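{- Let $(W,S)$ be a finite Coxeter system, $c$ a Coxeter element with reduced word $\mathbf{c}$, $s$ an initial letter of $c$, and $c'=scs$ with reduced word $\mathbf{c}'$. Let $\beta_1,\beta_2\in\Phi_{\geq-1}$. Then $\{\beta_1,\beta_2\}$ is a face of $\Delta(\mathbf{c}\mathbf{w}_\circ(\mathbf{c}),w_\circ)$ (positions identified with $\Phi_{\geq-1}$ via $\mathsf{Lr}_c$) if and only if $\{\sigma_s(\beta_1),\sigma_s(\beta_2)\}$ is a face of $\Delta(\mathbf{c}'\mathbf{w}_\circ(\mathbf{c}'),w_\circ)$ (positions identified with $\Phi_{\geq-1}$ via $\mathsf{Lr}_{c'}$).
   Context: $s$ is initial in $c$ if $\ell(sc)<\ell(c)$. $W$ acts on $V$ with simple roots $\{\alpha_t\}$, root system $\Phi$, positive roots $\Phi^+$, and $\Phi_{\geq-1}=\Phi^+\cup\{ -\alpha_t:t\in S\}$. The involution $\sigma_s$ of $\Phi_{\geq-1}$ is $\sigma_s(\beta)=\beta$ if $-\beta\in\{\alpha_t : t\neq s\}$, and $\sigma_s(\beta)=s(\beta)$ otherwise. $w_\circ$ is the longest element, $N=\ell(w_\circ)$. For a Coxeter element $d$ with reduced word $\mathbf{d}=(d_1,\dots,d_n)$, $\mathbf{w}_\circ(\mathbf{d})=(w_1,\dots,w_N)$ is the lexicographically first (as a sequence of positions) subword of $\mathbf{d}\mathbf{d}\cdots$ which is a reduced expression for $w_\circ$, and $\mathsf{Lr}_d$ is the bijection from positions of $(d_1,\dots,d_n,w_1,\dots,w_N)$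 to $\Phi_{\geq-1}$ sending $d_i\mapsto-\alpha_{d_i}$ and $w_i\mapsto w_1\cdots w_{i-1}(\alpha_{w_i})$. For a word $Q$ and $\pi\in W$, $\Delta(Q,\pi)$ is the simplicial complex on the positions of $Q$ whose faces are the sets $P$ of positions such that deleting them leaves a word containing a reduced expression for $\pi$ as a subword. -}

module Defs where

open import Data.Nat using (ℕ; zero; suc; _≤_; _<_; _+_)
open import Data.Fin using (Fin; toℕ; splitAt)
import Data.Fin as Fin
import Data.List.Membership.Propositional as LM
open import Data.Fin.Subset using (Subset; _∈_)
open import Data.Bool using (true; false)
open import Data.Vec using (Vec; []; _∷_)
open import Data.List using (List; []; _∷_; _++_; [_]; length; map; take; reverse; lookup; allFin)
open import Data.List.Relation.Unary.Linked using (Linked)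
open import Data.List.Relation.Binary.Permutation.Propositional using (_↭_)
open import Data.Product using (Σ; _×_; _,_; proj₂)
open import Data.Sum using (_⊎_; inj₁; inj₂)
open import Data.Unit using (⊤)
open import Data.Empty using (⊥)
open import Relation.Nullary using (¬_)
open import Relation.Binary.PropositionalEquality using (_≡_; _≢_)

-- Coxeter matrices (finite entries suffice: W is assumed finite)

record IsCoxeterMatrix {n : ℕ} (M : Fin n → Fin n → ℕ) : Set where
  field
    diag : ∀ s → M s s ≡ 1
    symm : ∀ s t → M s t ≡ M t s
    off  : ∀ s t → s ≢ t → 2 ≤ M s t

Word : ℕ → Set
Word n = List (Fin n)

alt : ∀ {n} → Fin n → Fin n → ℕ → Word n
alt s t zero    = []
alt s t (suc k) = s ∷ alt t s k

module _ {n : ℕ} (M : Fin n → Fin n → ℕ) where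

  -- equality in W = ⟨ S | s² = 1, (st)^{m(s,t)} = 1 ⟩ on words
  infix 4 _≈_
  data _≈_ : Word n → Word n → Set where
    ≈refl  : ∀ {u} → u ≈ u
    ≈sym   : ∀ {u v} → u ≈ v → v ≈ u
    ≈trans : ∀ {u v w} → u ≈ v → v ≈ w → u ≈ w
    ≈ctx   : ∀ {u v} (x y : Word n) → u ≈ v → (x ++ u ++ y) ≈ (x ++ v ++ y)
    ≈sq    : ∀ s → (s ∷ s ∷ []) ≈ []
    ≈braid : ∀ s t → alt s t (M s t) ≈ alt t s (M s t)

  FiniteW : Set
  FiniteW = Σ (List (Word n)) λ L → ∀ w → Σ (Word n) λ u → (u LM.∈ L) × (w ≈ u)

  Reduced : Word n → Set
  Reduced w = ∀ v → v ≈ w → length w ≤ length v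

  IsCoxeterElement : Word n → Set
  IsCoxeterElement c = Σ (Word n) λ p → (p ↭ allFin n) × (p ≈ c)

  Initial : Fin n → Word n → Set
  Initial s c = Σ (Word n) λ q → (q ≈ (s ∷ c)) × (∀ r → r ≈ c → length q < length r)

  Longest : Word n → Set
  Longest w0 = Reduced w0 × (∀ r → Reduced r → length r ≤ length w0)

  -- positions in c c c ⋯ : (copy index, position in c)
  Pos : ℕ → Set
  Pos m = ℕ × Fin m

  _<P_ : ∀ {m} → Pos m → Pos m → Set
  (k , j) <P (k' , j') = (k < k') ⊎ ((k ≡ k') × (toℕ j < toℕ j'))

  data LexLe {m : ℕ} : List (Pos m) → List (Pos m) → Set where
    lex[] : ∀ {ys} → LexLe [] ys
    lex<  : ∀ {p q xs ys} → p <P q → LexLe (p ∷ xs) (q ∷ ys)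
    lex≡  : ∀ {p xs ys} → LexLe xs ys → LexLe (p ∷ xs) (p ∷ ys)

  letters : (c : Word n) → List (Pos (length c)) → Word n
  letters c ws = map (λ p → lookup c (proj₂ p)) ws

  IsWoSubword : Word n → (c : Word n) → List (Pos (length c)) → Set
  IsWoSubword w0 c ws = Linked _<P_ ws × Reduced (letters c ws) × (letters c ws ≈ w0)

  -- ws is the lexicographically first (as sequence of positions) subword of
  -- c c c ⋯ that is a reduced expression for w0; w∘(c) = letters c ws
  IsLexFirstWo : Word n → (c : Word n) → List (Pos (length c)) → Set
  IsLexFirstWo w0 c ws = IsWoSubword w0 c ws
    × (∀ ws' → IsWoSubword w0 c ws' → LexLe ws ws')

  -- Φ_{≥-1}: negative simple roots, and positive roots encoded by their
  -- reflections (positive root u(α_t) ↔ reflection u t u⁻¹)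
  data Root : Set where
    neg : Fin n → Root
    pos : Word n → Root

  infix 4 _~_
  _~_ : Root → Root → Set
  neg t ~ neg t' = t ≡ t'
  pos r ~ pos r' = r ≈ r'
  neg _ ~ pos _  = ⊥
  pos _ ~ neg _  = ⊥

  InPhi : Root → Set
  InPhi (neg t) = ⊤
  InPhi (pos r) = Σ (Word n) λ u → Σ (Fin n) λ t → r ≈ (u ++ t ∷ reverse u)

  data Sigma (s : Fin n) : Root → Root → Set where
    σ-neg≠ : ∀ {t} → t ≢ s → Sigma s (neg t) (neg t)
    σ-negs : Sigma s (neg s) (pos [ s ])
    σ-poss : ∀ {r} → r ≈ [ s ] → Sigma s (pos r) (neg s)
    σ-pos≠ : ∀ {r} → ¬ (r ≈ [ s ]) → Sigma s (pos r) (pos (s ∷ r ++ [ s ]))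

  Qletter : (c w : Word n) → Fin (length c + length w) → Fin n
  Qletter c w i with splitAt (length c) i
  ... | inj₁ j = lookup c j
  ... | inj₂ k = lookup w k

  Lr : (c w : Word n) → Fin (length c + length w) → Root
  Lr c w i with splitAt (length c) i
  ... | inj₁ j = neg (lookup c j)
  ... | inj₂ k = pos (take (toℕ k) w ++ lookup w k ∷ reverse (take (toℕ k) w))

  sub : ∀ {m} → (Fin m → Fin n) → Subset m → Word n
  sub {zero}  f []           = []
  sub {suc m} f (true  ∷ bs) = f Fin.zero ∷ sub (λ i → f (Fin.suc i)) bs
  sub {suc m} f (false ∷ bs) = sub (λ i → f (Fin.suc i)) bs

  -- {β₁,β₂} (via Lr) is a face of Δ(c w, w0): deleting the positions Lr⁻¹{β₁,β₂}
  -- leaves a word containing a reduced expression for w0 as a subword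
  Face : (w0 c w : Word n) → Root → Root → Set
  Face w0 c w β₁ β₂ = Σ (Subset (length c + length w)) λ X →
      (∀ i → i ∈ X → ¬ (Lr c w i ~ β₁) × ¬ (Lr c w i ~ β₂))
    × (sub (Qletter c w) X ≈ w0) × Reduced (sub (Qletter c w) X)

{-# OPTIONS --safe #-}

-- Let s be initial in c, so that c = s d and c′ = d s up to commutations of letters.  If w∘(c) = s w and
-- w∘(c′) = w r up to commutations, then the word c′ w∘(c′) arises from c w∘(c) by moving the first letter s to
-- the end, where it becomes r = w∘ s w∘; on the labels this rotation is σ_s, and it carries subwords that are
-- reduced expressions for w∘ to such subwords.
--
-- The point is that w∘(c) is c-adapted: each of its letters is a source of the orientation of the Coxeter graph
-- given by c, which is then reversed at that letter.  Adapted reduced words of an element are unique up to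
-- commutations, which gives s w and w r as above.  To prove adaptedness, w∘(c) is read off c c c ⋯ greedily, and
-- one shows that once a letter t is skipped, i.e. is a descent of the word x taken so far, every neighbour r
-- following t is a descent of x as well.  This uses the Euler form E_c on the root space, which satisfies
-- E_{scs}(s v, s w) = E_c(v, w) for s initial in c: if x α_t < 0 < x α_r, then after removing a prefix of x one
-- may assume that x α_t is a negative multiple of some α_s with s initial, and the signs of E_c(x α_t, x α_r) and
-- E_c(x α_r, x α_t) become contradictory.
--
-- No real numbers are involved: 2cos(π/m) is replaced by the adjacency operator of a path with m − 1 vertices,
-- so that roots become integer vectors.

module Submission where

open import Defs
open import Data.Bool using (Bool; true; false; not; _xor_; if_then_else_)
open import Data.Bool.Properties using (not-distribˡ-xor; not-¬)
open import Data.Empty using (⊥)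
open import Data.Fin using (Fin; zero; suc; toℕ; splitAt; punchOut; punchIn)
import Data.Fin.Properties as Finₚ
open import Data.Fin.Subset as Sub using (Subset)
open import Data.Integer as ℤ using (ℤ; 0ℤ; 1ℤ; -_; _+_; _*_; _-_)
import Data.Integer.Properties as ℤₚ
open import Data.Integer.Tactic.RingSolver using (solve-∀)
open import Data.List using (List; []; _∷_; _++_; [_]; length; map; take; reverse; lookup; allFin; tabulate; foldl; _∷ʳ_; initLast; _∷ʳ′_)
open import Data.List.Membership.DecPropositional using (_∈?_)
open import Data.List.Membership.Propositional using (_∈_; _∉_)
open import Data.List.Membership.Propositional.Properties using (∈-∃++; ∈-++⁺ˡ; ∈-++⁺ʳ; ∈-++⁻; ∈-allFin)
open import Data.List.Properties using (++-assoc; ++-identityʳ; length-++; length-reverse; unfold-reverse; foldl-++; reverse-involutive; map-++; tabulate-cong)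
open import Data.List.Relation.Binary.Permutation.Propositional using (_↭_; ↭-sym; ↭-trans; ↭-refl; prep; ↭⇒↭ₛ)
open import Data.List.Relation.Binary.Permutation.Propositional.Properties using (↭-length; ∈-resp-↭; shift; ++-comm)
import Data.List.Relation.Binary.Permutation.Setoid.Properties as PermS
open import Data.List.Relation.Unary.All as All using (All; []; _∷_)
open import Data.List.Relation.Unary.AllPairs using ([]; _∷_)
open import Data.List.Relation.Unary.Any using (here; there; index)
open import Data.List.Relation.Unary.Any.Properties using (lookup-index)
open import Data.List.Relation.Unary.Linked using (Linked; []; [-]; _∷_)
open import Data.List.Relation.Unary.Unique.Propositional using (Unique)
open import Data.List.Relation.Unary.Unique.Propositional.Properties using (allFin⁺; Unique[x∷xs]⇒x∉xs)
open import Data.Nat as ℕ using (ℕ; zero; suc; pred; _≤_; _<_; z≤n; s≤s; NonZero)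
open import Data.Nat.DivMod using (_/_; _%_; m≡m%n+[m/n]*n; m%n<n)
open import Data.Nat.Divisibility using (_∣_; _∣?_; ∣-refl; ∣-trans; ∣m+n∣m⇒∣n; ∣m∣n⇒∣m+n; m∣m*n; n∣m*n; >⇒∤; 1∣_; _∣0)
open import Data.Nat.Induction using (<-wellFounded)
import Data.Nat.Properties as ℕₚ
open import Data.Product using (Σ; ∃; _×_; _,_; proj₁; proj₂)
open import Data.Sum using (_⊎_; inj₁; inj₂)
open import Data.Unit using (⊤; tt)
import Data.Vec as Vec
open import Data.Vec using ([]; _∷_)
open import Function using (_∘_)
open import Function.Bundles using (_⇔_; mk⇔; module Equivalence)
open import Induction.WellFounded using (Acc; acc)
open import Relation.Binary.Bundles using (Setoid)
open import Relation.Binary.Definitions using (tri<; tri≈; tri>)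
open import Relation.Binary.PropositionalEquality using (_≡_; _≢_; refl; sym; trans; cong; cong₂; subst; subst₂; setoid; module ≡-Reasoning)
import Relation.Binary.Reasoning.Setoid as SetoidReasoning
open import Relation.Nullary using (¬_; Dec; yes; no; does)
open import Relation.Nullary.Decidable using (map′; dec-true; dec-false)
open import Relation.Nullary.Negation using (contradiction)
open import Algebra.Properties.CommutativeMonoid.Sum ℤₚ.+-0-commutativeMonoid using (sum; sum-cong-≗; ∑-distrib-+)

-- Two facts about 2cos(π/m) carry the theory of roots: the Chebyshev polynomial U_{m-1}(x/2)
-- vanishes there, which gives the braid relation, and those of lower degree are non-negative there,
-- which gives every root a sign. For the adjacency operator A of a path with m - 1 vertices,
-- U_{m-1}(A/2) = 0 because A has the eigenvalues 2cos(kπ/m) with 0 < k < m, and the matrices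
-- U_j(A/2) with j < m have non-negative entries; the proof reads both facts off a wave equation.
-- All operators act on functions on ℕ, so one space serves every pair of letters. The price is that
-- the coefficient of a simple root is a function: signs are proved for all non-negative
-- coefficients at once, and the Euler form sums over an initial segment of ℕ that cuts no path.
--
-- Finiteness of W only supplies a list of words that may name an element several times. Lengths and
-- descents presuppose that equality in W is decided, so this comes first.
--
-- Words are controlled only up to commutations, and labels have to follow them. Faces are therefore
-- handled as subwords of lists of labelled letters, on which commutations act.

-- Words as elements of W, and decidability of equality in W

module Words {n : ℕ} (M : Fin n → Fin n → ℕ) where

  infix 4 _≋_
  _≋_ : Word n → Word n → Set
  _≋_ = _≈_ M

  ≋-setoid : Setoid _ _
  ≋-setoid = record { Carrier = Word n ; _≈_ = _≋_
    ; isEquivalence = record { refl = ≈refl ; sym = ≈sym ; trans = ≈trans } }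

  ≡⇒≋ : ∀ {u v} → u ≡ v → u ≋ v
  ≡⇒≋ refl = ≈refl

  ++-congˡ : ∀ x {u v} → u ≋ v → x ++ u ≋ x ++ v
  ++-congˡ x {u} {v} p = subst (λ z → x ++ z ≋ x ++ v) (++-identityʳ u)
    (subst (λ z → x ++ u ++ [] ≋ x ++ z) (++-identityʳ v) (≈ctx x [] p))

  ++-congʳ : ∀ y {u v} → u ≋ v → u ++ y ≋ v ++ y
  ++-congʳ y p = ≈ctx [] y p

  ∷-cong : ∀ s {u v} → u ≋ v → s ∷ u ≋ s ∷ v
  ∷-cong s = ++-congˡ [ s ]

  ∷-cancel : ∀ s u → s ∷ s ∷ u ≋ u
  ∷-cancel s u = ++-congʳ u (≈sq s)

  inverseʳ : ∀ w → w ++ reverse w ≋ []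
  inverseʳ []      = ≈refl
  inverseʳ (s ∷ w) = ≈trans (≡⇒≋ (trans (cong ((s ∷ w) ++_) (unfold-reverse s w)) (cong (s ∷_) (sym (++-assoc w (reverse w) [ s ])))))
    (≈trans (∷-cong s (++-congʳ [ s ] (inverseʳ w))) (≈sq s))

  inverseˡ : ∀ w → reverse w ++ w ≋ []
  inverseˡ []      = ≈refl
  inverseˡ (s ∷ w) = ≈trans (≡⇒≋ (trans (cong (_++ (s ∷ w)) (unfold-reverse s w)) (++-assoc (reverse w) [ s ] (s ∷ w))))
    (≈trans (++-congˡ (reverse w) (∷-cancel s w)) (inverseˡ w))

  cancelˡ : ∀ x {u v} → x ++ u ≋ x ++ v → u ≋ v
  cancelˡ x {u} {v} p = begin
    u                        ≈⟨ ++-congʳ u (≈sym (inverseˡ x)) ⟩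
    (reverse x ++ x) ++ u    ≡⟨ ++-assoc (reverse x) x u ⟩
    reverse x ++ x ++ u      ≈⟨ ++-congˡ (reverse x) p ⟩
    reverse x ++ x ++ v      ≡⟨ ++-assoc (reverse x) x v ⟨
    (reverse x ++ x) ++ v    ≈⟨ ++-congʳ v (inverseˡ x) ⟩
    v ∎
    where open SetoidReasoning ≋-setoid

  cancelʳ : ∀ y {u v} → u ++ y ≋ v ++ y → u ≋ v
  cancelʳ y {u} {v} p = begin
    u                        ≡⟨ ++-identityʳ u ⟨
    u ++ []                  ≈⟨ ++-congˡ u (≈sym (inverseʳ y)) ⟩
    u ++ y ++ reverse y      ≡⟨ ++-assoc u y (reverse y) ⟨
    (u ++ y) ++ reverse y    ≈⟨ ++-congʳ (reverse y) p ⟩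
    (v ++ y) ++ reverse y    ≡⟨ ++-assoc v y (reverse y) ⟩
    v ++ y ++ reverse y      ≈⟨ ++-congˡ v (inverseʳ y) ⟩
    v ++ []                  ≡⟨ ++-identityʳ v ⟩
    v ∎
    where open SetoidReasoning ≋-setoid

  reverse-cong : ∀ {u v} → u ≋ v → reverse u ≋ reverse v
  reverse-cong {u} {v} p = cancelˡ v (≈trans (++-congʳ (reverse u) (≈sym p)) (≈trans (inverseʳ u) (≈sym (inverseʳ v))))

  snoc-cancel : ∀ w s → (w ∷ʳ s) ∷ʳ s ≋ w
  snoc-cancel w s = ≈trans (≡⇒≋ (++-assoc w [ s ] [ s ])) (≈trans (++-congˡ w (≈sq s)) (≡⇒≋ (++-identityʳ w)))

  -- Word problem

  Cover : ℕ → Set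
  Cover k = Σ (Fin k → Word n) λ L → ∀ w → ∃ λ i → w ≋ L i

  merge : ∀ {k} (C : Cover (suc k)) (i j : Fin (suc k)) → i ≢ j → proj₁ C i ≋ proj₁ C j → Cover k
  merge (L , cov) i j i≢j p = (λ a → L (punchIn i a)) , λ w → go w (cov w)
    where
    go : ∀ w → (∃ λ a → w ≋ L a) → ∃ λ a → w ≋ L (punchIn i a)
    go w (a , q) with i Finₚ.≟ a
    ... | no  i≢a  = punchOut i≢a , ≈trans q (≡⇒≋ (cong L (sym (Finₚ.punchIn-punchOut i≢a))))
    ... | yes refl = punchOut i≢j , ≈trans q (≈trans p (≡⇒≋ (cong L (sym (Finₚ.punchIn-punchOut i≢j)))))

  -- A coset table for the trivial subgroup: indices of representatives are the states, and a letter
  -- leads to some representative of the product. Several indices may represent the same element.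
  module Table {k : ℕ} (C : Cover k) where
    L : Fin k → Word n
    L = proj₁ C

    act : Fin k → Fin n → Fin k
    act i s = proj₁ (proj₂ C (L i ∷ʳ s))

    run : Fin k → Word n → Fin k
    run = foldl act

    run-sound : ∀ i w → L i ++ w ≋ L (run i w)
    run-sound i []      = ≡⇒≋ (++-identityʳ (L i))
    run-sound i (s ∷ w) = ≈trans (≡⇒≋ (sym (++-assoc (L i) [ s ] w)))
      (≈trans (++-congʳ w (proj₂ (proj₂ C (L i ∷ʳ s)))) (run-sound (act i s) w))

    start : Fin k
    start = proj₁ (proj₂ C [])

    run-start : ∀ w → w ≋ L (run start w)
    run-start w = ≈trans (++-congʳ w (proj₂ (proj₂ C []))) (run-sound start w)

    Consistent : Set
    Consistent = (∀ s i → run i (s ∷ s ∷ []) ≡ i)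
               × (∀ s t i → run i (alt s t (M s t)) ≡ run i (alt t s (M s t)))

    run-cong : Consistent → ∀ {u v} → u ≋ v → ∀ i → run i u ≡ run i v
    run-cong ok ≈refl i         = refl
    run-cong ok (≈sym p) i      = sym (run-cong ok p i)
    run-cong ok (≈trans p q) i  = trans (run-cong ok p i) (run-cong ok q i)
    run-cong ok (≈ctx {u} {v} x y p) i = begin
      run i (x ++ u ++ y)           ≡⟨ foldl-++ act i x (u ++ y) ⟩
      run (run i x) (u ++ y)        ≡⟨ foldl-++ act (run i x) u y ⟩
      run (run (run i x) u) y       ≡⟨ cong (λ a → run a y) (run-cong ok p (run i x)) ⟩
      run (run (run i x) v) y       ≡⟨ foldl-++ act (run i x) v y ⟨
      run (run i x) (v ++ y)        ≡⟨ foldl-++ act i x (v ++ y) ⟨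
      run i (x ++ v ++ y) ∎
      where open ≡-Reasoning
    run-cong ok (≈sq s) i       = proj₁ ok s i
    run-cong ok (≈braid s t) i  = proj₂ ok s t i

    -- A consistent table is a right action of W on the indices, so equal words reach the same index
    -- from `start`. Conversely, a word equals the representative that it reaches.
    decide : Consistent → ∀ u v → Dec (u ≋ v)
    decide ok u v = map′
      (λ e → ≈trans (run-start u) (≈trans (≡⇒≋ (cong L e)) (≈sym (run-start v))))
      (λ p → run-cong ok p start)
      (run start u Finₚ.≟ run start v)

    Collision : Set
    Collision = Σ (Fin k) λ i → Σ (Fin k) λ j → i ≢ j × L i ≋ L j

    check : Consistent ⊎ Collision
    check with Finₚ.all? (λ s → Finₚ.all? (λ i → run i (s ∷ s ∷ []) Finₚ.≟ i))
    ... | no ¬p = inj₂ (let (s , q) = Finₚ.¬∀⟶∃¬ n _ (λ s → Finₚ.all? (λ i → run i (s ∷ s ∷ []) Finₚ.≟ i)) ¬p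
                            (i , r) = Finₚ.¬∀⟶∃¬ k _ (λ i → run i (s ∷ s ∷ []) Finₚ.≟ i) q
                        in run i (s ∷ s ∷ []) , i , r
                         , ≈trans (≈sym (run-sound i (s ∷ s ∷ []))) (≈trans (++-congˡ (L i) (≈sq s)) (≡⇒≋ (++-identityʳ (L i)))))
    ... | yes p with Finₚ.all? (λ s → Finₚ.all? (λ t → Finₚ.all? (λ i → run i (alt s t (M s t)) Finₚ.≟ run i (alt t s (M s t)))))
    ...   | yes q = inj₁ (p , q)
    ...   | no ¬q = inj₂ (let (s , q₁) = Finₚ.¬∀⟶∃¬ n _ (λ s → Finₚ.all? (λ t → Finₚ.all? (λ i → run i (alt s t (M s t)) Finₚ.≟ run i (alt t s (M s t))))) ¬q
                              (t , q₂) = Finₚ.¬∀⟶∃¬ n _ (λ t → Finₚ.all? (λ i → run i (alt s t (M s t)) Finₚ.≟ run i (alt t s (M s t)))) q₁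
                              (i , q₃) = Finₚ.¬∀⟶∃¬ k _ (λ i → run i (alt s t (M s t)) Finₚ.≟ run i (alt t s (M s t))) q₂
                          in _ , _ , q₃
                           , ≈trans (≈sym (run-sound i (alt s t (M s t)))) (≈trans (++-congˡ (L i) (≈braid s t)) (run-sound i (alt t s (M s t)))))

  -- If the table violates a relation of W, then two of the representatives are equal in W and one is redundant.
  cover⇒dec : ∀ k → Cover k → ∀ u v → Dec (u ≋ v)
  cover⇒dec zero (_ , cov) u v with () ← proj₁ (cov u)
  cover⇒dec (suc k) C with Table.check C
  ... | inj₁ ok               = Table.decide C ok
  ... | inj₂ (i , j , i≢j , p) = cover⇒dec k (merge C i j i≢j p)

  ≋-dec : FiniteW M → ∀ u v → Dec (u ≋ v)
  ≋-dec (L , cov) = cover⇒dec (length L) (lookup L , λ w → let (u , u∈L , p) = cov w in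
    index u∈L , ≈trans p (≡⇒≋ (lookup-index u∈L)))

  odd : ℕ → Bool
  odd zero    = false
  odd (suc k) = not (odd k)

  odd-+ : ∀ a b → odd (a ℕ.+ b) ≡ odd a xor odd b
  odd-+ zero b    = refl
  odd-+ (suc a) b = trans (cong not (odd-+ a b)) (not-distribˡ-xor (odd a) (odd b))

  odd-length-++ : ∀ (u v : Word n) → odd (length (u ++ v)) ≡ odd (length u) xor odd (length v)
  odd-length-++ u v = trans (cong odd (length-++ u)) (odd-+ (length u) (length v))

  length-alt : ∀ (s t : Fin n) k → length (alt s t k) ≡ k
  length-alt s t zero    = refl
  length-alt s t (suc k) = cong suc (length-alt t s k)

  odd-length-cong : ∀ {u v} → u ≋ v → odd (length u) ≡ odd (length v)
  odd-length-cong ≈refl = refl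
  odd-length-cong (≈sym p) = sym (odd-length-cong p)
  odd-length-cong (≈trans p q) = trans (odd-length-cong p) (odd-length-cong q)
  odd-length-cong (≈ctx {u} {v} x y p) = begin
    odd (length (x ++ u ++ y))                                ≡⟨ odd-length-++ x (u ++ y) ⟩
    odd (length x) xor odd (length (u ++ y))                  ≡⟨ cong (odd (length x) xor_) (odd-length-++ u y) ⟩
    odd (length x) xor (odd (length u) xor odd (length y))    ≡⟨ cong (λ b → odd (length x) xor (b xor odd (length y))) (odd-length-cong p) ⟩
    odd (length x) xor (odd (length v) xor odd (length y))    ≡⟨ cong (odd (length x) xor_) (odd-length-++ v y) ⟨
    odd (length x) xor odd (length (v ++ y))                  ≡⟨ odd-length-++ x (v ++ y) ⟨
    odd (length (x ++ v ++ y)) ∎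
    where open ≡-Reasoning
  odd-length-cong (≈sq s) = refl
  odd-length-cong (≈braid s t) = cong odd (trans (length-alt s t (M s t)) (sym (length-alt t s (M s t))))

-- Length function, ascents and descents

module Length {n : ℕ} (M : Fin n → Fin n → ℕ) (_≋?_ : ∀ u v → Dec (_≈_ M u v)) where
  open Words M

  any-word? : ∀ k {P : Word n → Set} → (∀ w → Dec (P w)) → Dec (Σ (Word n) λ w → length w ≡ k × P w)
  any-word? zero P? = map′ (λ p → [] , refl , p) (λ { ([] , _ , p) → p }) (P? [])
  any-word? (suc k) P? = map′ (λ (s , w , e , p) → s ∷ w , cong suc e , p)
    (λ { (s ∷ w , e , p) → s , w , ℕₚ.suc-injective e , p })
    (Finₚ.any? (λ s → any-word? k (λ w → P? (s ∷ w))))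

  least : {P : ℕ → Set} → (∀ k → Dec (P k)) → ∀ N → P N → ∃ λ k → P k × (∀ j → P j → k ≤ j)
  least P? zero p = zero , p , λ _ _ → z≤n
  least {P} P? (suc N) p with P? zero
  ... | yes p₀ = zero , p₀ , λ _ _ → z≤n
  ... | no ¬p₀ with (k , q , min) ← least {P ∘ suc} (P? ∘ suc) N p
      = suc k , q , λ { zero r → contradiction r ¬p₀ ; (suc j) r → s≤s (min j r) }

  abstract
    shortest : ∀ w → ∃ λ k → (Σ (Word n) λ v → length v ≡ k × v ≋ w) × (∀ j → (Σ (Word n) λ v → length v ≡ j × v ≋ w) → k ≤ j)
    shortest w = least (λ k → any-word? k (_≋? w)) (length w) (w , refl , ≈refl)

  len : Word n → ℕ
  len w = proj₁ (shortest w)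

  red : Word n → Word n
  red w = proj₁ (proj₁ (proj₂ (shortest w)))

  length-red : ∀ w → length (red w) ≡ len w
  length-red w = proj₁ (proj₂ (proj₁ (proj₂ (shortest w))))

  red-≋ : ∀ w → red w ≋ w
  red-≋ w = proj₂ (proj₂ (proj₁ (proj₂ (shortest w))))

  len-min : ∀ {w v} → v ≋ w → len w ≤ length v
  len-min {w} {v} p = proj₂ (proj₂ (shortest w)) (length v) (v , refl , p)

  len-cong : ∀ {u v} → u ≋ v → len u ≡ len v
  len-cong {u} {v} p = ℕₚ.≤-antisym (le p) (le (≈sym p))
    where
    le : ∀ {u v} → u ≋ v → len u ≤ len v
    le {u} {v} p = ℕₚ.≤-trans (len-min (≈trans (red-≋ v) (≈sym p))) (ℕₚ.≤-reflexive (length-red v))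

  len≤length : ∀ w → len w ≤ length w
  len≤length w = len-min ≈refl

  reduced⇒len : ∀ {w} → Reduced M w → len w ≡ length w
  reduced⇒len {w} r = ℕₚ.≤-antisym (len≤length w) (ℕₚ.≤-trans (r (red w) (red-≋ w)) (ℕₚ.≤-reflexive (length-red w)))

  len⇒reduced : ∀ {w} → length w ≤ len w → Reduced M w
  len⇒reduced p v q = ℕₚ.≤-trans p (len-min q)

  red-reduced : ∀ w → Reduced M (red w)
  red-reduced w = len⇒reduced (ℕₚ.≤-reflexive (trans (length-red w) (sym (len-cong (red-≋ w)))))

  len-++ : ∀ u v → len (u ++ v) ≤ len u ℕ.+ len v
  len-++ u v = ℕₚ.≤-trans (len-min (≈trans (++-congʳ (red v) (red-≋ u)) (++-congˡ u (red-≋ v))))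
    (ℕₚ.≤-reflexive (trans (length-++ (red u)) (cong₂ ℕ._+_ (length-red u) (length-red v))))

  len-reverse : ∀ w → len (reverse w) ≡ len w
  len-reverse w = ℕₚ.≤-antisym (le w) (ℕₚ.≤-trans (ℕₚ.≤-reflexive (len-cong (≡⇒≋ (sym (reverse-involutive w))))) (le (reverse w)))
    where
    le : ∀ w → len (reverse w) ≤ len w
    le w = ℕₚ.≤-trans (len-min (reverse-cong (red-≋ w))) (ℕₚ.≤-reflexive (trans (length-reverse (red w)) (length-red w)))

  odd-len : ∀ w → odd (len w) ≡ odd (length w)
  odd-len w = trans (cong odd (sym (length-red w))) (odd-length-cong (red-≋ w))

  Ascent Descent : Word n → Fin n → Set
  Ascent  w s = len (w ++ [ s ]) ≡ suc (len w)
  Descent w s = len w ≡ suc (len (w ++ [ s ]))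

  len-snoc≤ : ∀ w s → len (w ++ [ s ]) ≤ suc (len w)
  len-snoc≤ w s = ℕₚ.≤-trans (len-++ w [ s ]) (ℕₚ.≤-trans (ℕₚ.+-monoʳ-≤ (len w) (len≤length [ s ])) (ℕₚ.≤-reflexive (ℕₚ.+-comm (len w) 1)))

  len≤snoc : ∀ w s → len w ≤ suc (len (w ++ [ s ]))
  len≤snoc w s = ℕₚ.≤-trans (ℕₚ.≤-reflexive (len-cong (≈sym (snoc-cancel w s)))) (len-snoc≤ (w ++ [ s ]) s)

  -- Every relation of W preserves the parity of the number of letters, and appending a letter
  -- changes it.
  len-snoc≢ : ∀ w s → len (w ++ [ s ]) ≢ len w
  len-snoc≢ w s e = not-¬ refl (sym (trans (sym (odd-length-snoc w)) (trans (sym (odd-len (w ++ [ s ]))) (trans (cong odd e) (odd-len w)))))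
    where
    odd-length-snoc : ∀ w → odd (length (w ++ [ s ])) ≡ not (odd (length w))
    odd-length-snoc w = trans (cong odd (length-++ w)) (cong odd (ℕₚ.+-comm (length w) 1))

  ascent⊎descent : ∀ w s → Ascent w s ⊎ Descent w s
  ascent⊎descent w s with ℕₚ.<-cmp (len (w ++ [ s ])) (len w)
  ... | tri< lt _ _ = inj₂ (ℕₚ.≤-antisym (len≤snoc w s) lt)
  ... | tri≈ _ e _  = contradiction e (len-snoc≢ w s)
  ... | tri> _ _ gt = inj₁ (ℕₚ.≤-antisym (len-snoc≤ w s) gt)

  ascent⇒¬descent : ∀ {w s} → Ascent w s → ¬ Descent w s
  ascent⇒¬descent {w} {s} a d = ℕₚ.<-irrefl (trans d (cong suc a)) (ℕₚ.m<n⇒m<1+n (ℕₚ.n<1+n (len w)))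

  ¬ascent⇒descent : ∀ {w s} → ¬ Ascent w s → Descent w s
  ¬ascent⇒descent {w} {s} ¬a with ascent⊎descent w s
  ... | inj₁ a = contradiction a ¬a
  ... | inj₂ d = d

  descent-cong : ∀ {u v s} → u ≋ v → Descent u s → Descent v s
  descent-cong {s = s} p d = trans (len-cong (≈sym p)) (trans d (cong suc (len-cong (++-congʳ [ s ] p))))

  descent⇒ascent : ∀ {w s} → Descent w s → Ascent (w ++ [ s ]) s
  descent⇒ascent {w} {s} d = trans (len-cong (snoc-cancel w s)) d

  reduced-++ˡ : ∀ u v → Reduced M (u ++ v) → Reduced M u
  reduced-++ˡ u v r w p = ℕₚ.+-cancelʳ-≤ (length v) (length u) (length w)
    (subst₂ _≤_ (length-++ u) (length-++ w) (r (w ++ v) (++-congʳ v p)))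

  reduced-++ʳ : ∀ u v → Reduced M (u ++ v) → Reduced M v
  reduced-++ʳ u v r w p = ℕₚ.+-cancelˡ-≤ (length u) (length v) (length w)
    (subst₂ _≤_ (length-++ u) (length-++ u) (r (u ++ w) (++-congˡ u p)))

  reduced-cong : ∀ {u v} → u ≋ v → length u ≡ length v → Reduced M u → Reduced M v
  reduced-cong p e r w q = ℕₚ.≤-trans (ℕₚ.≤-reflexive (sym e)) (r w (≈trans q (≈sym p)))

  length-snoc : ∀ (w : Word n) s → length (w ++ [ s ]) ≡ suc (length w)
  length-snoc w s = trans (length-++ w) (ℕₚ.+-comm (length w) 1)

  reduced-snoc⇒ascent : ∀ {w s} → Reduced M (w ++ [ s ]) → Ascent w s
  reduced-snoc⇒ascent {w} {s} r = trans (reduced⇒len r)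
    (trans (length-snoc w s) (cong suc (sym (reduced⇒len (reduced-++ˡ w [ s ] r)))))

  ascent⇒reduced-snoc : ∀ {w s} → Reduced M w → Ascent w s → Reduced M (w ++ [ s ])
  ascent⇒reduced-snoc {w} {s} r a = len⇒reduced (ℕₚ.≤-reflexive
    (trans (length-snoc w s) (trans (cong suc (sym (reduced⇒len r))) (sym a))))

  reduced-≋-length : ∀ {u v} → Reduced M u → Reduced M v → u ≋ v → length u ≡ length v
  reduced-≋-length r r′ p = trans (sym (reduced⇒len r)) (trans (len-cong p) (reduced⇒len r′))

-- Wave equation and Chebyshev polynomials of paths

-- The recurrence of the Chebyshev polynomials P b of the adjacency operator of a path, read at its vertices a, is
-- a discrete wave equation on a strip of width m.  Its solution is symmetric in a and b, so that the boundary
-- condition at a = m forces it to vanish at time b = m.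
module Wave (m : ℕ) (N : ℕ → ℕ → ℤ)
  (zero-time : ∀ a → N 0 a ≡ 0ℤ) (left : ∀ b → N b 0 ≡ 0ℤ) (right : ∀ b → N b m ≡ 0ℤ)
  (wave : ∀ b a → suc a < m → N (suc (suc b)) (suc a) ≡ N (suc b) (suc (suc a)) + N (suc b) a - N b (suc a))
  where

  -- By the wave equation, the difference of the values at (b + 1, a) and (b, a + 1) is unchanged
  -- when both indices grow by one; it is evaluated at time 0.
  diagonal-step : ∀ b a → b ≤ a → a < m → N (suc b) a ≡ N b (suc a) + N 1 (a ℕ.∸ b)
  diagonal-step zero a _ _ = sym (trans (cong (_+ N 1 a) (zero-time (suc a))) (ℤₚ.+-identityˡ (N 1 a)))
  diagonal-step (suc b) (suc a) (s≤s b≤a) a<m = begin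
    N (suc (suc b)) (suc a)                                ≡⟨ wave b a a<m ⟩
    N (suc b) (suc (suc a)) + N (suc b) a - N b (suc a)    ≡⟨ cong (λ z → N (suc b) (suc (suc a)) + z - N b (suc a)) (diagonal-step b a b≤a (ℕₚ.<-trans (ℕₚ.n<1+n a) a<m)) ⟩
    N (suc b) (suc (suc a)) + (N b (suc a) + N 1 (a ℕ.∸ b)) - N b (suc a)  ≡⟨ ring (N (suc b) (suc (suc a))) (N b (suc a)) (N 1 (a ℕ.∸ b)) ⟩
    N (suc b) (suc (suc a)) + N 1 (a ℕ.∸ b) ∎
    where
    open ≡-Reasoning
    ring : ∀ x y z → x + (y + z) - y ≡ x + z
    ring = solve-∀

  -- Induction on the distance δ from the diagonal. Distance 1 is `diagonal-step` with boundary
  -- value `N 1 0` = 0; for larger δ the wave equation is applied on both sides of the diagonal, and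
  -- the terms in between are symmetric by induction.
  symmetric-from : ∀ δ a → δ ℕ.+ a ≤ m → N (δ ℕ.+ a) a ≡ N a (δ ℕ.+ a)
  symmetric-from zero a _ = refl
  symmetric-from (suc zero) a a<m = trans (diagonal-step a a ℕₚ.≤-refl a<m)
    (trans (cong (N a (suc a) +_) (trans (cong (N 1) (ℕₚ.n∸n≡0 a)) (left 1))) (ℤₚ.+-identityʳ _))
  symmetric-from (suc (suc δ)) zero _ = trans (left _) (sym (zero-time _))
  symmetric-from (suc (suc δ)) (suc a) le = begin
    N (suc (suc (δ ℕ.+ suc a))) (suc a)
      ≡⟨ wave (δ ℕ.+ suc a) a (ℕₚ.≤-trans (s≤s (ℕₚ.≤-trans (ℕₚ.m≤n+m (suc a) δ) (ℕₚ.n≤1+n _))) le) ⟩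
    N (suc (δ ℕ.+ suc a)) (suc (suc a)) + N (suc (δ ℕ.+ suc a)) a - N (δ ℕ.+ suc a) (suc a)
      ≡⟨ cong₂ _-_ (cong₂ _+_
          (subst (λ z → N z (suc (suc a)) ≡ N (suc (suc a)) z) (ℕₚ.+-suc δ (suc a))
            (symmetric-from δ (suc (suc a)) (subst (_≤ m) (sym (ℕₚ.+-suc δ (suc a))) (ℕₚ.≤-trans (ℕₚ.n≤1+n _) le))))
          (subst (λ z → N z a ≡ N a z) (cong suc (sym (ℕₚ.+-suc δ a)))
            (symmetric-from (suc (suc δ)) a (subst (_≤ m) (cong suc (ℕₚ.+-suc δ a)) (ℕₚ.≤-trans (ℕₚ.n≤1+n _) le)))))
         (symmetric-from δ (suc a) (ℕₚ.≤-trans (ℕₚ.≤-trans (ℕₚ.n≤1+n _) (ℕₚ.n≤1+n _)) le)) ⟩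
    N (suc (suc a)) (suc (δ ℕ.+ suc a)) + N a (suc (δ ℕ.+ suc a)) - N (suc a) (δ ℕ.+ suc a)
      ≡⟨ cong (λ z → z + N a (suc (δ ℕ.+ suc a)) - N (suc a) (δ ℕ.+ suc a)) (wave a (δ ℕ.+ suc a) le) ⟩
    N (suc a) (suc (suc (δ ℕ.+ suc a))) + N (suc a) (δ ℕ.+ suc a) - N a (suc (δ ℕ.+ suc a)) + N a (suc (δ ℕ.+ suc a)) - N (suc a) (δ ℕ.+ suc a)
      ≡⟨ ring (N (suc a) (suc (suc (δ ℕ.+ suc a)))) (N (suc a) (δ ℕ.+ suc a)) (N a (suc (δ ℕ.+ suc a))) ⟩
    N (suc a) (suc (suc (δ ℕ.+ suc a))) ∎
    where
    open ≡-Reasoning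
    ring : ∀ x y z → x + y - z + z - y ≡ x
    ring = solve-∀

  symmetric : ∀ {b a} → a ≤ b → b ≤ m → N b a ≡ N a b
  symmetric {b} {a} a≤b b≤m = subst (λ z → N z a ≡ N a z) (ℕₚ.m∸n+n≡m a≤b)
    (symmetric-from (b ℕ.∸ a) a (subst (_≤ m) (sym (ℕₚ.m∸n+n≡m a≤b)) b≤m))

  vanishes : ∀ a → a ≤ m → N m a ≡ 0ℤ
  vanishes a a≤m = trans (symmetric a≤m ℕₚ.≤-refl) (right a)

  module _ (initial : ∀ a → 0ℤ ℤ.≤ N 1 a) where

    nonneg-below : ∀ b a → b ≤ suc a → a ≤ m → 0ℤ ℤ.≤ N b a
    nonneg-below zero a _ _ = ℤₚ.≤-reflexive (sym (zero-time a))
    nonneg-below (suc b) a (s≤s b≤a) a≤m with ℕₚ.m≤n⇒m<n∨m≡n a≤m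
    ... | inj₂ refl = ℤₚ.≤-reflexive (sym (right (suc b)))
    -- Unrolling along the diagonal writes the value as a sum of initial values, until time 0 or the
    -- wall a = m is reached.
    ... | inj₁ a<m  = subst (0ℤ ℤ.≤_) (sym (diagonal-step b a b≤a a<m))
      (ℤₚ.+-mono-≤ (nonneg-below b (suc a) (ℕₚ.≤-trans b≤a (ℕₚ.≤-trans (ℕₚ.n≤1+n a) (ℕₚ.n≤1+n (suc a)))) a<m) (initial (a ℕ.∸ b)))

    nonneg : ∀ b a → b ≤ m → a ≤ m → 0ℤ ℤ.≤ N b a
    nonneg b a b≤m a≤m with ℕₚ.≤-total a b
    ... | inj₂ b≤a = nonneg-below b a (ℕₚ.≤-trans b≤a (ℕₚ.n≤1+n a)) a≤m
    ... | inj₁ a≤b = subst (0ℤ ℤ.≤_) (sym (symmetric a≤b b≤m)) (nonneg-below a b (ℕₚ.≤-trans a≤b (ℕₚ.n≤1+n b)) b≤m)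

-- Adjacency operators of disjoint unions of paths

Fun : Set
Fun = ℕ → ℤ

infix 4 _≐_
_≐_ : Fun → Fun → Set
f ≐ g = ∀ i → f i ≡ g i

NonNeg : Fun → Set
NonNeg f = ∀ i → 0ℤ ℤ.≤ f i

sum< : ℕ → Fun → ℤ
sum< zero f    = 0ℤ
sum< (suc K) f = sum< K f + f K

sum<-cong : ∀ K {f g} → f ≐ g → sum< K f ≡ sum< K g
sum<-cong zero p    = refl
sum<-cong (suc K) p = cong₂ _+_ (sum<-cong K p) (p K)

sum<-+ : ∀ K f g → sum< K (λ i → f i + g i) ≡ sum< K f + sum< K g
sum<-+ zero f g    = refl
sum<-+ (suc K) f g = trans (cong (_+ (f K + g K)) (sum<-+ K f g)) (ring (sum< K f) (sum< K g) (f K) (g K))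
  where
  ring : ∀ a b x y → a + b + (x + y) ≡ a + x + (b + y)
  ring = solve-∀

sum<-neg : ∀ K f → sum< K (λ i → - f i) ≡ - sum< K f
sum<-neg zero f    = refl
sum<-neg (suc K) f = trans (cong (_+ - f K) (sum<-neg K f)) (sym (ℤₚ.neg-distrib-+ (sum< K f) (f K)))

sum<-nonneg : ∀ K {f} → NonNeg f → 0ℤ ℤ.≤ sum< K f
sum<-nonneg zero p    = ℤₚ.≤-refl
sum<-nonneg (suc K) p = ℤₚ.+-mono-≤ (sum<-nonneg K p) (p K)

*-nonneg : ∀ {x y} → 0ℤ ℤ.≤ x → 0ℤ ℤ.≤ y → 0ℤ ℤ.≤ x * y
*-nonneg {ℤ.+ a} {ℤ.+ b} _ _ = subst (0ℤ ℤ.≤_) (ℤₚ.pos-* a b) (ℤ.+≤+ z≤n)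
*-nonneg {ℤ.-[1+ _ ]} ()
*-nonneg {ℤ.+ _} {ℤ.-[1+ _ ]} _ ()

-- Consecutive vertices i − 1 and i of ℕ are joined unless h divides i, so every path has h vertices.
module Path (h : ℕ) .{{_ : NonZero h}} where

  edge : ℕ → ℤ
  edge i = if does (h ∣? i) then 0ℤ else 1ℤ

  edge-∣ : ∀ {i} → h ∣ i → edge i ≡ 0ℤ
  edge-∣ {i} p = cong (if_then 0ℤ else 1ℤ) (dec-true (h ∣? i) p)

  edge-∤ : ∀ {i} → ¬ h ∣ i → edge i ≡ 1ℤ
  edge-∤ {i} p = cong (if_then 0ℤ else 1ℤ) (dec-false (h ∣? i) p)

  edge-nonneg : ∀ i → 0ℤ ℤ.≤ edge i
  edge-nonneg i with does (h ∣? i)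
  ... | true  = ℤₚ.≤-refl
  ... | false = ℤ.+≤+ z≤n

  -- As h divides 0, `edge 0` vanishes, and the default `pred 0` = 0 contributes nothing.
  A : Fun → Fun
  A f i = edge (suc i) * f (suc i) + edge i * f (pred i)

  A-cong : ∀ {f g} → f ≐ g → A f ≐ A g
  A-cong p i = cong₂ _+_ (cong (edge (suc i) *_) (p (suc i))) (cong (edge i *_) (p (pred i)))

  A-+ : ∀ f g → A (λ i → f i + g i) ≐ (λ i → A f i + A g i)
  A-+ f g i = ring (edge (suc i)) (edge i) (f (suc i)) (g (suc i)) (f (pred i)) (g (pred i))
    where
    ring : ∀ a b x y z w → a * (x + y) + b * (z + w) ≡ a * x + b * z + (a * y + b * w)
    ring = solve-∀

  A-neg : ∀ f → A (λ i → - f i) ≐ (λ i → - A f i)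
  A-neg f i = ring (edge (suc i)) (edge i) (f (suc i)) (f (pred i))
    where
    ring : ∀ a b x z → a * (- x) + b * (- z) ≡ - (a * x + b * z)
    ring = solve-∀

  A-zero : ∀ {f} → (∀ i → f i ≡ 0ℤ) → ∀ i → A f i ≡ 0ℤ
  A-zero p i = trans (A-cong p i) (cong₂ _+_ (ℤₚ.*-zeroʳ (edge (suc i))) (ℤₚ.*-zeroʳ (edge i)))

  A-nonneg : ∀ {f} → NonNeg f → NonNeg (A f)
  A-nonneg p i = ℤₚ.+-mono-≤ (*-nonneg (edge-nonneg (suc i)) (p (suc i))) (*-nonneg (edge-nonneg i) (p (pred i)))

  -- The difference of the two partial sums telescopes to a boundary term with the factor `edge K`,
  -- which vanishes because a path ends just before K.
  A-self-adjoint : ∀ {K} → h ∣ K → ∀ f g → sum< K (λ i → A f i * g i) ≡ sum< K (λ i → f i * A g i)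
  A-self-adjoint {K} h∣K f g = ℤₚ.i-j≡0⇒i≡j _ _ (trans (telescope K) (cong (_* (f K * g (pred K) - f (pred K) * g K)) (edge-∣ h∣K)))
    where
    ring : ∀ {F G} a b f₊ f₀ f₋ g₊ g₀ g₋ → F - G ≡ b * (f₀ * g₋ - f₋ * g₀) →
      F + (a * f₊ + b * f₋) * g₀ - (G + f₀ * (a * g₊ + b * g₋)) ≡ a * (f₊ * g₀ - f₀ * g₊)
    ring {F} {G} a b f₊ f₀ f₋ g₊ g₀ g₋ e = trans (ring₁ F G a b f₊ f₀ f₋ g₊ g₀ g₋) (trans (cong (_+ _) e) (ring₂ a b f₊ f₀ f₋ g₊ g₀ g₋))
      where
      ring₁ : ∀ F G a b f₊ f₀ f₋ g₊ g₀ g₋ → F + (a * f₊ + b * f₋) * g₀ - (G + f₀ * (a * g₊ + b * g₋))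
        ≡ F - G + ((a * f₊ + b * f₋) * g₀ - f₀ * (a * g₊ + b * g₋))
      ring₁ = solve-∀
      ring₂ : ∀ a b f₊ f₀ f₋ g₊ g₀ g₋ → b * (f₀ * g₋ - f₋ * g₀) + ((a * f₊ + b * f₋) * g₀ - f₀ * (a * g₊ + b * g₋)) ≡ a * (f₊ * g₀ - f₀ * g₊)
      ring₂ = solve-∀
    telescope : ∀ K → sum< K (λ i → A f i * g i) - sum< K (λ i → f i * A g i) ≡ edge K * (f K * g (pred K) - f (pred K) * g K)
    telescope zero    = sym (cong (_* (f 0 * g 0 - f 0 * g 0)) (edge-∣ (h ∣0)))
    telescope (suc K) = ring {sum< K (λ i → A f i * g i)} {sum< K (λ i → f i * A g i)} (edge (suc K)) (edge K) (f (suc K)) (f K) (f (pred K)) (g (suc K)) (g K) (g (pred K)) (telescope K)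

  -- Chebyshev polynomials of the second kind, P (b + 1) = U_b(A / 2).
  P : ℕ → Fun → Fun
  P zero          f i = 0ℤ
  P (suc zero)    f i = f i
  P (suc (suc b)) f i = A (P (suc b) f) i - P b f i

  -- The restriction of f to the q-th path, shifted by one so that the positions 0 and h + 1 are
  -- walls with value 0.
  block : ℕ → Fun → ℕ → ℤ
  block q f zero    = 0ℤ
  block q f (suc a) with a ℕ.<? h
  ... | yes _ = f (a ℕ.+ q ℕ.* h)
  ... | no  _ = 0ℤ

  block-inside : ∀ q f {a} → a < h → block q f (suc a) ≡ f (a ℕ.+ q ℕ.* h)
  block-inside q f {a} a<h with a ℕ.<? h
  ... | yes _  = refl
  ... | no ¬p = contradiction a<h ¬p

  block-outside : ∀ q f → block q f (suc h) ≡ 0ℤ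
  block-outside q f with h ℕ.<? h
  ... | yes p = contradiction p (ℕₚ.<-irrefl refl)
  ... | no _  = refl

  edge-inside : ∀ q {a} → suc a < h → edge (suc a ℕ.+ q ℕ.* h) ≡ 1ℤ
  edge-inside q {a} a<h = edge-∤ λ d → >⇒∤ a<h (∣m+n∣m⇒∣n (subst (h ∣_) (ℕₚ.+-comm (suc a) (q ℕ.* h)) d) (n∣m*n q))

  block-A : ∀ q f {a} → a < h → A f (a ℕ.+ q ℕ.* h) ≡ block q f (suc (suc a)) + block q f a
  block-A q f {a} a<h = cong₂ _+_ (up (ℕₚ.m≤n⇒m<n∨m≡n a<h)) (down a a<h)
    where
    up : (suc a < h) ⊎ (suc a ≡ h) → edge (suc a ℕ.+ q ℕ.* h) * f (suc a ℕ.+ q ℕ.* h) ≡ block q f (suc (suc a))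
    up (inj₁ lt)   = trans (cong (_* f (suc a ℕ.+ q ℕ.* h)) (edge-inside q lt)) (trans (ℤₚ.*-identityˡ _) (sym (block-inside q f lt)))
    up (inj₂ e) = trans (cong (_* f (suc a ℕ.+ q ℕ.* h)) (edge-∣ (subst (λ z → h ∣ z ℕ.+ q ℕ.* h) (sym e) (∣m∣n⇒∣m+n ∣-refl (n∣m*n q)))))
      (sym (subst (λ z → block q f (suc z) ≡ 0ℤ) (sym e) (block-outside q f)))
    down : ∀ a → a < h → edge (a ℕ.+ q ℕ.* h) * f (pred (a ℕ.+ q ℕ.* h)) ≡ block q f a
    down zero a<h    = cong (_* f (pred (q ℕ.* h))) (edge-∣ (n∣m*n q))
    down (suc a) a<h = trans (cong (_* f (a ℕ.+ q ℕ.* h)) (edge-inside q a<h))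
      (trans (ℤₚ.*-identityˡ _) (sym (block-inside q f (ℕₚ.<-trans (ℕₚ.n<1+n a) a<h))))

  module BlockWave (q : ℕ) (f : Fun) where

    N : ℕ → ℕ → ℤ
    N b = block q (P b f)

    zero-time : ∀ a → N 0 a ≡ 0ℤ
    zero-time zero = refl
    zero-time (suc a) with a ℕ.<? h
    ... | yes _ = refl
    ... | no  _ = refl

    wave : ∀ b a → suc a < suc h → N (suc (suc b)) (suc a) ≡ N (suc b) (suc (suc a)) + N (suc b) a - N b (suc a)
    wave b a (s≤s a<h) = trans (block-inside q (P (suc (suc b)) f) a<h)
      (cong₂ _-_ (block-A q (P (suc b) f) a<h) (sym (block-inside q (P b f) a<h)))

    open Wave (suc h) N zero-time (λ _ → refl) (λ b → block-outside q (P b f)) wave public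

    initial-nonneg : NonNeg f → ∀ a → 0ℤ ℤ.≤ N 1 a
    initial-nonneg p zero = ℤₚ.≤-refl
    initial-nonneg p (suc a) with a ℕ.<? h
    ... | yes _ = p _
    ... | no  _ = ℤₚ.≤-refl

  at-block : ∀ (Q : ℤ → Set) (f : Fun) i → Q (block (i / h) f (suc (i % h))) → Q (f i)
  at-block Q f i x = subst (λ j → Q (f j)) (sym (m≡m%n+[m/n]*n i h)) (subst Q (block-inside (i / h) f (m%n<n i h)) x)

  -- With h = m - 1 this is U_{m-1}(A/2) = 0, the operator form of the braid relation.
  P-vanishes : ∀ f i → P (suc h) f i ≡ 0ℤ
  P-vanishes f i = at-block (_≡ 0ℤ) (P (suc h) f) i (BlockWave.vanishes (i / h) f (suc (i % h)) (ℕₚ.m≤n⇒m≤1+n (m%n<n i h)))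

  P-nonneg : ∀ {f} → NonNeg f → ∀ b → b ≤ suc h → NonNeg (P b f)
  P-nonneg {f} p b b≤ i = at-block (0ℤ ℤ.≤_) (P b f) i
    (BlockWave.nonneg (i / h) f (BlockWave.initial-nonneg (i / h) f p) b (suc (i % h)) b≤ (ℕₚ.m≤n⇒m≤1+n (m%n<n i h)))

-- The root space and the action of W on it

sum-zero : ∀ {n} (f : Fin n → ℤ) → (∀ t → f t ≡ 0ℤ) → sum f ≡ 0ℤ
sum-zero {zero} f p  = refl
sum-zero {suc n} f p = cong₂ _+_ (p zero) (sum-zero (f ∘ suc) (p ∘ suc))

sum-single : ∀ {n} (f : Fin n → ℤ) s → (∀ t → t ≢ s → f t ≡ 0ℤ) → sum f ≡ f s
sum-single f zero p    = trans (cong (f zero +_) (sum-zero (f ∘ suc) (λ t → p (suc t) λ ()))) (ℤₚ.+-identityʳ (f zero))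
sum-single f (suc s) p = trans (cong₂ _+_ (p zero λ ()) (sum-single (f ∘ suc) s (λ t t≢s → p (suc t) (t≢s ∘ Finₚ.suc-injective)))) (ℤₚ.+-identityˡ (f (suc s)))

sum-neg : ∀ {n} (f : Fin n → ℤ) → sum (λ t → - f t) ≡ - sum f
sum-neg {zero} f  = refl
sum-neg {suc n} f = trans (cong (- f zero +_) (sum-neg (f ∘ suc))) (sym (ℤₚ.neg-distrib-+ (f zero) (sum (f ∘ suc))))

sum-nonneg : ∀ {n} (f : Fin n → ℤ) → (∀ t → 0ℤ ℤ.≤ f t) → 0ℤ ℤ.≤ sum f
sum-nonneg {zero} f p  = ℤₚ.≤-refl
sum-nonneg {suc n} f p = ℤₚ.+-mono-≤ (p zero) (sum-nonneg (f ∘ suc) (p ∘ suc))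

module Rep {n : ℕ} (M : Fin n → Fin n → ℕ) (cox : IsCoxeterMatrix M) where
  open IsCoxeterMatrix cox
  open Words M

  V : Set
  V = Fin n → Fun

  infix 4 _≗ⱽ_
  _≗ⱽ_ : V → V → Set
  v ≗ⱽ w = ∀ t → v t ≐ w t

  adj : ℕ → Fun → Fun
  adj k = Path.A (suc k)

  -- Truncated subtraction treats m = 1 and m = 2 alike: both give paths with a single vertex, hence
  -- the zero operator.
  A : Fin n → Fin n → Fun → Fun
  A s t = adj (M s t ℕ.∸ 2)

  A-sym : ∀ s t f → A s t f ≐ A t s f
  A-sym s t f i = cong (λ m → adj (m ℕ.∸ 2) f i) (symm s t)

  A-cong : ∀ s t {f g} → f ≐ g → A s t f ≐ A s t g
  A-cong s t = Path.A-cong (suc (M s t ℕ.∸ 2))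

  A-+ : ∀ s t f g → A s t (λ i → f i + g i) ≐ (λ i → A s t f i + A s t g i)
  A-+ s t = Path.A-+ (suc (M s t ℕ.∸ 2))

  A-neg : ∀ s t f → A s t (λ i → - f i) ≐ (λ i → - A s t f i)
  A-neg s t = Path.A-neg (suc (M s t ℕ.∸ 2))

  A-zero : ∀ s t {f} → (∀ i → f i ≡ 0ℤ) → ∀ i → A s t f i ≡ 0ℤ
  A-zero s t = Path.A-zero (suc (M s t ℕ.∸ 2))

  A-nonneg : ∀ s t {f} → NonNeg f → NonNeg (A s t f)
  A-nonneg s t = Path.A-nonneg (suc (M s t ℕ.∸ 2))

  A-nonadjacent : ∀ s t → M s t ℕ.∸ 2 ≡ 0 → ∀ f i → A s t f i ≡ 0ℤ
  A-nonadjacent s t e f i = trans (cong (λ k → adj k f i) e)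
    (cong₂ _+_ (cong (_* f (suc i)) (Path.edge-∣ 1 (1∣ suc i))) (cong (_* f (pred i)) (Path.edge-∣ 1 (1∣ i))))

  A-diag : ∀ s f i → A s s f i ≡ 0ℤ
  A-diag s = A-nonadjacent s s (cong (ℕ._∸ 2) (diag s))

  nbrs : Fin n → V → Fun
  nbrs s v i = sum (λ u → A s u (v u) i)

  -- The reflection v ↦ v - B(v, α_s) α_s in coordinates, for the form B with 2 on the diagonal and
  -- -`A s t` off it.
  act : Fin n → V → V
  act s v t with t Finₚ.≟ s
  ... | yes _ = λ i → - v s i + nbrs s v i
  ... | no  _ = v t

  act-at : ∀ s v i → act s v s i ≡ - v s i + nbrs s v i
  act-at s v i with s Finₚ.≟ s
  ... | yes _  = refl
  ... | no s≢s = contradiction refl s≢s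

  act-off : ∀ {s t} → t ≢ s → ∀ v i → act s v t i ≡ v t i
  act-off {s} {t} t≢s v i with t Finₚ.≟ s
  ... | yes t≡s = contradiction t≡s t≢s
  ... | no _    = refl

  nbrs-cong : ∀ s {v w} → v ≗ⱽ w → nbrs s v ≐ nbrs s w
  nbrs-cong s p i = sum-cong-≗ (λ u → A-cong s u (p u) i)

  nbrs-act : ∀ s v → nbrs s (act s v) ≐ nbrs s v
  nbrs-act s v i = sum-cong-≗ (λ u → go u (u Finₚ.≟ s))
    where
    go : ∀ u → Dec (u ≡ s) → A s u (act s v u) i ≡ A s u (v u) i
    go u (yes refl) = trans (A-diag s (act s v s) i) (sym (A-diag s (v s) i))
    go u (no u≢s)   = A-cong s u (act-off u≢s v) i

  nbrs-nonneg : ∀ s {v} → (∀ u → NonNeg (v u)) → NonNeg (nbrs s v)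
  nbrs-nonneg s p i = sum-nonneg _ (λ u → A-nonneg s u (p u) i)

  act-cong : ∀ s {v w} → v ≗ⱽ w → act s v ≗ⱽ act s w
  act-cong s p t i with t Finₚ.≟ s
  ... | yes _ = cong₂ _+_ (cong -_ (p s i)) (nbrs-cong s p i)
  ... | no  _ = p t i

  _+ⱽ_ : V → V → V
  (v +ⱽ w) t i = v t i + w t i

  -ⱽ_ : V → V
  (-ⱽ v) t i = - v t i

  act-+ : ∀ s v w → act s (v +ⱽ w) ≗ⱽ (act s v +ⱽ act s w)
  act-+ s v w t i with t Finₚ.≟ s
  ... | no  _ = refl
  ... | yes _ = trans (cong (- (v s i + w s i) +_) (trans (sum-cong-≗ (λ u → A-+ s u (v u) (w u) i)) (∑-distrib-+ (λ u → A s u (v u) i) (λ u → A s u (w u) i))))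
    (ring (v s i) (w s i) (nbrs s v i) (nbrs s w i))
    where
    ring : ∀ a b c d → - (a + b) + (c + d) ≡ - a + c + (- b + d)
    ring = solve-∀

  act-neg : ∀ s v → act s (-ⱽ v) ≗ⱽ -ⱽ (act s v)
  act-neg s v t i with t Finₚ.≟ s
  ... | no  _ = refl
  ... | yes _ = trans (cong (- (- v s i) +_) (trans (sum-cong-≗ (λ u → A-neg s u (v u) i)) (sum-neg (λ u → A s u (v u) i))))
    (sym (ℤₚ.neg-distrib-+ (- v s i) (nbrs s v i)))

  act-involutive : ∀ s v → act s (act s v) ≗ⱽ v
  act-involutive s v t i with t Finₚ.≟ s
  ... | no t≢s   = act-off t≢s v i
  ... | yes refl = trans (cong₂ _+_ (cong -_ (act-at s v i)) (nbrs-act s v i)) (ring (v s i) (nbrs s v i))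
    where
    ring : ∀ a b → - (- a + b) + b ≡ a
    ring = solve-∀

  infixr 5 _·_
  _·_ : Word n → V → V
  []      · v = v
  (s ∷ w) · v = act s (w · v)

  ·-cong : ∀ w {u v} → u ≗ⱽ v → w · u ≗ⱽ w · v
  ·-cong []      p = p
  ·-cong (s ∷ w) p = act-cong s (·-cong w p)

  ·-++ : ∀ x y v → (x ++ y) · v ≡ x · y · v
  ·-++ [] y v      = refl
  ·-++ (s ∷ x) y v = cong (act s) (·-++ x y v)

  ·-+ : ∀ w u v → w · (u +ⱽ v) ≗ⱽ (w · u) +ⱽ (w · v)
  ·-+ [] u v t i      = refl
  ·-+ (s ∷ w) u v t i = trans (act-cong s (·-+ w u v) t i) (act-+ s (w · u) (w · v) t i)

  ·-neg : ∀ w v → w · (-ⱽ v) ≗ⱽ -ⱽ (w · v)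
  ·-neg [] v t i      = refl
  ·-neg (s ∷ w) v t i = trans (act-cong s (·-neg w v) t i) (act-neg s (w · v) t i)

  module Dihedral (s t : Fin n) (s≢t : s ≢ t) (v : V) where

    -- The defect of the braid relation in coordinate a after k letters. It satisfies the Chebyshev
    -- recurrence in k and hence vanishes at k = `M a b`.
    gap : Fin n → Fin n → ℕ → Fun
    gap a b k i = (alt a b k · v) a i - (alt b a k · v) a i

    -- Each step of the recurrence exchanges a and b, so the initial function alternates with the
    -- parity of k.
    start : Fin n → Fin n → ℕ → Fun
    start a b zero    = gap b a 1
    start a b (suc k) = start b a k

    off-both : ∀ {a b u} → u ≢ a → u ≢ b → ∀ k i → (alt a b k · v) u i ≡ v u i
    off-both u≢a u≢b zero i            = refl
    off-both {a} {b} u≢a u≢b (suc k) i = trans (act-off u≢a (alt b a k · v) i) (off-both u≢b u≢a k i)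

    nbrs-diff : ∀ {a b} → a ≢ b → ∀ x y → (∀ u → u ≢ a → u ≢ b → x u ≐ y u) → ∀ i →
      nbrs a x i - nbrs a y i ≡ A a b (λ j → x b j - y b j) i
    nbrs-diff {a} {b} a≢b x y p i = begin
      nbrs a x i - nbrs a y i                                ≡⟨ cong (nbrs a x i +_) (sum-neg (λ u → A a u (y u) i)) ⟨
      nbrs a x i + sum (λ u → - A a u (y u) i)               ≡⟨ ∑-distrib-+ (λ u → A a u (x u) i) (λ u → - A a u (y u) i) ⟨
      sum (λ u → A a u (x u) i - A a u (y u) i)              ≡⟨ sum-cong-≗ (λ u → linear u i) ⟩
      sum (λ u → A a u (λ j → x u j - y u j) i)              ≡⟨ sum-single _ b (λ u u≢b → vanish u u≢b (u Finₚ.≟ a)) ⟩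
      A a b (λ j → x b j - y b j) i ∎
      where
      open ≡-Reasoning
      linear : ∀ u i → A a u (x u) i - A a u (y u) i ≡ A a u (λ j → x u j - y u j) i
      linear u i = sym (trans (A-+ a u (x u) (λ j → - y u j) i) (cong (A a u (x u) i +_) (A-neg a u (y u) i)))
      vanish : ∀ u → u ≢ b → Dec (u ≡ a) → A a u (λ j → x u j - y u j) i ≡ 0ℤ
      vanish u u≢b (yes refl) = A-diag a (λ j → x a j - y a j) i
      vanish u u≢b (no u≢a)   = A-zero a u (λ j → ℤₚ.i≡j⇒i-j≡0 (p u u≢a u≢b j)) i

    -- The contributions of the letters other than a and b cancel.
    gap-step : ∀ {a b} → a ≢ b → ∀ k i → gap a b (suc (suc k)) i ≡ A a b (gap b a (suc k)) i - gap a b k i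
    gap-step {a} {b} a≢b k i = begin
      (alt a b (suc (suc k)) · v) a i - (alt b a (suc (suc k)) · v) a i
        ≡⟨ cong₂ _-_ (act-at a x i) (trans (act-off a≢b (alt a b (suc k) · v) i) (act-at a y i)) ⟩
      (- x a i + nbrs a x i) - (- y a i + nbrs a y i)
        ≡⟨ ring (x a i) (nbrs a x i) (y a i) (nbrs a y i) ⟩
      (nbrs a x i - nbrs a y i) - (x a i - y a i)
        ≡⟨ cong₂ _-_ (trans (nbrs-diff a≢b x y agree i) (A-cong a b eq-b i)) (cong (_- y a i) (act-off a≢b (alt a b k · v) i)) ⟩
      A a b (gap b a (suc k)) i - gap a b k i ∎
      where
      open ≡-Reasoning
      x y : V
      x = alt b a (suc k) · v
      y = alt b a k · v
      ring : ∀ p q r s → (- p + q) - (- r + s) ≡ (q - s) - (p - r)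
      ring = solve-∀
      agree : ∀ u → u ≢ a → u ≢ b → x u ≐ y u
      agree u u≢a u≢b j = trans (off-both u≢b u≢a (suc k) j) (sym (off-both u≢b u≢a k j))
      eq-b : ∀ j → x b j - y b j ≡ gap b a (suc k) j
      eq-b j = cong (λ z → x b j - z) (sym (act-off (a≢b ∘ sym) (alt b a k · v) j))

    module _ (k₀ : ℕ) where
      open Path (suc k₀) using (P)

      gap-P : ∀ a b → a ≢ b → M a b ℕ.∸ 2 ≡ k₀ → M b a ℕ.∸ 2 ≡ k₀ → ∀ k → gap a b k ≐ P k (start a b k)
      gap-P a b a≢b e e′ zero i          = ℤₚ.+-inverseʳ (v a i)
      gap-P a b a≢b e e′ (suc zero) i    = refl
      gap-P a b a≢b e e′ (suc (suc k)) i = trans (gap-step a≢b k i)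
        (cong₂ _-_ (trans (cong (λ z → adj z (gap b a (suc k)) i) e) (Path.A-cong (suc k₀) (gap-P b a (a≢b ∘ sym) e′ e (suc k)) i))
                   (gap-P a b a≢b e e′ k i))

    gap-vanishes : ∀ {a b} → a ≢ b → ∀ i → gap a b (M a b) i ≡ 0ℤ
    gap-vanishes {a} {b} a≢b i = trans (gap-P k₀ a b a≢b refl (cong (ℕ._∸ 2) (symm b a)) (M a b) i)
      (subst (λ m → P m (start a b (M a b)) i ≡ 0ℤ) (ℕₚ.m+[n∸m]≡n (off a b a≢b)) (Path.P-vanishes (suc k₀) (start a b (M a b)) i))
      where
      k₀ = M a b ℕ.∸ 2
      open Path (suc k₀) using (P)

    braid : alt s t (M s t) · v ≗ⱽ alt t s (M s t) · v
    braid u i with u Finₚ.≟ s | u Finₚ.≟ t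
    ... | yes refl | _        = ℤₚ.i-j≡0⇒i≡j _ _ (gap-vanishes s≢t i)
    ... | no _     | yes refl = sym (ℤₚ.i-j≡0⇒i≡j _ _ (subst (λ m → gap t s m i ≡ 0ℤ) (symm t s) (gap-vanishes (s≢t ∘ sym) i)))
    ... | no u≢s   | no u≢t   = trans (off-both u≢s u≢t (M s t) i) (sym (off-both u≢t u≢s (M s t) i))

  ·-≋ : ∀ {x y} → x ≋ y → ∀ v → x · v ≗ⱽ y · v
  ·-≋ ≈refl v t i         = refl
  ·-≋ (≈sym p) v t i      = sym (·-≋ p v t i)
  ·-≋ (≈trans p q) v t i  = trans (·-≋ p v t i) (·-≋ q v t i)
  ·-≋ (≈ctx {x} {y} a b p) v t i = begin
    ((a ++ x ++ b) · v) t i  ≡⟨ cong (λ z → z t i) (trans (·-++ a (x ++ b) v) (cong (a ·_) (·-++ x b v))) ⟩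
    (a · x · b · v) t i      ≡⟨ ·-cong a (·-≋ p (b · v)) t i ⟩
    (a · y · b · v) t i      ≡⟨ cong (λ z → z t i) (trans (·-++ a (y ++ b) v) (cong (a ·_) (·-++ y b v))) ⟨
    ((a ++ y ++ b) · v) t i  ∎
    where open ≡-Reasoning
  ·-≋ (≈sq s) v           = act-involutive s v
  ·-≋ (≈braid s t) v u i with s Finₚ.≟ t
  ... | yes refl = refl
  ... | no s≢t   = Dihedral.braid s t s≢t v u i

  -- The multiple of the simple root α_s with coefficient f.
  e : Fin n → Fun → V
  e s f t with t Finₚ.≟ s
  ... | yes _ = f
  ... | no  _ = λ _ → 0ℤ

  e-at : ∀ s f i → e s f s i ≡ f i
  e-at s f i with s Finₚ.≟ s
  ... | yes _  = refl
  ... | no s≢s = contradiction refl s≢s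

  e-off : ∀ {s t} → t ≢ s → ∀ f i → e s f t i ≡ 0ℤ
  e-off {s} {t} t≢s f i with t Finₚ.≟ s
  ... | yes t≡s = contradiction t≡s t≢s
  ... | no _    = refl

  Nonnegⱽ Nonposⱽ : V → Set
  Nonnegⱽ v = ∀ t i → 0ℤ ℤ.≤ v t i
  Nonposⱽ v = ∀ t i → v t i ℤ.≤ 0ℤ

  e-nonneg : ∀ s {f} → NonNeg f → Nonnegⱽ (e s f)
  e-nonneg s p t i with t Finₚ.≟ s
  ... | yes _ = p i
  ... | no  _ = ℤₚ.≤-refl

  nbrs-e : ∀ s t f → nbrs s (e t f) ≐ A s t f
  nbrs-e s t f i = trans (sum-single _ t (λ u u≢t → A-zero s u (e-off u≢t f) i)) (A-cong s t (e-at t f) i)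

  act-e : ∀ s f → act s (e s f) ≗ⱽ -ⱽ (e s f)
  act-e s f t i = go (t Finₚ.≟ s)
    where
    go : Dec (t ≡ s) → act s (e s f) t i ≡ - e s f t i
    go (no t≢s)   = trans (act-off t≢s (e s f) i) (trans (e-off t≢s f i) (cong -_ (sym (e-off t≢s f i))))
    go (yes refl) = trans (act-at s (e s f) i) (trans (cong (- e s f s i +_) (trans (nbrs-e s s f i) (A-diag s f i))) (ℤₚ.+-identityʳ _))

  ones : Fun
  ones _ = 1ℤ

  ones-nonneg : NonNeg ones
  ones-nonneg _ = ℤ.+≤+ z≤n

  Adj : Fin n → Fin n → Set
  Adj s t = M s t ℕ.∸ 2 ≢ 0

  Adj-sym : ∀ {s t} → Adj s t → Adj t s
  Adj-sym {s} {t} a = a ∘ trans (cong (ℕ._∸ 2) (symm s t))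

  Adj⇒≢ : ∀ {s t} → Adj s t → s ≢ t
  Adj⇒≢ {s} a refl = a (cong (ℕ._∸ 2) (diag s))

  nonadj? : ∀ s t → Dec (M s t ℕ.∸ 2 ≡ 0)
  nonadj? s t = (M s t ℕ.∸ 2) ℕ.≟ 0

  commute : ∀ {s t} → s ≢ t → M s t ℕ.∸ 2 ≡ 0 → (s ∷ t ∷ []) ≋ (t ∷ s ∷ [])
  commute {s} {t} s≢t z = subst (λ m → alt s t m ≋ alt t s m) (sym two) (≈braid s t)
    where
    two : 2 ≡ M s t
    two = ℕₚ.≤-antisym (off s t s≢t) (ℕₚ.m∸n≡0⇒m≤n z)

  -- Vertex 0 is the end of a path with at least two vertices and so has exactly one neighbour. This
  -- entry serves as the concrete witness of strict positivity.
  A-ones : ∀ {s t} → Adj s t → A s t ones 0 ≡ 1ℤ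
  A-ones {s} {t} a = go (M s t ℕ.∸ 2) a
    where
    go : ∀ k → k ≢ 0 → adj k ones 0 ≡ 1ℤ
    go zero k≢0   = contradiction refl k≢0
    go (suc k) _  = cong₂ _+_ (cong (_* 1ℤ) (Path.edge-∤ (suc (suc k)) {1} (>⇒∤ (s≤s (s≤s z≤n))))) (cong (_* 1ℤ) (Path.edge-∣ (suc (suc k)) {0} (suc (suc k) ∣0)))

-- Every root has a sign; characterisation of the longest element

module Positivity {n : ℕ} (M : Fin n → Fin n → ℕ) (cox : IsCoxeterMatrix M) (_≋?_ : ∀ u v → Dec (_≈_ M u v)) where
  open IsCoxeterMatrix cox
  open Words M
  open Length M _≋?_
  open Rep M cox

  -- The coefficient f is arbitrary because the induction, on passing through a dihedral subgroup,
  -- replaces f by Chebyshev values `P j f`.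
  Positive : Word n → Fin n → Set
  Positive w s = ∀ f → NonNeg f → Nonnegⱽ (w · e s f)

  nonneg-cong : ∀ {u v} → u ≗ⱽ v → Nonnegⱽ u → Nonnegⱽ v
  nonneg-cong p q t i = subst (0ℤ ℤ.≤_) (p t i) (q t i)

  act-e-off : ∀ {a b} → a ≢ b → ∀ f → act b (e a f) ≗ⱽ e a f +ⱽ e b (A b a f)
  act-e-off {a} {b} a≢b f t i = go (t Finₚ.≟ b)
    where
    go : Dec (t ≡ b) → act b (e a f) t i ≡ e a f t i + e b (A b a f) t i
    go (no t≢b)   = trans (act-off t≢b (e a f) i) (sym (trans (cong (e a f t i +_) (e-off t≢b (A b a f) i)) (ℤₚ.+-identityʳ _)))
    go (yes refl) = trans (act-at b (e a f) i) (cong₂ _+_ (trans (cong -_ z) (sym z)) (trans (nbrs-e b a f i) (sym (e-at b (A b a f) i))))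
      where
      z : e a f b i ≡ 0ℤ
      z = e-off (a≢b ∘ sym) f i

  e-cong : ∀ s {f g} → f ≐ g → e s f ≗ⱽ e s g
  e-cong s p t i with t Finₚ.≟ s
  ... | yes _ = p i
  ... | no  _ = refl

  e-minus : ∀ s f g t i → e s (λ j → f j - g j) t i ≡ e s f t i - e s g t i
  e-minus s f g t i with t Finₚ.≟ s
  ... | yes _ = refl
  ... | no  _ = refl

  -- w = y v with v in the dihedral subgroup ⟨ s , t ⟩; letters are moved from y to v until y has neither s nor t as
  -- a descent, and then v sends e s to a non-negative combination of e s and e t.
  module Strip (s t : Fin n) (s≢t : s ≢ t) (w : Word n) (asc : Ascent w s)
    (IH : ∀ y → len y < len w → ∀ r → Ascent y r → Positive y r) where

    k₀ : ℕ
    k₀ = M s t ℕ.∸ 2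
    open Path (suc k₀) using (P)

    -- The dihedral roots: the usual coefficients sin((j+1)π/m)/sin(π/m) and sin(jπ/m)/sin(π/m)
    -- appear as `P (suc j)` and `P j`.
    Orbit : Fin n → Fin n → ℕ → Set
    Orbit a b j = ∀ f → alt a b j · e s f ≗ⱽ e a (P (suc j) f) +ⱽ e b (P j f)

    orbit-step : ∀ {a b j} → a ≢ b → M b a ℕ.∸ 2 ≡ k₀ → Orbit a b j → Orbit b a (suc j)
    orbit-step {a} {b} {j} a≢b ba orbit f u i = begin
      act b (alt a b j · e s f) u i                   ≡⟨ act-cong b (orbit f) u i ⟩
      act b (e a p +ⱽ e b q) u i                      ≡⟨ act-+ b (e a p) (e b q) u i ⟩
      act b (e a p) u i + act b (e b q) u i           ≡⟨ cong₂ _+_ (act-e-off a≢b p u i) (act-e b q u i) ⟩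
      e a p u i + e b (A b a p) u i + - e b q u i     ≡⟨ ring (e a p u i) (e b (A b a p) u i) (e b q u i) ⟩
      e b (A b a p) u i - e b q u i + e a p u i       ≡⟨ cong (_+ e a p u i) (e-minus b (A b a p) q u i) ⟨
      e b (λ z → A b a p z - q z) u i + e a p u i     ≡⟨ cong (_+ e a p u i) (e-cong b (λ z → cong (_- q z) (cong (λ k → adj k p z) ba)) u i) ⟩
      e b (P (suc (suc j)) f) u i + e a p u i ∎
      where
      open ≡-Reasoning
      p q : Fun
      p = P (suc j) f
      q = P j f
      ring : ∀ x y z → x + y + - z ≡ y - z + x
      ring = solve-∀

    m≡ : M s t ≡ suc (suc k₀)
    m≡ = sym (ℕₚ.m+[n∸m]≡n (off s t s≢t))

    record State (a b : Fin n) (j : ℕ) (y : Word n) : Set where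
      field
        a≢b     : a ≢ b
        ab      : M a b ≡ M s t
        ba      : M b a ≡ M s t
        split   : w ≋ y ++ alt a b (suc j)
        length≡ : len y ℕ.+ suc j ≡ len w
        orbit   : Orbit a b (suc j)
        other   : Word n
        other≡  : alt b a (suc j) ≡ other ++ [ s ]
        bound   : suc j ≤ M s t

    -- At full length the braid relation rewrites the dihedral factor so that it ends in `s`, and
    -- `s` would be a descent of `w`. For this reason `State` records that `alt b a (suc j)` ends in
    -- `s`.
    no-longest : ∀ {a b j y} → State a b j y → suc j ≢ M s t
    no-longest {a} {b} {j} {y} st eq = ℕₚ.<-irrefl refl (begin-strict
      len (w ++ [ s ])                              ≡⟨ len-cong (++-congʳ [ s ] (≈trans split (++-congˡ y swap))) ⟩
      len ((y ++ other ++ [ s ]) ++ [ s ])          ≡⟨ len-cong (≈trans (≡⇒≋ (cong (_++ [ s ]) (sym (++-assoc y other [ s ])))) (snoc-cancel (y ++ other) s)) ⟩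
      len (y ++ other)                              ≤⟨ len-++ y other ⟩
      len y ℕ.+ len other                           ≤⟨ ℕₚ.+-monoʳ-≤ (len y) (len≤length other) ⟩
      len y ℕ.+ length other                        <⟨ ℕₚ.+-monoʳ-< (len y) (ℕₚ.≤-reflexive lo) ⟩
      len y ℕ.+ suc j                               ≡⟨ length≡ ⟩
      len w                                         <⟨ ℕₚ.n<1+n (len w) ⟩
      suc (len w)                                   ≡⟨ asc ⟨
      len (w ++ [ s ]) ∎)
      where
      open State st
      open ℕₚ.≤-Reasoning
      swap : alt a b (suc j) ≋ other ++ [ s ]
      swap = ≈trans (subst (λ m → alt a b m ≋ alt b a m) (trans ab (sym eq)) (≈braid a b)) (≡⇒≋ other≡)
      lo : suc (length other) ≡ suc j
      lo = trans (sym (length-snoc other s)) (trans (cong length (sym other≡)) (length-alt b a (suc j)))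

    strip : ∀ fuel {a b j y} → len y ≤ fuel → State a b j y → Positive w s
    strip fuel {a} {b} {j} {y} le st with ascent⊎descent y b
    strip zero {a} {b} {j} {y} le st | inj₂ d with () ← ℕₚ.≤-trans (ℕₚ.≤-reflexive (sym d)) le
    strip (suc fuel) {a} {b} {j} {y} le st | inj₂ d = strip fuel {y = y ++ [ b ]} (ℕₚ.≤-pred (ℕₚ.≤-trans (ℕₚ.≤-reflexive (sym d)) le)) record
      { a≢b     = a≢b ∘ sym
      ; ab      = ba
      ; ba      = ab
      ; split   = ≈trans split (≈trans (++-congʳ (alt a b (suc j)) (≈sym (snoc-cancel y b)))
                    (≡⇒≋ (++-assoc (y ++ [ b ]) [ b ] (alt a b (suc j)))))
      ; length≡ = trans (ℕₚ.+-suc (len (y ++ [ b ])) (suc j)) (trans (cong (ℕ._+ suc j) (sym d)) length≡)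
      ; orbit   = orbit-step {j = suc j} a≢b (cong (ℕ._∸ 2) ba) orbit
      ; other   = a ∷ other
      ; other≡  = cong (a ∷_) other≡
      ; bound   = ℕₚ.≤∧≢⇒< bound (no-longest st)
      }
      where open State st
    strip fuel {a} {b} {j} {y} le st | inj₁ ascb = λ f f≥0 →
      let Pnn = Path.P-nonneg (suc k₀) f≥0
          -- Strictness matters: the coefficient `P (suc (suc j))` is known to be non-negative only
          -- for j + 2 ≤ m.
          j<  = ℕₚ.≤-trans (ℕₚ.≤∧≢⇒< bound (no-longest st)) (ℕₚ.≤-reflexive m≡)
      in nonneg-cong (λ u i → sym (trans (·-≋ split (e s f) u i) (trans (cong (λ z → z u i) (·-++ y (alt a b (suc j)) (e s f)))
              (trans (·-cong y (orbit f) u i) (·-+ y (e a (P (suc (suc j)) f)) (e b (P (suc j) f)) u i)))))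
         (λ u i → ℤₚ.+-mono-≤ (IH y y<w a asca (P (suc (suc j)) f) (Pnn (suc (suc j)) j<) u i)
                              (IH y y<w b ascb (P (suc j) f) (Pnn (suc j) (ℕₚ.<⇒≤ j<)) u i))
      where
      open State st
      y<w : len y < len w
      y<w = ℕₚ.≤-trans (ℕₚ.≤-trans (s≤s (ℕₚ.m≤m+n (len y) j)) (ℕₚ.≤-reflexive (sym (ℕₚ.+-suc (len y) j)))) (ℕₚ.≤-reflexive length≡)
      asca : Ascent y a
      asca with ascent⊎descent y a
      ... | inj₁ p = p
      ... | inj₂ d = contradiction (begin-strict
        len w                                     ≡⟨ len-cong (≈trans split (≡⇒≋ (sym (++-assoc y [ a ] (alt b a j))))) ⟩
        len ((y ++ [ a ]) ++ alt b a j)           ≤⟨ len-++ (y ++ [ a ]) (alt b a j) ⟩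
        len (y ++ [ a ]) ℕ.+ len (alt b a j)      ≤⟨ ℕₚ.+-monoʳ-≤ (len (y ++ [ a ])) (ℕₚ.≤-trans (len≤length (alt b a j)) (ℕₚ.≤-reflexive (length-alt b a j))) ⟩
        len (y ++ [ a ]) ℕ.+ j                    <⟨ ℕₚ.+-monoˡ-< j (ℕₚ.≤-reflexive (sym d)) ⟩
        len y ℕ.+ j                               ≤⟨ ℕₚ.+-monoʳ-≤ (len y) (ℕₚ.n≤1+n j) ⟩
        len y ℕ.+ suc j                           ≡⟨ length≡ ⟩
        len w ∎) (ℕₚ.<-irrefl refl)
        where open ℕₚ.≤-Reasoning

    positive : Descent w t → Positive w s
    positive d = strip (len (w ++ [ t ])) {t} {s} {0} {w ++ [ t ]} ℕₚ.≤-refl record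
      { a≢b     = s≢t ∘ sym
      ; ab      = symm t s
      ; ba      = refl
      ; split   = ≈sym (snoc-cancel w t)
      ; length≡ = trans (ℕₚ.+-comm (len (w ++ [ t ])) 1) (sym d)
      ; orbit   = orbit-step {j = 0} s≢t (cong (ℕ._∸ 2) (symm t s)) (λ f u i → sym (trans (cong (e s f u i +_) (zero-e t f u i)) (ℤₚ.+-identityʳ _)))
      ; other   = []
      ; other≡  = refl
      ; bound   = ℕₚ.≤-trans (s≤s z≤n) (off s t s≢t)
      }
      where
      zero-e : ∀ t f u i → e t (P 0 f) u i ≡ 0ℤ
      zero-e t f u i with u Finₚ.≟ t
      ... | yes _ = refl
      ... | no  _ = refl

  len≡0 : ∀ {w} → len w ≡ 0 → w ≋ []
  len≡0 {w} z with red w | length-red w | red-≋ w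
  ... | []    | _ | p = ≈sym p
  ... | _ ∷ _ | q | _ with () ← trans q z

  has-descent : ∀ w → len w ≢ 0 → ∃ (Descent w)
  has-descent w nz = go (red w) (length-red w) (red-≋ w) (red-reduced w)
    where
    go : ∀ v → length v ≡ len w → v ≋ w → Reduced M v → ∃ (Descent w)
    go v q p r with initLast v
    ... | []      = contradiction (sym q) nz
    ... | y ∷ʳ′ t = t , descent-cong p
      (trans (reduced-snoc⇒ascent {y} {t} r) (cong suc (len-cong (≈sym (snoc-cancel y t)))))

  ascent⇒positive : ∀ {w s} → Ascent w s → Positive w s
  ascent⇒positive {w} {s} = go w s (<-wellFounded (len w))
    where
    go : ∀ w s → Acc _<_ (len w) → Ascent w s → Positive w s
    go w s (acc rec) asc with len w ℕ.≟ 0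
    ... | yes z = λ f f≥0 → nonneg-cong (λ t i → sym (·-≋ (len≡0 z) (e s f) t i)) (e-nonneg s f≥0)
    ... | no nz with t , d ← has-descent w nz = Strip.positive s t s≢t w asc (λ y lt r → go y r (rec lt)) d
      where
      s≢t : s ≢ t
      s≢t refl = ascent⇒¬descent {w} {s} asc d

  descent⇒negative : ∀ {w s} → Descent w s → ∀ f → NonNeg f → Nonposⱽ (w · e s f)
  descent⇒negative {w} {s} d f f≥0 t i = subst (ℤ._≤ 0ℤ) (ℤₚ.neg-involutive ((w · e s f) t i))
    (ℤₚ.neg-mono-≤ (subst (0ℤ ℤ.≤_) (flipped t i) (ascent⇒positive (descent⇒ascent {w} {s} d) f f≥0 t i)))
    where
    flipped : (w ++ [ s ]) · e s f ≗ⱽ -ⱽ (w · e s f)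
    flipped t i = trans (cong (λ z → z t i) (·-++ w [ s ] (e s f))) (trans (·-cong w (act-e s f) t i) (·-neg w (e s f) t i))

  0ⱽ : V
  0ⱽ _ _ = 0ℤ

  ·-zero : ∀ w → w · 0ⱽ ≗ⱽ 0ⱽ
  ·-zero w t i = i≡-i⇒0 (trans (·-cong w {0ⱽ} { -ⱽ 0ⱽ } (λ _ _ → refl) t i) (·-neg w 0ⱽ t i))
    where
    i≡-i⇒0 : ∀ {x} → x ≡ - x → x ≡ 0ℤ
    i≡-i⇒0 {ℤ.+ zero}   _  = refl
    i≡-i⇒0 {ℤ.+ suc _}  ()
    i≡-i⇒0 {ℤ.-[1+ _ ]} ()

  ·-inverse : ∀ w v → reverse w · w · v ≗ⱽ v
  ·-inverse w v t i = trans (cong (λ z → z t i) (sym (·-++ (reverse w) w v))) (·-≋ (inverseˡ w) v t i)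

  -- Both signs would make the image zero, but the inverse of w sends it back to `e s ones`.
  not-both-signs : ∀ w s → Nonnegⱽ (w · e s ones) → Nonposⱽ (w · e s ones) → ⊥
  not-both-signs w s p q with () ← trans (sym (e-at s ones 0)) (trans (sym (·-inverse w (e s ones) s 0))
    (trans (·-cong (reverse w) (λ t i → ℤₚ.≤-antisym (q t i) (p t i)) s 0) (·-zero (reverse w) s 0)))

  total : ∀ {k} → (Fin k → V) → V
  total g t i = sum (λ j → g j t i)

  ·-total : ∀ w {k} (g : Fin k → V) → w · total g ≗ⱽ total (λ j → w · g j)
  ·-total w {zero} g t i  = ·-zero w t i
  ·-total w {suc k} g t i = trans (·-+ w (g zero) (total (g ∘ suc)) t i) (cong ((w · g zero) t i +_) (·-total w (g ∘ suc) t i))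

  total-e : ∀ v → v ≗ⱽ total (λ u → e u (v u))
  total-e v t i = sym (trans (sum-single (λ u → e u (v u) t i) t (λ u u≢t → e-off (u≢t ∘ sym) (v u) i)) (e-at t (v t) i))

  all-descents-negative : ∀ {w} → (∀ s → Descent w s) → ∀ v → Nonnegⱽ v → Nonposⱽ (w · v)
  all-descents-negative {w} ds v v≥0 t i = subst (ℤ._≤ 0ℤ) (sym (trans (·-cong w (total-e v) t i) (·-total w (λ u → e u (v u)) t i)))
    (subst (ℤ._≤ 0ℤ) (trans (cong -_ (sum-neg (λ u → (w · e u (v u)) t i))) (ℤₚ.neg-involutive _))
      (ℤₚ.neg-mono-≤ (sum-nonneg (λ u → - (w · e u (v u)) t i) (λ u → ℤₚ.neg-mono-≤ (descent⇒negative {w} (ds u) (v u) (v≥0 u) t i)))))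

  -- Each letter of v shortens the product: before it, v sends its simple root to a non-negative
  -- vector, which w makes non-positive, so the letter cannot be an ascent.
  all-descents-len : ∀ {w} → (∀ s → Descent w s) → ∀ k v → length v ≡ k → Reduced M v → len (w ++ v) ℕ.+ k ≡ len w
  all-descents-len {w} ds k v eq r with initLast v
  all-descents-len {w} ds .0 .[] refl r | [] = trans (ℕₚ.+-identityʳ _) (len-cong (≡⇒≋ (++-identityʳ w)))
  all-descents-len {w} ds zero .(v ++ [ s ]) eq r | v ∷ʳ′ s with () ← trans (sym (length-snoc v s)) eq
  all-descents-len {w} ds (suc k) .(v ++ [ s ]) eq r | v ∷ʳ′ s = begin
    len (w ++ v ++ [ s ]) ℕ.+ suc k      ≡⟨ cong (ℕ._+ suc k) (len-cong (≡⇒≋ (sym (++-assoc w v [ s ])))) ⟩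
    len ((w ++ v) ++ [ s ]) ℕ.+ suc k    ≡⟨ ℕₚ.+-suc _ k ⟩
    suc (len ((w ++ v) ++ [ s ])) ℕ.+ k  ≡⟨ cong (ℕ._+ k) (¬ascent⇒descent {w ++ v} {s} not-ascent) ⟨
    len (w ++ v) ℕ.+ k                   ≡⟨ all-descents-len {w} ds k v (ℕₚ.suc-injective (trans (sym (length-snoc v s)) eq)) (reduced-++ˡ v [ s ] r) ⟩
    len w ∎
    where
    open ≡-Reasoning
    not-ascent : ¬ Ascent (w ++ v) s
    not-ascent a = not-both-signs (w ++ v) s (ascent⇒positive a ones ones-nonneg)
      (λ t i → subst (ℤ._≤ 0ℤ) (cong (λ z → z t i) (sym (·-++ w v (e s ones))))
        (all-descents-negative {w} ds (v · e s ones) (ascent⇒positive {v} {s} (reduced-snoc⇒ascent {v} {s} r) ones ones-nonneg) t i))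

  module _ {w0 : Word n} (longest : Longest M w0) where

    len≤longest : ∀ w → len w ≤ length w0
    len≤longest w = ℕₚ.≤-trans (ℕₚ.≤-reflexive (sym (length-red w))) (proj₂ longest (red w) (red-reduced w))

    all-descents⇒longest : ∀ {w} → (∀ s → Descent w s) → w ≋ w0
    all-descents⇒longest {w} ds = cancelʳ (reverse w0) (≈trans (len≡0 zero-len) (≈sym (inverseʳ w0)))
      where
      rev-reduced : Reduced M (reverse w0)
      rev-reduced = len⇒reduced (ℕₚ.≤-reflexive (trans (length-reverse w0) (trans (sym (reduced⇒len (proj₁ longest))) (sym (len-reverse w0)))))
      -- For v the inverse of w∘, the length of w v is the length of w minus that of w∘, hence zero.
      zero-len : len (w ++ reverse w0) ≡ 0
      zero-len = ℕₚ.n≤0⇒n≡0 (ℕₚ.+-cancelʳ-≤ (length w0) _ 0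
        (ℕₚ.≤-trans (ℕₚ.≤-reflexive (all-descents-len {w} ds (length w0) (reverse w0) (length-reverse w0) rev-reduced)) (len≤longest w)))

  ·-absent : ∀ {s} w → s ∉ w → ∀ v → (w · v) s ≐ v s
  ·-absent [] _ v i            = refl
  ·-absent {s} (t ∷ w) s∉ v i = trans (act-off (s∉ ∘ here) (w · v) i) (·-absent w (s∉ ∘ there) v i)

-- Orientations of the Coxeter graph and the Euler form

common-multiple : ∀ {n} (f : Fin n → ℕ) → (∀ s → 0 < f s) → ∃ λ K → 0 < K × (∀ s → f s ∣ K)
common-multiple {zero} f p  = 1 , s≤s z≤n , λ ()
common-multiple {suc n} f p with K , K>0 , d ← common-multiple (f ∘ suc) (p ∘ suc)
  = f zero ℕ.* K , ℕₚ.*-mono-< (p zero) K>0 , λ { zero → m∣m*n K ; (suc s) → ∣-trans (d s) (n∣m*n (f zero)) }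

sum-update : ∀ {n} (f g : Fin n → ℤ) s d → (∀ t → t ≢ s → g t ≡ f t) → g s ≡ f s + d → sum g ≡ sum f + d
sum-update f g zero d p q    = trans (cong₂ _+_ q (sum-cong-≗ (λ t → p (suc t) λ ()))) (ring (f zero) d (sum (f ∘ suc)))
  where
  ring : ∀ x y z → x + y + z ≡ x + z + y
  ring = solve-∀
sum-update f g (suc s) d p q = trans (cong₂ _+_ (p zero λ ()) (sum-update (f ∘ suc) (g ∘ suc) s d (λ t t≢s → p (suc t) (t≢s ∘ Finₚ.suc-injective)) q))
  (sym (ℤₚ.+-assoc (f zero) (sum (f ∘ suc)) d))

sum<-lower : ∀ {K f} → 0 < K → NonNeg f → f 0 ℤ.≤ sum< K f
sum<-lower {suc zero} {f} _ p    = ℤₚ.≤-reflexive (sym (ℤₚ.+-identityˡ (f 0)))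
sum<-lower {suc (suc K)} {f} _ p = ℤₚ.≤-trans (ℤₚ.≤-reflexive (sym (ℤₚ.+-identityʳ (f 0)))) (ℤₚ.+-mono-≤ (sum<-lower {suc K} (s≤s z≤n) p) (p (suc K)))

gate : Bool → ℤ → ℤ
gate b x = if b then x else 0ℤ

gate-zero : ∀ b {x} → x ≡ 0ℤ → gate b x ≡ 0ℤ
gate-zero true  p = p
gate-zero false p = refl

gate-nonneg : ∀ b {x} → 0ℤ ℤ.≤ x → 0ℤ ℤ.≤ gate b x
gate-nonneg true  p = p
gate-nonneg false p = ℤₚ.≤-refl

module Euler {n : ℕ} (M : Fin n → Fin n → ℕ) (cox : IsCoxeterMatrix M) (_≋?_ : ∀ u v → Dec (_≈_ M u v)) where
  open Words M
  open Length M _≋?_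
  open Rep M cox
  open Positivity M cox _≋?_

  -- o t r ≡ true means that t precedes r; only the values on adjacent pairs matter.
  Orientation : Set
  Orientation = Fin n → Fin n → Bool

  -- Makes s a sink. For s initial in c this is the passage from the orientation of c to that of
  -- scs.
  flip : Fin n → Orientation → Orientation
  flip s o t r with t Finₚ.≟ s | r Finₚ.≟ s
  ... | yes _ | _     = false
  ... | no  _ | yes _ = true
  ... | no  _ | no  _ = o t r

  flip-from : ∀ s o r → flip s o s r ≡ false
  flip-from s o r with s Finₚ.≟ s | r Finₚ.≟ s
  ... | yes _  | _ = refl
  ... | no s≢s | _ = contradiction refl s≢s

  flip-to : ∀ {s} o {t} → t ≢ s → flip s o t s ≡ true
  flip-to {s} o {t} t≢s with t Finₚ.≟ s | s Finₚ.≟ s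
  ... | yes t≡s | _      = contradiction t≡s t≢s
  ... | no _    | yes _  = refl
  ... | no _    | no s≢s = contradiction refl s≢s

  flip-off : ∀ {s} o {t r} → t ≢ s → r ≢ s → flip s o t r ≡ o t r
  flip-off {s} o {t} {r} t≢s r≢s with t Finₚ.≟ s | r Finₚ.≟ s
  ... | yes t≡s | _       = contradiction t≡s t≢s
  ... | no _    | yes r≡s = contradiction r≡s r≢s
  ... | no _    | no _    = refl

  Antisym : Orientation → Set
  Antisym o = ∀ t r → Adj t r → o t r ≡ not (o r t)

  Source : Orientation → Fin n → Set
  Source o s = ∀ r → Adj s r → o s r ≡ true

  flip-antisym : ∀ s {o} → Antisym o → Antisym (flip s o)
  flip-antisym s {o} anti t r a with t Finₚ.≟ s | r Finₚ.≟ s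
  ... | yes refl | yes refl = contradiction refl (Adj⇒≢ a)
  ... | yes refl | no  _    = refl
  ... | no  _    | yes _    = refl
  ... | no  _    | no  _    = anti t r a

  flips : Orientation → Word n → Orientation
  flips o []      = o
  flips o (s ∷ x) = flips (flip s o) x

  flips-antisym : ∀ x {o} → Antisym o → Antisym (flips o x)
  flips-antisym [] anti      = anti
  flips-antisym (s ∷ x) anti = flips-antisym x (flip-antisym s anti)

  Adapted : Orientation → Word n → Set
  Adapted o []      = ⊤
  Adapted o (s ∷ x) = Source o s × Adapted (flip s o) x

  source-into : ∀ {o s} → Antisym o → Source o s → ∀ r → Adj r s → o r s ≡ false
  source-into anti src r a = trans (anti r _ a) (cong not (src r (Adj-sym a)))

  -- The interval below K is a union of whole paths for all pairs of letters simultaneously, so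
  -- every `A s t` is self-adjoint for the one pairing `⟨_,_⟩`.
  K,multiple : ∃ λ K → 0 < K × (∀ s t → suc (M s t ℕ.∸ 2) ∣ K)
  K,multiple with common-multiple (λ s → proj₁ (row s)) (λ s → proj₁ (proj₂ (row s)))
    where
    row : ∀ s → ∃ λ K → 0 < K × (∀ t → suc (M s t ℕ.∸ 2) ∣ K)
    row s = common-multiple (λ t → suc (M s t ℕ.∸ 2)) (λ t → s≤s z≤n)
  ... | K , K>0 , d = K , K>0 , λ s t → ∣-trans (proj₂ (proj₂ (common-multiple (λ t → suc (M s t ℕ.∸ 2)) (λ t → s≤s z≤n))) t) (d s)

  abstract
    K : ℕ
    K = proj₁ K,multiple

    K>0 : 0 < K
    K>0 = proj₁ (proj₂ K,multiple)

    ∣K : ∀ s t → suc (M s t ℕ.∸ 2) ∣ K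
    ∣K = proj₂ (proj₂ K,multiple)

  ⟨_,_⟩ : Fun → Fun → ℤ
  ⟨ f , g ⟩ = sum< K (λ i → f i * g i)

  ⟨⟩-cong : ∀ {f f′ g g′} → f ≐ f′ → g ≐ g′ → ⟨ f , g ⟩ ≡ ⟨ f′ , g′ ⟩
  ⟨⟩-cong p q = sum<-cong K (λ i → cong₂ _*_ (p i) (q i))

  ⟨⟩-comm : ∀ f g → ⟨ f , g ⟩ ≡ ⟨ g , f ⟩
  ⟨⟩-comm f g = sum<-cong K (λ i → ℤₚ.*-comm (f i) (g i))

  ⟨⟩-+ˡ : ∀ f g k → ⟨ (λ i → f i + g i) , k ⟩ ≡ ⟨ f , k ⟩ + ⟨ g , k ⟩
  ⟨⟩-+ˡ f g k = trans (sum<-cong K (λ i → ℤₚ.*-distribʳ-+ (k i) (f i) (g i))) (sum<-+ K (λ i → f i * k i) (λ i → g i * k i))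

  ⟨⟩-+ʳ : ∀ f g k → ⟨ f , (λ i → g i + k i) ⟩ ≡ ⟨ f , g ⟩ + ⟨ f , k ⟩
  ⟨⟩-+ʳ f g k = trans (sum<-cong K (λ i → ℤₚ.*-distribˡ-+ (f i) (g i) (k i))) (sum<-+ K (λ i → f i * g i) (λ i → f i * k i))

  ⟨⟩-negˡ : ∀ f g → ⟨ (λ i → - f i) , g ⟩ ≡ - ⟨ f , g ⟩
  ⟨⟩-negˡ f g = trans (sum<-cong K (λ i → sym (ℤₚ.neg-distribˡ-* (f i) (g i)))) (sum<-neg K (λ i → f i * g i))

  ⟨⟩-negʳ : ∀ f g → ⟨ f , (λ i → - g i) ⟩ ≡ - ⟨ f , g ⟩
  ⟨⟩-negʳ f g = trans (⟨⟩-comm f _) (trans (⟨⟩-negˡ g f) (cong -_ (⟨⟩-comm g f)))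

  ⟨⟩-zeroˡ : ∀ {f} → (∀ i → f i ≡ 0ℤ) → ∀ g → ⟨ f , g ⟩ ≡ 0ℤ
  ⟨⟩-zeroˡ p g = trans (sum<-cong K (λ i → cong (_* g i) (p i))) (zeros K)
    where
    zeros : ∀ K → sum< K (λ i → 0ℤ * g i) ≡ 0ℤ
    zeros zero    = refl
    zeros (suc K) = cong (_+ 0ℤ * g K) (zeros K)

  ⟨⟩-zeroʳ : ∀ f {g} → (∀ i → g i ≡ 0ℤ) → ⟨ f , g ⟩ ≡ 0ℤ
  ⟨⟩-zeroʳ f {g} p = trans (⟨⟩-comm f g) (⟨⟩-zeroˡ p f)

  ⟨⟩-nonneg : ∀ {f g} → NonNeg f → NonNeg g → 0ℤ ℤ.≤ ⟨ f , g ⟩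
  ⟨⟩-nonneg p q = sum<-nonneg K (λ i → *-nonneg (p i) (q i))

  ⟨⟩-sumˡ : ∀ {k} (f : Fin k → Fun) g → ⟨ (λ i → sum (λ u → f u i)) , g ⟩ ≡ sum (λ u → ⟨ f u , g ⟩)
  ⟨⟩-sumˡ {zero} f g  = ⟨⟩-zeroˡ (λ _ → refl) g
  ⟨⟩-sumˡ {suc k} f g = trans (⟨⟩-+ˡ (f zero) (λ i → sum (λ u → f (suc u) i)) g) (cong (⟨ f zero , g ⟩ +_) (⟨⟩-sumˡ (f ∘ suc) g))

  ⟨⟩-A : ∀ s t f g → ⟨ A s t f , g ⟩ ≡ ⟨ f , A s t g ⟩
  ⟨⟩-A s t = Path.A-self-adjoint (suc (M s t ℕ.∸ 2)) (∣K s t)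

  later : Orientation → V → V
  later o w t i = sum (λ r → gate (o t r) (A t r (w r) i))

  L : Orientation → V → V
  L o w t i = w t i - later o w t i

  L-cong : ∀ o {v w} → v ≗ⱽ w → L o v ≗ⱽ L o w
  L-cong o p t i = cong₂ _-_ (p t i) (sum-cong-≗ (λ r → cong (gate (o t r)) (A-cong t r (p r) i)))

  L-e : ∀ o s f t i → L o (e s f) t i ≡ e s f t i - gate (o t s) (A t s f i)
  L-e o s f t i = cong (λ z → e s f t i - z)
    (trans (sum-single _ s (λ r r≢s → gate-zero (o t r) (A-zero t r (e-off r≢s f) i))) (cong (gate (o t s)) (A-cong t s (e-at s f) i)))

  L-source : ∀ {o s} → Source o s → ∀ w i → L o w s i ≡ w s i - nbrs s w i
  L-source {o} {s} src w i = cong (λ z → w s i - z) (sum-cong-≗ go)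
    where
    go : ∀ r → gate (o s r) (A s r (w r) i) ≡ A s r (w r) i
    go r with nonadj? s r
    ... | yes z = trans (gate-zero (o s r) (A-nonadjacent s r z (w r) i)) (sym (A-nonadjacent s r z (w r) i))
    ... | no a  = cong (λ b → gate b (A s r (w r) i)) (src r a)

  L-flip-at : ∀ {o s} → Source o s → ∀ w i → L (flip s o) (act s w) s i ≡ - L o w s i
  L-flip-at {o} {s} src w i = begin
    act s w s i - later (flip s o) (act s w) s i  ≡⟨ cong₂ _-_ (act-at s w i) (sum-zero _ (λ r → cong (λ b → gate b (A s r (act s w r) i)) (flip-from s o r))) ⟩
    - w s i + nbrs s w i - 0ℤ                     ≡⟨ ring (w s i) (nbrs s w i) ⟩
    - (w s i - nbrs s w i)                        ≡⟨ cong -_ (L-source {o} src w i) ⟨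
    - L o w s i ∎
    where
    open ≡-Reasoning
    ring : ∀ x y → - x + y - 0ℤ ≡ - (x - y)
    ring = solve-∀

  L-flip-off : ∀ {o s} → Antisym o → Source o s → ∀ w {t} → t ≢ s → ∀ i →
    L (flip s o) (act s w) t i ≡ L o w t i + A t s (L o w s) i
  L-flip-off {o} {s} anti src w {t} t≢s i = trans (cong₂ _-_ (act-off t≢s w i) (sum-update _ _ s (- A t s (L o w s) i) same at-s))
    (ring (w t i) (later o w t i) (A t s (L o w s) i))
    where
    ring : ∀ x y z → x - (y + - z) ≡ x - y + z
    ring = solve-∀
    same : ∀ r → r ≢ s → gate (flip s o t r) (A t r (act s w r) i) ≡ gate (o t r) (A t r (w r) i)
    same r r≢s = cong₂ gate (flip-off o t≢s r≢s) (A-cong t r (act-off r≢s w) i)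
    old-zero : gate (o t s) (A t s (w s) i) ≡ 0ℤ
    old-zero with nonadj? t s
    ... | yes z = gate-zero (o t s) (A-nonadjacent t s z (w s) i)
    ... | no a  = cong (λ b → gate b (A t s (w s) i)) (source-into anti src t a)
    at-s : gate (flip s o t s) (A t s (act s w s) i) ≡ gate (o t s) (A t s (w s) i) + - A t s (L o w s) i
    at-s = begin
      gate (flip s o t s) (A t s (act s w s) i)   ≡⟨ cong (λ b → gate b (A t s (act s w s) i)) (flip-to o t≢s) ⟩
      A t s (act s w s) i                         ≡⟨ A-cong t s (λ j → trans (act-at s w j) (trans (ring′ (w s j) (nbrs s w j)) (cong -_ (sym (L-source {o} src w j))))) i ⟩
      A t s (λ j → - L o w s j) i                 ≡⟨ A-neg t s (L o w s) i ⟩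
      - A t s (L o w s) i                         ≡⟨ ℤₚ.+-identityˡ _ ⟨
      0ℤ + - A t s (L o w s) i                    ≡⟨ cong (_+ - A t s (L o w s) i) old-zero ⟨
      gate (o t s) (A t s (w s) i) + - A t s (L o w s) i ∎
      where
      open ≡-Reasoning
      ring′ : ∀ x y → - x + y ≡ - (x - y)
      ring′ = solve-∀

  -- On multiples of α_t and α_r with t ≠ r, this pairs through -`A t r` if t precedes r and is 0
  -- otherwise; on equal simple roots it is the plain pairing. The sum of E and its transpose is the
  -- Coxeter form.
  E : Orientation → V → V → ℤ
  E o v w = sum (λ t → ⟨ v t , L o w t ⟩)

  E-cong : ∀ o {v v′ w w′} → v ≗ⱽ v′ → w ≗ⱽ w′ → E o v w ≡ E o v′ w′
  E-cong o p q = sum-cong-≗ (λ t → ⟨⟩-cong (p t) (L-cong o q t))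

  -- Let l be the s-coordinate of `L o w`. The reflection negates l and adds `A t s l` to every
  -- other coordinate t. By self-adjointness these additions pair with v to the neighbour sum of s,
  -- which cancels the neighbour term in `act s v`.
  E-flip : ∀ {o s} → Antisym o → Source o s → ∀ v w → E (flip s o) (act s v) (act s w) ≡ E o v w
  E-flip {o} {s} anti src v w = begin
    sum (λ t → ⟨ act s v t , L (flip s o) (act s w) t ⟩)
      ≡⟨ sum-update g _ s (- ⟨ nbrs s v , l ⟩) off-s at-s ⟩
    sum g - ⟨ nbrs s v , l ⟩
      ≡⟨ cong₂ _-_ (∑-distrib-+ (λ t → ⟨ v t , L o w t ⟩) (λ t → ⟨ A s t (v t) , l ⟩)) (⟨⟩-sumˡ (λ u → A s u (v u)) l) ⟩
    E o v w + sum (λ t → ⟨ A s t (v t) , l ⟩) - sum (λ t → ⟨ A s t (v t) , l ⟩)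
      ≡⟨ ring (E o v w) (sum (λ t → ⟨ A s t (v t) , l ⟩)) ⟩
    E o v w ∎
    where
    open ≡-Reasoning
    l : Fun
    l = L o w s
    g : Fin n → ℤ
    g t = ⟨ v t , L o w t ⟩ + ⟨ A s t (v t) , l ⟩
    ring : ∀ x y → x + y - y ≡ x
    ring = solve-∀
    off-s : ∀ t → t ≢ s → ⟨ act s v t , L (flip s o) (act s w) t ⟩ ≡ g t
    off-s t t≢s = trans (⟨⟩-cong (act-off t≢s v) (L-flip-off anti src w t≢s))
      (trans (⟨⟩-+ʳ (v t) (L o w t) (A t s l))
        (cong (⟨ v t , L o w t ⟩ +_) (trans (sym (⟨⟩-A t s (v t) l)) (⟨⟩-cong (A-sym t s (v t)) (λ _ → refl)))))
    at-s : ⟨ act s v s , L (flip s o) (act s w) s ⟩ ≡ g s + - ⟨ nbrs s v , l ⟩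
    at-s = begin
      ⟨ act s v s , L (flip s o) (act s w) s ⟩          ≡⟨ ⟨⟩-cong (act-at s v) (L-flip-at {o} src w) ⟩
      ⟨ (λ i → - v s i + nbrs s v i) , (λ i → - l i) ⟩  ≡⟨ ⟨⟩-negʳ (λ i → - v s i + nbrs s v i) l ⟩
      - ⟨ (λ i → - v s i + nbrs s v i) , l ⟩            ≡⟨ cong -_ (⟨⟩-+ˡ (λ i → - v s i) (nbrs s v) l) ⟩
      - (⟨ (λ i → - v s i) , l ⟩ + ⟨ nbrs s v , l ⟩)    ≡⟨ cong (λ z → - (z + ⟨ nbrs s v , l ⟩)) (⟨⟩-negˡ (v s) l) ⟩
      - (- ⟨ v s , l ⟩ + ⟨ nbrs s v , l ⟩)              ≡⟨ ring′ ⟨ v s , l ⟩ ⟨ nbrs s v , l ⟩ ⟩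
      ⟨ v s , l ⟩ + 0ℤ + - ⟨ nbrs s v , l ⟩             ≡⟨ cong (λ z → ⟨ v s , l ⟩ + z + - ⟨ nbrs s v , l ⟩) (⟨⟩-zeroˡ (A-diag s (v s)) l) ⟨
      g s + - ⟨ nbrs s v , l ⟩ ∎
      where
      ring′ : ∀ x y → - (- x + y) ≡ x + 0ℤ + - y
      ring′ = solve-∀

  E-word : ∀ x {o} → Antisym o → Adapted o x → ∀ v w → E o (x · v) (x · w) ≡ E (flips o x) v w
  E-word [] anti ad v w                = refl
  E-word (s ∷ x) {o} anti (src , ad) v w = trans (sym (E-flip anti src (act s (x · v)) (act s (x · w))))
    (trans (E-cong (flip s o) (act-involutive s (x · v)) (act-involutive s (x · w))) (E-word x (flip-antisym s anti) ad v w))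

  E-eˡ : ∀ o s f w → E o (e s f) w ≡ ⟨ f , L o w s ⟩
  E-eˡ o s f w = trans (sum-single _ s (λ t t≢s → ⟨⟩-zeroˡ (e-off t≢s f) (L o w t))) (⟨⟩-cong (e-at s f) (λ _ → refl))

  -- No neighbour precedes a source, so `L o` fixes `e s f`.
  E-e-source : ∀ {o s} → Antisym o → Source o s → ∀ v f → E o v (e s f) ≡ ⟨ v s , f ⟩
  E-e-source {o} {s} anti src v f = trans (sum-single _ s off-s) (⟨⟩-cong {v s} (λ _ → refl) at-s)
    where
    off-s : ∀ t → t ≢ s → ⟨ v t , L o (e s f) t ⟩ ≡ 0ℤ
    off-s t t≢s = ⟨⟩-zeroʳ (v t) (λ i → trans (L-e o s f t i) (cong₂ _-_ (e-off t≢s f i) (gated i)))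
      where
      gated : ∀ i → gate (o t s) (A t s f i) ≡ 0ℤ
      gated i with nonadj? t s
      ... | yes z = gate-zero (o t s) (A-nonadjacent t s z f i)
      ... | no a  = cong (λ b → gate b (A t s f i)) (source-into anti src t a)
    at-s : ∀ i → L o (e s f) s i ≡ f i
    at-s i = trans (L-e o s f s i) (trans (cong₂ _-_ (e-at s f i) (gate-zero (o s s) (A-diag s f i))) (ℤₚ.+-identityʳ (f i)))

  later-nonneg : ∀ o {w} → Nonnegⱽ w → Nonnegⱽ (later o w)
  later-nonneg o p t i = sum-nonneg _ (λ r → gate-nonneg (o t r) (A-nonneg t r (p r) i))

  len-∷≤ : ∀ s w → len (s ∷ w) ≤ suc (len w)
  len-∷≤ s w = ℕₚ.≤-trans (len-++ [ s ] w) (ℕₚ.+-monoˡ-≤ (len w) (len≤length [ s ]))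

  descent-∷ : ∀ {s x r} → Reduced M (s ∷ x) → Descent x r → Descent (s ∷ x) r
  descent-∷ {s} {x} {r} red d = ¬ascent⇒descent {s ∷ x} {r} λ a → ℕₚ.<-irrefl refl (begin-strict
    len (s ∷ x)            <⟨ ℕₚ.n<1+n _ ⟩
    suc (len (s ∷ x))      ≡⟨ a ⟨
    len (s ∷ x ++ [ r ])   ≤⟨ len-∷≤ s (x ++ [ r ]) ⟩
    suc (len (x ++ [ r ])) ≡⟨ d ⟨
    len x                  ≤⟨ len≤length x ⟩
    length x               ≤⟨ ℕₚ.n≤1+n _ ⟩
    length (s ∷ x)         ≡⟨ reduced⇒len red ⟨
    len (s ∷ x) ∎)
    where open ℕₚ.≤-Reasoning

  len-[] : len [] ≡ 0
  len-[] = ℕₚ.n≤0⇒n≡0 (len≤length [])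

  -- If s x turns e t negative while x does not, then s x sends e t to a negative multiple of e s; as s is a
  -- source, the Euler form then contradicts positivity of (s x) e r.
  crossing : ∀ {o s x} → Antisym o → Adapted o (s ∷ x) → ∀ {t r} → Adj t r → flips o (s ∷ x) t r ≡ true →
    Ascent x t → Descent (s ∷ x) t → ¬ Ascent (s ∷ x) r
  crossing {o} {s} {x} anti ad@(src , _) {t} {r} t~r t→r asc desc ascr = ℤₚ.<-irrefl refl (begin-strict
    E o v y                                    ≡⟨ trans (E-word (s ∷ x) anti ad (e t ones) (e r ones)) (E-eˡ oₖ t ones (e r ones)) ⟩
    ⟨ ones , L oₖ (e r ones) t ⟩               ≡⟨ ⟨⟩-cong {ones} (λ _ → refl) (λ i → trans (L-e oₖ r ones t i) (cong₂ _-_ (e-off (Adj⇒≢ t~r) ones i) (cong (λ b → gate b (A t r ones i)) t→r))) ⟩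
    ⟨ ones , (λ i → 0ℤ - A t r ones i) ⟩       ≡⟨ ⟨⟩-cong {ones} (λ _ → refl) (λ i → ℤₚ.+-identityˡ _) ⟩
    ⟨ ones , (λ i → - A t r ones i) ⟩          ≡⟨ ⟨⟩-negʳ ones (A t r ones) ⟩
    - ⟨ ones , A t r ones ⟩                    <⟨ ℤₚ.neg-mono-< positive ⟩
    0ℤ                                         ≤⟨ ⟨⟩-nonneg {h} {later o y s} h≥0 (later-nonneg o y≥0 s) ⟩
    ⟨ h , later o y s ⟩                        ≡⟨ trans (cong (_+ ⟨ h , later o y s ⟩) zero₁) (ℤₚ.+-identityˡ _) ⟨
    ⟨ y s , v s ⟩ + ⟨ h , later o y s ⟩        ≡⟨ cong₂ _+_ (⟨⟩-comm (y s) (v s)) (trans (⟨⟩-negˡ (v s) (later o y s)) (sym (⟨⟩-negʳ (v s) (later o y s)))) ⟩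
    ⟨ v s , y s ⟩ + ⟨ v s , (λ i → - later o y s i) ⟩  ≡⟨ ⟨⟩-+ʳ (v s) (y s) (λ i → - later o y s i) ⟨
    ⟨ v s , L o y s ⟩                          ≡⟨ E-eˡ o s (v s) y ⟨
    E o (e s (v s)) y                          ≡⟨ E-cong o {w = y} (λ u i → sym (v≗ u i)) (λ _ _ → refl) ⟩
    E o v y ∎)
    where
    open ℤₚ.≤-Reasoning
    oₖ : Orientation
    oₖ = flips o (s ∷ x)
    v y : V
    v = (s ∷ x) · e t ones
    y = (s ∷ x) · e r ones
    h : Fun
    h i = - v s i
    v≤0 : Nonposⱽ v
    v≤0 = descent⇒negative {s ∷ x} {t} desc ones ones-nonneg
    h≥0 : NonNeg h
    h≥0 i = ℤₚ.neg-mono-≤ (v≤0 s i)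
    y≥0 : Nonnegⱽ y
    y≥0 = ascent⇒positive ascr ones ones-nonneg
    v≗ : v ≗ⱽ e s (v s)
    v≗ u i = go (u Finₚ.≟ s)
      where
      go : Dec (u ≡ s) → v u i ≡ e s (v s) u i
      go (yes refl) = sym (e-at s (v s) i)
      go (no u≢s)   = trans (ℤₚ.≤-antisym (v≤0 u i) (subst (0ℤ ℤ.≤_) (sym (act-off u≢s (x · e t ones) i)) (ascent⇒positive asc ones ones-nonneg u i)))
        (sym (e-off u≢s (v s) i))
    r↛t : oₖ r t ≡ false
    r↛t = trans (flips-antisym (s ∷ x) anti r t (Adj-sym t~r)) (cong not t→r)
    -- The transposed value E(y, v) equals that of the simple roots of r and t, which is 0 since r
    -- does not precede t. As v is a multiple of the source root, the same value is the pairing of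
    -- `y s` with `v s`.
    zero₁ : ⟨ y s , v s ⟩ ≡ 0ℤ
    zero₁ = trans (sym (E-e-source anti src y (v s))) (trans (E-cong o {v = y} (λ _ _ → refl) (λ u i → sym (v≗ u i)))
      (trans (E-word (s ∷ x) anti ad (e r ones) (e t ones)) (trans (E-eˡ oₖ r ones (e t ones))
        (⟨⟩-zeroʳ ones (λ i → trans (L-e oₖ t ones r i) (cong₂ _-_ (e-off (Adj⇒≢ (Adj-sym t~r)) ones i) (cong (λ b → gate b (A r t ones i)) r↛t)))))))
    -- The summand at vertex 0 is already 1, and the others are non-negative.
    positive : 0ℤ ℤ.< ⟨ ones , A t r ones ⟩
    positive = ℤₚ.<-≤-trans (ℤ.+<+ (s≤s z≤n)) (subst (ℤ._≤ ⟨ ones , A t r ones ⟩) (trans (ℤₚ.*-identityˡ _) (A-ones t~r))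
      (sum<-lower {f = λ i → 1ℤ * A t r ones i} K>0 (λ i → *-nonneg (ones-nonneg i) (A-nonneg t r ones-nonneg i))))

  -- Letters are removed from the left until the sign of the root of t changes; `crossing` applies
  -- there. Reducedness carries the descent r of the remaining suffix back through the removed
  -- letters.
  propagate : ∀ x {o} → Antisym o → Adapted o x → Reduced M x → ∀ {t r} → Adj t r → flips o x t r ≡ true →
    Descent x t → Descent x r
  propagate [] anti ad red t~r t→r d with () ← trans (sym len-[]) d
  propagate (s ∷ x) anti (src , ad) red {t} {r} t~r t→r d with ascent⊎descent x t
  ... | inj₁ a  = ¬ascent⇒descent {s ∷ x} {r} (crossing {x = x} anti (src , ad) t~r t→r a d)
  ... | inj₂ d′ = descent-∷ red (propagate x (flip-antisym s anti) ad (reduced-++ʳ [ s ] x red) t~r t→r d′)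

-- Words without repeated letters, and commutation classes

sum-lower : ∀ {n} (f : Fin n → ℤ) → (∀ t → 0ℤ ℤ.≤ f t) → ∀ s → f s ℤ.≤ sum f
sum-lower f p zero    = ℤₚ.≤-trans (ℤₚ.≤-reflexive (sym (ℤₚ.+-identityʳ (f zero)))) (ℤₚ.+-monoʳ-≤ (f zero) (sum-nonneg (f ∘ suc) (p ∘ suc)))
sum-lower f p (suc s) = ℤₚ.≤-trans (ℤₚ.≤-reflexive (sym (ℤₚ.+-identityˡ (f (suc s))))) (ℤₚ.+-mono-≤ (p zero) (sum-lower (f ∘ suc) (p ∘ suc) s))

module _ {A : Set} where

  Unique-resp-↭ : {xs ys : List A} → xs ↭ ys → Unique xs → Unique ys
  Unique-resp-↭ p = PermS.Unique-resp-↭ (setoid A) (↭⇒↭ₛ p)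

  unique-tail : ∀ {x : A} {xs} → Unique (x ∷ xs) → Unique xs
  unique-tail (_ ∷ u) = u

  unique-++ˡ : ∀ (xs : List A) {ys} → Unique (xs ++ ys) → Unique xs
  unique-++ˡ []       u       = []
  unique-++ˡ (x ∷ xs) u@(_ ∷ v) = All.tabulate (λ y∈ e → Unique[x∷xs]⇒x∉xs u (∈-++⁺ˡ (subst (_∈ xs) (sym e) y∈))) ∷ unique-++ˡ xs v

  unique-++-disjoint : ∀ (xs : List A) {ys} → Unique (xs ++ ys) → ∀ {z} → z ∈ xs → z ∉ ys
  unique-++-disjoint (x ∷ xs) u (here refl) z∈ = Unique[x∷xs]⇒x∉xs u (∈-++⁺ʳ xs z∈)
  unique-++-disjoint (x ∷ xs) u (there p) z∈   = unique-++-disjoint xs (unique-tail u) p z∈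

  ∈-tail : ∀ {x z : A} {xs ys} → x ∉ xs → z ∈ xs → z ∈ x ∷ ys → z ∈ ys
  ∈-tail x∉ z∈ (here refl) = contradiction z∈ x∉
  ∈-tail x∉ z∈ (there q)   = q

  unique⊆⇒↭++ : ∀ {xs ys : List A} → Unique xs → (∀ {z} → z ∈ xs → z ∈ ys) → ∃ λ zs → ys ↭ xs ++ zs
  unique⊆⇒↭++ {[]} {ys} _ _ = ys , ↭-refl
  unique⊆⇒↭++ {x ∷ xs} {ys} u sub with ys₁ , ys₂ , refl ← ∈-∃++ (sub (here refl))
    with zs , p ← unique⊆⇒↭++ {xs} {ys₁ ++ ys₂} (unique-tail u) (λ z∈ → ∈-tail (Unique[x∷xs]⇒x∉xs u) z∈ (∈-resp-↭ (shift x ys₁ ys₂) (sub (there z∈))))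
    = zs , ↭-trans (shift x ys₁ ys₂) (prep x p)

covering⇒↭ : ∀ {n} (c : Word n) → (∀ s → s ∈ c) → length c ≤ length (allFin n) → c ↭ allFin n
covering⇒↭ {n} c all le with unique⊆⇒↭++ (allFin⁺ n) (λ {z} _ → all z)
... | [] , p     = subst (c ↭_) (++-identityʳ (allFin n)) p
... | z ∷ zs , p = contradiction (ℕₚ.≤-trans (ℕₚ.≤-reflexive (trans (sym (length-++ (allFin n))) (sym (↭-length p)))) le) (ℕₚ.m+1+n≰m (length (allFin n)))

module Commutation {n : ℕ} (M : Fin n → Fin n → ℕ) (cox : IsCoxeterMatrix M) (_≋?_ : ∀ u v → Dec (_≈_ M u v)) where
  open IsCoxeterMatrix cox
  open Words M
  open Length M _≋?_
  open Rep M cox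
  open Positivity M cox _≋?_
  open Euler M cox _≋?_

  Commutes : Fin n → Fin n → Set
  Commutes s t = s ≢ t × M s t ℕ.∸ 2 ≡ 0

  infix 4 _~ᶜ_
  data _~ᶜ_ : Word n → Word n → Set where
    ~refl  : ∀ {u} → u ~ᶜ u
    ~trans : ∀ {u v w} → u ~ᶜ v → v ~ᶜ w → u ~ᶜ w
    ~∷     : ∀ s {u v} → u ~ᶜ v → s ∷ u ~ᶜ s ∷ v
    ~swap  : ∀ {s t} → Commutes s t → ∀ u → s ∷ t ∷ u ~ᶜ t ∷ s ∷ u

  Commutes-sym : ∀ {s t} → Commutes s t → Commutes t s
  Commutes-sym {s} {t} (s≢t , z) = s≢t ∘ sym , trans (cong (ℕ._∸ 2) (symm t s)) z

  ~⇒≋ : ∀ {u v} → u ~ᶜ v → u ≋ v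
  ~⇒≋ ~refl                = ≈refl
  ~⇒≋ (~trans p q)         = ≈trans (~⇒≋ p) (~⇒≋ q)
  ~⇒≋ (~∷ s p)             = ∷-cong s (~⇒≋ p)
  ~⇒≋ (~swap (s≢t , z) u)  = ++-congʳ u (commute s≢t z)

  ~⇒length : ∀ {u v} → u ~ᶜ v → length u ≡ length v
  ~⇒length ~refl        = refl
  ~⇒length (~trans p q) = trans (~⇒length p) (~⇒length q)
  ~⇒length (~∷ s p)     = cong suc (~⇒length p)
  ~⇒length (~swap _ u)  = refl

  move-front : ∀ {s} c₁ {c₂} → (∀ {u} → u ∈ c₁ → Commutes u s) → c₁ ++ s ∷ c₂ ~ᶜ s ∷ c₁ ++ c₂
  move-front [] _           = ~refl
  move-front (u ∷ c₁) comm = ~trans (~∷ u (move-front c₁ (comm ∘ there))) (~swap (comm (here refl)) (c₁ ++ _))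

  infixr 5 _⁻·_
  -- The action of the inverse of w, which reads w from the left. Left descents of w show in the
  -- sign of `w ⁻· e s ones`.
  _⁻·_ : Word n → V → V
  []      ⁻· v = v
  (s ∷ w) ⁻· v = w ⁻· act s v

  ⁻·-reverse : ∀ w v → w ⁻· v ≡ reverse w · v
  ⁻·-reverse [] v      = refl
  ⁻·-reverse (s ∷ w) v = trans (⁻·-reverse w (act s v)) (sym (trans (cong (_· v) (unfold-reverse s w)) (·-++ (reverse w) [ s ] v)))

  ⁻·-≋ : ∀ {x y} → x ≋ y → ∀ v → x ⁻· v ≗ⱽ y ⁻· v
  ⁻·-≋ {x} {y} p v t i = trans (cong (λ z → z t i) (⁻·-reverse x v)) (trans (·-≋ (reverse-cong p) v t i) (cong (λ z → z t i) (sym (⁻·-reverse y v))))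

  ⁻·-cong : ∀ x {u v} → u ≗ⱽ v → x ⁻· u ≗ⱽ x ⁻· v
  ⁻·-cong [] p      = p
  ⁻·-cong (s ∷ x) p = ⁻·-cong x (act-cong s p)

  ⁻·-++ : ∀ x y v → (x ++ y) ⁻· v ≡ y ⁻· x ⁻· v
  ⁻·-++ [] y v      = refl
  ⁻·-++ (s ∷ x) y v = ⁻·-++ x y (act s v)

  ⁻·-neg : ∀ x v → x ⁻· (-ⱽ v) ≗ⱽ -ⱽ (x ⁻· v)
  ⁻·-neg [] v t i      = refl
  ⁻·-neg (s ∷ x) v t i = trans (⁻·-cong x (act-neg s v) t i) (⁻·-neg x (act s v) t i)

  ⁻·-absent : ∀ {s} w → s ∉ w → ∀ v → (w ⁻· v) s ≐ v s
  ⁻·-absent [] _ v i           = refl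
  ⁻·-absent {s} (t ∷ w) s∉ v i = trans (⁻·-absent w (s∉ ∘ there) (act t v) i) (act-off (s∉ ∘ here) v i)

  ∷⁻·e : ∀ s z → (s ∷ z) ⁻· e s ones ≗ⱽ -ⱽ (z ⁻· e s ones)
  ∷⁻·e s z t i = trans (⁻·-cong z (act-e s ones) t i) (⁻·-neg z (e s ones) t i)

  -- Each letter of c acts once, on a coordinate that is still 0, and replaces it by the
  -- non-negative sum over its neighbours. The coordinate of s is never touched, so each u in c
  -- receives at least the contribution of s.
  grow : ∀ {s} c → Unique c → s ∉ c → ∀ v → Nonnegⱽ v → (∀ {u} → u ∈ c → ∀ i → v u i ≡ 0ℤ) →
    Nonnegⱽ (c ⁻· v) × (∀ {u} → u ∈ c → ∀ i → A u s (v s) i ℤ.≤ (c ⁻· v) u i)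
  grow [] _ _ v v≥0 _ = v≥0 , λ ()
  grow {s} (t ∷ c) uniq s∉ v v≥0 vanish = proj₁ rec , bound
    where
    at-t : ∀ i → act t v t i ≡ nbrs t v i
    at-t i = trans (act-at t v i) (trans (cong (λ z → - z + nbrs t v i) (vanish (here refl) i)) (ℤₚ.+-identityˡ _))
    v′≥0 : Nonnegⱽ (act t v)
    v′≥0 u i = go (u Finₚ.≟ t)
      where
      go : Dec (u ≡ t) → 0ℤ ℤ.≤ act t v u i
      go (yes refl) = subst (0ℤ ℤ.≤_) (sym (at-t i)) (nbrs-nonneg t v≥0 i)
      go (no u≢t)   = subst (0ℤ ℤ.≤_) (sym (act-off u≢t v i)) (v≥0 u i)
    t∉c : t ∉ c
    t∉c = Unique[x∷xs]⇒x∉xs uniq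
    rec = grow {s} c (unique-tail uniq) (s∉ ∘ there) (act t v) v′≥0
      (λ {u} u∈ i → trans (act-off (λ u≡t → t∉c (subst (_∈ c) u≡t u∈)) v i) (vanish (there u∈) i))
    bound : ∀ {u} → u ∈ t ∷ c → ∀ i → A u s (v s) i ℤ.≤ (c ⁻· act t v) u i
    bound (here refl) i = ℤₚ.≤-trans (sum-lower (λ u → A t u (v u) i) (λ u → A-nonneg t u (v≥0 u) i) s)
      (ℤₚ.≤-reflexive (trans (sym (at-t i)) (sym (⁻·-absent c t∉c (act t v) i))))
    bound {u} (there u∈) i = ℤₚ.≤-trans (ℤₚ.≤-reflexive (A-cong u s (λ j → sym (act-off (s∉ ∘ here) v j)) i)) (proj₂ rec u∈ i)

  grow-e : ∀ {s} c → Unique c → s ∉ c →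
    Nonnegⱽ (c ⁻· e s ones) × (∀ {u} → u ∈ c → ∀ i → A u s ones i ℤ.≤ (c ⁻· e s ones) u i)
  grow-e {s} c uniq s∉ with p , q ← grow c uniq s∉ (e s ones) (e-nonneg s ones-nonneg) (λ u∈ → e-off (λ u≡s → s∉ (subst (_∈ c) u≡s u∈)) ones)
    = p , λ {u} u∈ i → ℤₚ.≤-trans (ℤₚ.≤-reflexive (A-cong u s (λ j → sym (e-at s ones j)) i)) (q u∈ i)

  1≰0 : ¬ (1ℤ ℤ.≤ 0ℤ)
  1≰0 (ℤ.+≤+ ())

  -- Only the letter s can change the coordinate of s, which starts at 1.
  letter-present : ∀ {s c} → Nonposⱽ (c ⁻· e s ones) → s ∈ c
  letter-present {s} {c} np with _∈?_ Finₚ._≟_ s c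
  ... | yes p = p
  ... | no s∉ = contradiction (subst (ℤ._≤ 0ℤ) (trans (⁻·-absent c s∉ (e s ones) 0) (e-at s ones 0)) (np s 0)) 1≰0

  unique-split : ∀ {s : Fin n} c₁ {c₂} → Unique (c₁ ++ s ∷ c₂) → Unique (s ∷ c₁ ++ c₂)
  unique-split {s} c₁ {c₂} = Unique-resp-↭ (shift s c₁ c₂)

  -- A letter u before s and adjacent to s acquires a positive coordinate at vertex 0. It does not
  -- occur again, so that coordinate survives to the end, against the sign assumed. Hence every
  -- letter before s commutes with s.
  pull-letter : ∀ {s c} → Unique c → Nonposⱽ (c ⁻· e s ones) →
    Σ (Word n) λ d → (c ~ᶜ s ∷ d) × Unique (s ∷ d) × (c ↭ s ∷ d)
  pull-letter {s} {c} uniq np with c₁ , c₂ , refl ← ∈-∃++ (letter-present {s} {c} np)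
    = c₁ ++ c₂ , move-front c₁ comm , uniq′ , shift s c₁ c₂
    where
    uniq′ : Unique (s ∷ c₁ ++ c₂)
    uniq′ = unique-split c₁ uniq
    s∉ : s ∉ c₁ ++ c₂
    s∉ = Unique[x∷xs]⇒x∉xs uniq′
    comm : ∀ {u} → u ∈ c₁ → Commutes u s
    comm {u} u∈ = u≢s , nonadj (nonadj? u s)
      where
      u≢s : u ≢ s
      u≢s refl = s∉ (∈-++⁺ˡ u∈)
      u∉c₂ : u ∉ c₂
      u∉c₂ = unique-++-disjoint c₁ (unique-tail uniq′) u∈
      value : ((c₁ ++ s ∷ c₂) ⁻· e s ones) u 0 ≡ (c₁ ⁻· e s ones) u 0
      value = trans (cong (λ z → z u 0) (⁻·-++ c₁ (s ∷ c₂) (e s ones)))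
        (trans (⁻·-absent c₂ u∉c₂ (act s (c₁ ⁻· e s ones)) 0) (act-off u≢s (c₁ ⁻· e s ones) 0))
      nonadj : Dec (M u s ℕ.∸ 2 ≡ 0) → M u s ℕ.∸ 2 ≡ 0
      nonadj (yes z) = z
      nonadj (no a)  = contradiction (ℤₚ.≤-trans (ℤₚ.≤-reflexive (sym (A-ones a)))
        (ℤₚ.≤-trans (proj₂ (grow-e c₁ (unique-++ˡ c₁ (unique-tail uniq′)) (s∉ ∘ ∈-++⁺ˡ)) u∈ 0)
          (subst (ℤ._≤ 0ℤ) value (np u 0)))) 1≰0

  neg-nonpos : ∀ {v} → Nonnegⱽ v → Nonposⱽ (-ⱽ v)
  neg-nonpos p t i = ℤₚ.neg-mono-≤ (p t i)

  nonpos-cong : ∀ {u v} → u ≗ⱽ v → Nonposⱽ u → Nonposⱽ v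
  nonpos-cong p q t i = subst (ℤ._≤ 0ℤ) (p t i) (q t i)

  -- The first letter of e′ is a left descent of e′, hence of c, so it can be pulled to the front of
  -- c and cancelled.
  unique≋⇒~ : ∀ e′ c → Unique e′ → Unique c → c ≋ e′ → c ~ᶜ e′
  unique≋⇒~ [] [] _ _ _ = ~refl
  unique≋⇒~ [] (s ∷ c) _ uniq p = contradiction (letter-present {s} {[]} (nonpos-cong (⁻·-≋ p (e s ones))
    (nonpos-cong (λ t i → sym (∷⁻·e s c t i)) (neg-nonpos (proj₁ (grow-e c (unique-tail uniq) (Unique[x∷xs]⇒x∉xs uniq))))))) λ ()
  unique≋⇒~ (s ∷ e′) c uniqe uniq p with pull-letter {s} {c} uniq (nonpos-cong (λ t i → sym (⁻·-≋ p (e s ones) t i))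
    (nonpos-cong (λ t i → sym (∷⁻·e s e′ t i)) (neg-nonpos (proj₁ (grow-e e′ (unique-tail uniqe) (Unique[x∷xs]⇒x∉xs uniqe))))))
  ... | d , c~ , uniqd , _ = ~trans c~ (~∷ s (unique≋⇒~ e′ d (unique-tail uniqe) (unique-tail uniqd)
        (cancelˡ [ s ] (≈trans (≈sym (~⇒≋ c~)) p))))

  reduced-∷⇒nonneg : ∀ {s z} → Reduced M (s ∷ z) → Nonnegⱽ (z ⁻· e s ones)
  reduced-∷⇒nonneg {s} {z} r = nonneg-cong (λ t i → cong (λ y → y t i) (sym (⁻·-reverse z (e s ones)))) (ascent⇒positive asc ones ones-nonneg)
    where
    asc : Ascent (reverse z) s
    asc = begin
      len (reverse z ++ [ s ])  ≡⟨ len-cong (≡⇒≋ (sym (unfold-reverse s z))) ⟩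
      len (reverse (s ∷ z))     ≡⟨ len-reverse (s ∷ z) ⟩
      len (s ∷ z)               ≡⟨ reduced⇒len r ⟩
      suc (length z)            ≡⟨ cong suc (reduced⇒len (reduced-++ʳ [ s ] z r)) ⟨
      suc (len z)               ≡⟨ cong suc (len-reverse z) ⟨
      suc (len (reverse z)) ∎
      where open ≡-Reasoning

  left-descent-nonpos : ∀ {s z y} → Reduced M (s ∷ z) → y ≋ s ∷ z → Nonposⱽ (y ⁻· e s ones)
  left-descent-nonpos {s} {z} {y} r p = nonpos-cong (λ t i → trans (sym (∷⁻·e s z t i)) (⁻·-≋ (≈sym p) (e s ones) t i)) (neg-nonpos (reduced-∷⇒nonneg r))

  left-descent⇒∷ : ∀ {s y} → len (s ∷ y) < len y → Σ (Word n) λ z → Reduced M (s ∷ z) × y ≋ s ∷ z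
  left-descent⇒∷ {s} {y} lt = red (s ∷ y) , len⇒reduced (ℕₚ.≤-trans (s≤s (ℕₚ.≤-reflexive (length-red (s ∷ y)))) (ℕₚ.≤-trans lt (ℕₚ.≤-reflexive (len-cong y≋)))) , y≋
    where
    y≋ : y ≋ s ∷ red (s ∷ y)
    y≋ = ≈trans (≈sym (∷-cancel s y)) (∷-cong s (≈sym (red-≋ (s ∷ y))))

  -- If s were missing from c, then c would preserve every s-coordinate. But writing p = p₁ s p₂,
  -- the vector p₂⁻¹ α_s has s-coordinate 1, and p turns it into -1. So all letters occur, and the
  -- length leaves no room for repetitions.
  coxeter⇒↭ : ∀ {p c} → p ↭ allFin n → p ≋ c → Reduced M c → c ↭ allFin n
  coxeter⇒↭ {p} {c} perm p≋c r = covering⇒↭ c present (ℕₚ.≤-trans (r p p≋c) (ℕₚ.≤-reflexive (↭-length perm)))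
    where
    present : ∀ s → s ∈ c
    present s with _∈?_ Finₚ._≟_ s c
    ... | yes s∈ = s∈
    ... | no s∉ with p₁ , p₂ , refl ← ∈-∃++ (∈-resp-↭ (↭-sym perm) (∈-allFin s)) = contradiction contra λ ()
      where
      uniq : Unique (s ∷ p₁ ++ p₂)
      uniq = unique-split p₁ (Unique-resp-↭ (↭-sym perm) (allFin⁺ n))
      x : V
      x = p₂ ⁻· e s ones
      p₂x : p₂ · x ≗ⱽ e s ones
      p₂x t i = trans (cong (λ z → (p₂ · z) t i) (⁻·-reverse p₂ (e s ones)))
        (trans (cong (λ z → z t i) (sym (·-++ p₂ (reverse p₂) (e s ones)))) (·-≋ (inverseʳ p₂) (e s ones) t i))
      contra : 1ℤ ≡ - 1ℤ
      contra = begin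
        1ℤ                               ≡⟨ e-at s ones 0 ⟨
        e s ones s 0                     ≡⟨ ⁻·-absent p₂ (Unique[x∷xs]⇒x∉xs uniq ∘ ∈-++⁺ʳ p₁) (e s ones) 0 ⟨
        x s 0                            ≡⟨ ·-absent c s∉ x 0 ⟨
        (c · x) s 0                      ≡⟨ ·-≋ p≋c x s 0 ⟨
        ((p₁ ++ s ∷ p₂) · x) s 0         ≡⟨ cong (λ z → z s 0) (·-++ p₁ (s ∷ p₂) x) ⟩
        (p₁ · act s (p₂ · x)) s 0        ≡⟨ ·-absent p₁ (Unique[x∷xs]⇒x∉xs uniq ∘ ∈-++⁺ˡ) (act s (p₂ · x)) 0 ⟩
        act s (p₂ · x) s 0               ≡⟨ act-cong s p₂x s 0 ⟩
        act s (e s ones) s 0             ≡⟨ act-e s ones s 0 ⟩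
        - e s ones s 0                   ≡⟨ cong -_ (e-at s ones 0) ⟩
        - 1ℤ ∎
        where open ≡-Reasoning

-- Adapted words, and greedy reading of a periodic word

module AdaptedWords {n : ℕ} (M : Fin n → Fin n → ℕ) (cox : IsCoxeterMatrix M) (_≋?_ : ∀ u v → Dec (_≈_ M u v)) where
  open Words M
  open Length M _≋?_
  open Rep M cox
  open Euler M cox _≋?_
  open Commutation M cox _≋?_

  infix 4 _≈ᵒ_
  _≈ᵒ_ : Orientation → Orientation → Set
  o ≈ᵒ o′ = ∀ t r → Adj t r → o t r ≡ o′ t r

  flip-cong : ∀ s {o o′} → o ≈ᵒ o′ → flip s o ≈ᵒ flip s o′
  flip-cong s p t r a with t Finₚ.≟ s | r Finₚ.≟ s
  ... | yes _ | _     = refl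
  ... | no  _ | yes _ = refl
  ... | no  _ | no  _ = p t r a

  flip-comm : ∀ {s u} → s ≢ u → M s u ℕ.∸ 2 ≡ 0 → ∀ o → flip s (flip u o) ≈ᵒ flip u (flip s o)
  flip-comm {s} {u} s≢u z o t r a = go (t Finₚ.≟ s) (t Finₚ.≟ u) (r Finₚ.≟ s) (r Finₚ.≟ u)
    where
    go : Dec (t ≡ s) → Dec (t ≡ u) → Dec (r ≡ s) → Dec (r ≡ u) → flip s (flip u o) t r ≡ flip u (flip s o) t r
    go (yes refl) (yes refl) _ _        = refl
    go (yes refl) (no t≢u) _ (yes refl) = contradiction z a
    go (yes refl) (no t≢u) _ (no r≢u)   = trans (flip-from s (flip u o) r) (sym (trans (flip-off (flip s o) t≢u r≢u) (flip-from s o r)))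
    go (no t≢s) (yes refl) (yes refl) _ = contradiction z (Adj-sym a)
    go (no t≢s) (yes refl) (no r≢s) _   = trans (flip-off (flip u o) t≢s r≢s) (trans (flip-from u o r) (sym (flip-from u (flip s o) r)))
    go (no t≢s) (no t≢u) (yes refl) (yes refl) = refl
    go (no t≢s) (no t≢u) (yes refl) (no r≢u) = trans (flip-to (flip u o) t≢s) (sym (trans (flip-off (flip s o) t≢u r≢u) (flip-to o t≢s)))
    go (no t≢s) (no t≢u) (no r≢s) (yes refl) = trans (flip-off (flip u o) t≢s r≢s) (trans (flip-to o t≢u) (sym (flip-to (flip s o) t≢u)))
    go (no t≢s) (no t≢u) (no r≢s) (no r≢u) = trans (flip-off (flip u o) t≢s r≢s) (trans (flip-off o t≢u r≢u)
      (sym (trans (flip-off (flip s o) t≢u r≢u) (flip-off o t≢s r≢s))))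

  adapted-cong : ∀ x {o o′} → o ≈ᵒ o′ → Adapted o x → Adapted o′ x
  adapted-cong [] p ad              = tt
  adapted-cong (s ∷ x) p (src , ad) = (λ r a → trans (sym (p s r a)) (src r a)) , adapted-cong x (flip-cong s p) ad

  adapted-snoc : ∀ x {o t} → Adapted o x → Source (flips o x) t → Adapted o (x ++ [ t ])
  adapted-snoc [] ad src               = src , tt
  adapted-snoc (s ∷ x) (src′ , ad) src = src′ , adapted-snoc x ad src

  flips-snoc : ∀ x o t → flips o (x ++ [ t ]) ≡ flip t (flips o x)
  flips-snoc [] o t      = refl
  flips-snoc (s ∷ x) o t = flips-snoc x (flip s o) t

  ∈-∷-≢ : ∀ {t s : Fin n} {d} → t ≢ s → t ∈ s ∷ d → t ∈ d
  ∈-∷-≢ t≢s (here e)  = contradiction e t≢s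
  ∈-∷-≢ t≢s (there p) = p

  source-flip : ∀ {o s u} → s ≢ u → M s u ℕ.∸ 2 ≡ 0 → Source o s → Source (flip u o) s
  source-flip {o} s≢u z src r a = trans (flip-off o s≢u (λ { refl → a z })) (src r a)

  -- Two sources are never adjacent, so the first letter of y either is a or commutes with a; in the
  -- latter case a is still a source after the flip.
  pull-front : ∀ y {o a} → Antisym o → Source o a → a ∈ y → Adapted o y →
    Σ (Word n) λ y′ → (y ~ᶜ a ∷ y′) × Adapted (flip a o) y′
  pull-front (b ∷ y) {o} {a} anti srca a∈ (srcb , ad) with a Finₚ.≟ b
  ... | yes refl = y , ~refl , ad
  ... | no a≢b with nonadj? a b
  ...   | no a~b = contradiction (trans (sym (srca b a~b)) (source-into anti srcb a a~b)) λ ()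
  ...   | yes z with y′ , y~ , ad′ ← pull-front y (flip-antisym b anti) (source-flip {o} a≢b z srca) (∈-∷-≢ a≢b a∈) ad
          = b ∷ y′ , ~trans (~∷ b y~) (~swap (Commutes-sym (a≢b , z)) y′) , source-flip {o} (a≢b ∘ sym) (proj₂ (Commutes-sym (a≢b , z))) srcb , adapted-cong y′ (flip-comm a≢b z o) ad′

  -- The first letter of x is a left descent of y, so it occurs in y and can be pulled to the front.
  -- The last letter stays open, as adaptedness is assumed of `x` but not of `x ++ [ r ]`; what
  -- remains of y at the end is one letter.
  adapted-unique : ∀ x {r y o} → Antisym o → Adapted o x → Adapted o y → Reduced M (x ++ [ r ]) → Reduced M y →
    x ++ [ r ] ≋ y → ∃ λ r′ → y ~ᶜ x ++ [ r′ ]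
  adapted-unique [] {y = y} anti adx ady redx redy p = single y (reduced-≋-length redx redy p)
    where
    single : ∀ y → 1 ≡ length y → ∃ λ r′ → y ~ᶜ [ r′ ]
    single (r′ ∷ []) _ = r′ , ~refl
  adapted-unique (a ∷ x) {r} {y} anti (srca , adx) ady redx redy p
    with y′ , y~ , ady′ ← pull-front y anti srca (letter-present {a} {y} (left-descent-nonpos redx (≈sym p))) ady
    with r′ , q ← adapted-unique x {r} {y′} (flip-antisym a anti) adx ady′ (reduced-++ʳ [ a ] (x ++ [ r ]) redx)
                    (reduced-++ʳ [ a ] y′ (reduced-cong (~⇒≋ y~) (~⇒length y~) redy)) (cancelˡ [ a ] (≈trans p (~⇒≋ y~)))
    = r′ , ~trans y~ (~∷ a q)

  ori : Word n → Orientation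
  ori []      t r = false
  ori (u ∷ c) t r with u Finₚ.≟ t | u Finₚ.≟ r
  ... | yes _ | _     = true
  ... | no  _ | yes _ = false
  ... | no  _ | no  _ = ori c t r

  ori-first : ∀ t c r → ori (t ∷ c) t r ≡ true
  ori-first t c r with t Finₚ.≟ t | t Finₚ.≟ r
  ... | yes _  | _ = refl
  ... | no t≢t | _ = contradiction refl t≢t

  ori-second : ∀ {t r} c → r ≢ t → ori (r ∷ c) t r ≡ false
  ori-second {t} {r} c r≢t with r Finₚ.≟ t | r Finₚ.≟ r
  ... | yes p | _      = contradiction p r≢t
  ... | no _  | yes _  = refl
  ... | no _  | no r≢r = contradiction refl r≢r

  ori-skip : ∀ {u t r} c → u ≢ t → u ≢ r → ori (u ∷ c) t r ≡ ori c t r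
  ori-skip {u} {t} {r} c u≢t u≢r with u Finₚ.≟ t | u Finₚ.≟ r
  ... | yes p | _     = contradiction p u≢t
  ... | no _  | yes p = contradiction p u≢r
  ... | no _  | no _  = refl

  ori-∷-cong : ∀ u {c c′ t r} → ori c t r ≡ ori c′ t r → ori (u ∷ c) t r ≡ ori (u ∷ c′) t r
  ori-∷-cong u {t = t} {r} p with u Finₚ.≟ t | u Finₚ.≟ r
  ... | yes _ | _     = refl
  ... | no  _ | yes _ = refl
  ... | no  _ | no  _ = p

  ori-~ : ∀ {c c′} → c ~ᶜ c′ → ori c ≈ᵒ ori c′
  ori-~ ~refl t r a        = refl
  ori-~ (~trans p q) t r a = trans (ori-~ p t r a) (ori-~ q t r a)
  ori-~ (~∷ u {c} {c′} p) t r a = ori-∷-cong u {c} {c′} (ori-~ p t r a)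
  ori-~ (~swap {x} {y} (x≢y , z) c) t r a = go (x Finₚ.≟ t) (x Finₚ.≟ r) (y Finₚ.≟ t) (y Finₚ.≟ r)
    where
    go : Dec (x ≡ t) → Dec (x ≡ r) → Dec (y ≡ t) → Dec (y ≡ r) → ori (x ∷ y ∷ c) t r ≡ ori (y ∷ x ∷ c) t r
    go (yes refl) _ _ (yes refl)        = contradiction z a
    go (yes refl) _ _ (no y≢r)          = trans (ori-first x (y ∷ c) r) (sym (trans (ori-skip (x ∷ c) (x≢y ∘ sym) y≢r) (ori-first x c r)))
    go (no x≢t) (yes refl) (yes refl) _ = contradiction z (Adj-sym a)
    go (no x≢t) (yes refl) (no y≢t) _   = trans (ori-second (y ∷ c) x≢t) (sym (trans (ori-skip (x ∷ c) y≢t (x≢y ∘ sym)) (ori-second c x≢t)))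
    go (no x≢t) (no x≢r) _ _ = trans (ori-skip (y ∷ c) x≢t x≢r) (ori-∷-cong y {c} {x ∷ c} (sym (ori-skip c x≢t x≢r)))

  ori-++ : ∀ {t} c y r → t ∈ c → ori (c ++ y) t r ≡ ori c t r
  ori-++ {t} (u ∷ c) y r t∈ with u Finₚ.≟ t | u Finₚ.≟ r
  ... | yes _  | _     = refl
  ... | no _   | yes _ = refl
  ... | no u≢t | no _  = ori-++ c y r (∈-∷-≢ (u≢t ∘ sym) t∈)

  ori-antisym : ∀ {t r} c → t ≢ r → t ∈ c → ori c t r ≡ not (ori c r t)
  ori-antisym {t} {r} (u ∷ c) t≢r t∈ with u Finₚ.≟ t | u Finₚ.≟ r
  ... | yes refl | yes refl = contradiction refl t≢r
  ... | yes refl | no  _    = refl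
  ... | no  _    | yes _    = refl
  ... | no  u≢t  | no  _    = ori-antisym c t≢r (∈-∷-≢ (u≢t ∘ sym) t∈)

  ori-absent : ∀ {t r} c y → t ∉ c → r ∈ c → ori (c ++ y) t r ≡ false
  ori-absent {t} {r} (u ∷ c) y t∉ r∈ with u Finₚ.≟ t | u Finₚ.≟ r
  ... | yes refl | _     = contradiction (here refl) t∉
  ... | no _     | yes _ = refl
  ... | no _     | no u≢r = ori-absent c y (t∉ ∘ there) (∈-∷-≢ (u≢r ∘ sym) r∈)

  ori-rotate : ∀ {s d} → Unique (s ∷ d) → (∀ t → t ∈ s ∷ d) → ori (d ++ [ s ]) ≈ᵒ flip s (ori (s ∷ d))
  ori-rotate {s} {d} uniq all t r a = go (t Finₚ.≟ s) (r Finₚ.≟ s)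
    where
    go : Dec (t ≡ s) → Dec (r ≡ s) → ori (d ++ [ s ]) t r ≡ flip s (ori (s ∷ d)) t r
    go (yes refl) _ = trans (ori-absent d [ s ] (Unique[x∷xs]⇒x∉xs uniq) (∈-∷-≢ (Adj⇒≢ a ∘ sym) (all r)))
      (sym (flip-from s (ori (s ∷ d)) r))
    go (no t≢s) (yes refl) = trans (ori-antisym (d ++ [ s ]) t≢s (∈-++⁺ˡ (∈-∷-≢ t≢s (all t))))
      (trans (cong not (ori-absent d [ s ] (Unique[x∷xs]⇒x∉xs uniq) (∈-∷-≢ t≢s (all t)))) (sym (flip-to (ori (s ∷ d)) t≢s)))
    go (no t≢s) (no r≢s) = trans (ori-++ d [ s ] r (∈-∷-≢ t≢s (all t)))
      (sym (trans (flip-off (ori (s ∷ d)) t≢s r≢s) (ori-skip d (t≢s ∘ sym) (r≢s ∘ sym))))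

  data Before : Word n → Fin n → Fin n → Set where
    first : ∀ {t r d} → r ∈ d → Before (t ∷ d) t r
    further : ∀ {t r u d} → Before d t r → Before (u ∷ d) t r

  before-∈ : ∀ {d t r} → Before d t r → t ∈ d × r ∈ d
  before-∈ (first p) = here refl , there p
  before-∈ (further b) with p , q ← before-∈ b = there p , there q

  before-snoc : ∀ d {u t r} → Before (d ++ [ u ]) t r → Before d t r ⊎ (r ≡ u × t ∈ d)
  before-snoc [] (further ())
  before-snoc (x ∷ d) (first p) with ∈-++⁻ d p
  ... | inj₁ q           = inj₁ (first q)
  ... | inj₂ (here refl) = inj₂ (refl , here refl)
  before-snoc (x ∷ d) (further b) with before-snoc d b
  ... | inj₁ q       = inj₁ (further q)
  ... | inj₂ (e , q) = inj₂ (e , there q)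

  before⇒ori : ∀ {d t r} → Unique d → Before d t r → ori d t r ≡ true
  before⇒ori {t ∷ d} {t} {r} uniq (first p) = ori-first t d r
  before⇒ori {u ∷ d} {t} {r} uniq (further b) = trans (ori-skip {u} d
      (λ { refl → Unique[x∷xs]⇒x∉xs uniq (proj₁ (before-∈ b)) }) (λ { refl → Unique[x∷xs]⇒x∉xs uniq (proj₂ (before-∈ b)) }))
    (before⇒ori (unique-tail uniq) b)

  -- Reading the periodic word d d d ⋯ from left to right after having taken x: zs is what is taken from now on,
  -- and a letter may be skipped only if it is a descent.
  data Run : Word n → Word n → Word n → Set where
    done : ∀ {x d} → Run x d []
    taken : ∀ {x t d zs} → Run (x ++ [ t ]) (d ++ [ t ]) zs → Run x (t ∷ d) (t ∷ zs)
    skipped : ∀ {x t d zs} → Descent x t → Run x (d ++ [ t ]) zs → Run x (t ∷ d) zs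

  unique-rotate : ∀ {t : Fin n} {d} → Unique (t ∷ d) → Unique (d ++ [ t ])
  unique-rotate {t} {d} = Unique-resp-↭ (++-comm [ t ] d)

  descent-persists : ∀ {x t u} → Ascent x t → Descent x u → t ≢ u → M t u ℕ.∸ 2 ≡ 0 → Descent (x ++ [ t ]) u
  descent-persists {x} {t} {u} asc d t≢u z = ¬ascent⇒descent {x ++ [ t ]} {u} λ a → ℕₚ.<-irrefl refl (begin-strict
    len x                            <⟨ ℕₚ.n<1+n _ ⟩
    suc (len x)                      ≡⟨ asc ⟨
    len (x ++ [ t ])                 <⟨ ℕₚ.n<1+n _ ⟩
    suc (len (x ++ [ t ]))           ≡⟨ a ⟨
    len ((x ++ [ t ]) ++ [ u ])      ≡⟨ len-cong (≈trans (≡⇒≋ (++-assoc x [ t ] [ u ])) (≈trans (++-congˡ x (commute t≢u z)) (≡⇒≋ (sym (++-assoc x [ u ] [ t ]))))) ⟩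
    len ((x ++ [ u ]) ++ [ t ])      ≤⟨ len-snoc≤ (x ++ [ u ]) t ⟩
    suc (len (x ++ [ u ]))           ≡⟨ d ⟨
    len x ∎)
    where open ℕₚ.≤-Reasoning

  -- F collects the skipped letters; they stay descents and precede every letter that was not skipped.
  module _ (o₀ : Orientation) (anti : Antisym o₀) where

    run⇒adapted : ∀ {x d zs} (F : Word n) → Unique d → (∀ t → t ∈ d) → Reduced M (x ++ zs) → Adapted o₀ x →
      (∀ {t} → t ∈ F → Descent x t) →
      (∀ {t r} → t ∈ F → r ∉ F → Adj t r → flips o₀ x t r ≡ true) →
      (∀ {t r} → t ∉ F → r ∉ F → Before d t r → Adj t r → flips o₀ x t r ≡ true) →
      Run x d zs → Adapted o₀ (x ++ zs)
    run⇒adapted {x} F uniq all red ad I₀ I₁ I₂ done = subst (Adapted o₀) (sym (++-identityʳ x)) ad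
    run⇒adapted {x} F uniq all red ad I₀ I₁ I₂ (taken {t = t} {d} {zs} run) =
      subst (Adapted o₀) (++-assoc x [ t ] zs)
        (run⇒adapted F (unique-rotate uniq) (λ u → ∈-resp-↭ (++-comm [ t ] d) (all u)) (subst (Reduced M) (sym (++-assoc x [ t ] zs)) red)
          (adapted-snoc x ad src) J₀ J₁ J₂ run)
      where
      redx : Reduced M x
      redx = reduced-++ˡ x (t ∷ zs) red
      asc : Ascent x t
      asc = reduced-snoc⇒ascent {x} {t} (reduced-++ˡ (x ++ [ t ]) zs (subst (Reduced M) (sym (++-assoc x [ t ] zs)) red))
      ¬desc : ¬ Descent x t
      ¬desc = ascent⇒¬descent {x} {t} asc
      t∉F : t ∉ F
      t∉F t∈ = ¬desc (I₀ t∈)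
      -- A skipped neighbour u of t precedes t, so `propagate` would make t a descent too, and it
      -- could not be taken.
      F-nonadj : ∀ {u} → u ∈ F → ¬ Adj u t
      F-nonadj u∈ a = ¬desc (propagate x anti ad redx a (I₁ u∈ t∉F a) (I₀ u∈))
      src : Source (flips o₀ x) t
      src r a with _∈?_ Finₚ._≟_ r F
      ... | yes r∈ = contradiction (Adj-sym a) (F-nonadj r∈)
      ... | no r∉  = I₂ t∉F r∉ (first (∈-∷-≢ (Adj⇒≢ a ∘ sym) (all r))) a
      ≢t : ∀ {u} → u ∈ F → u ≢ t
      ≢t u∈ refl = t∉F u∈
      J₀ : ∀ {u} → u ∈ F → Descent (x ++ [ t ]) u
      J₀ {u} u∈ with nonadj? t u
      ... | yes z = descent-persists {x} asc (I₀ u∈) (≢t u∈ ∘ sym) z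
      ... | no a  = contradiction (Adj-sym a) (F-nonadj u∈)
      J₁ : ∀ {u r} → u ∈ F → r ∉ F → Adj u r → flips o₀ (x ++ [ t ]) u r ≡ true
      J₁ {u} {r} u∈ r∉ a = trans (cong (λ z → z u r) (flips-snoc x o₀ t)) (go (r Finₚ.≟ t))
        where
        go : Dec (r ≡ t) → flip t (flips o₀ x) u r ≡ true
        go (yes refl) = flip-to (flips o₀ x) (≢t u∈)
        go (no r≢t)   = trans (flip-off (flips o₀ x) (≢t u∈) r≢t) (I₁ u∈ r∉ a)
      J₂ : ∀ {u r} → u ∉ F → r ∉ F → Before (d ++ [ t ]) u r → Adj u r → flips o₀ (x ++ [ t ]) u r ≡ true
      J₂ {u} {r} u∉ r∉ b a = trans (cong (λ z → z u r) (flips-snoc x o₀ t)) (go (before-snoc d b))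
        where
        ∈d⇒≢t : ∀ {v} → v ∈ d → v ≢ t
        ∈d⇒≢t v∈ refl = Unique[x∷xs]⇒x∉xs uniq v∈
        go : Before d u r ⊎ (r ≡ t × u ∈ d) → flip t (flips o₀ x) u r ≡ true
        go (inj₂ (refl , u∈)) = flip-to (flips o₀ x) (∈d⇒≢t u∈)
        go (inj₁ b′)          = trans (flip-off (flips o₀ x) (∈d⇒≢t (proj₁ (before-∈ b′))) (∈d⇒≢t (proj₂ (before-∈ b′)))) (I₂ u∉ r∉ (further b′) a)
    run⇒adapted {x} F uniq all red ad I₀ I₁ I₂ (skipped {t = t} {d} {zs} desc run) =
      run⇒adapted (t ∷ F) (unique-rotate uniq) (λ u → ∈-resp-↭ (++-comm [ t ] d) (all u)) red ad J₀ J₁ J₂ run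
      where
      J₀ : ∀ {u} → u ∈ t ∷ F → Descent x u
      J₀ (here refl) = desc
      J₀ (there p)   = I₀ p
      J₁ : ∀ {u r} → u ∈ t ∷ F → r ∉ t ∷ F → Adj u r → flips o₀ x u r ≡ true
      J₁ (there p) r∉ a = I₁ p (r∉ ∘ there) a
      J₁ {r = r} (here refl) r∉ a with _∈?_ Finₚ._≟_ t F
      ... | yes t∈ = I₁ t∈ (r∉ ∘ there) a
      -- The letter t is at the front of `t ∷ d`, hence before every other letter that was not
      -- skipped.
      ... | no t∉  = I₂ t∉ (r∉ ∘ there) (first (∈-∷-≢ (r∉ ∘ here) (all r))) a
      J₂ : ∀ {u r} → u ∉ t ∷ F → r ∉ t ∷ F → Before (d ++ [ t ]) u r → Adj u r → flips o₀ x u r ≡ true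
      J₂ u∉ r∉ b a with before-snoc d b
      ... | inj₁ b′         = I₂ (u∉ ∘ there) (r∉ ∘ there) (further b′) a
      -- Moving t to the end creates only pairs with second letter t, which now belongs to the
      -- skipped letters.
      ... | inj₂ (refl , _) = contradiction (here refl) r∉

  ori-Antisym : ∀ {c} → (∀ t → t ∈ c) → Antisym (ori c)
  ori-Antisym {c} all t r a = ori-antisym c (Adj⇒≢ a) (all t)

  greedy⇒adapted : ∀ {c zs} → Unique c → (∀ t → t ∈ c) → Reduced M zs → Run [] c zs → Adapted (ori c) zs
  greedy⇒adapted {c} uniq all red = run⇒adapted (ori c) (ori-Antisym all) [] uniq all red tt (λ ()) (λ ()) (λ _ _ b _ → before⇒ori uniq b)

-- The lexicographically first subword is greedy

module Greedy {n : ℕ} (M : Fin n → Fin n → ℕ) (cox : IsCoxeterMatrix M) (_≋?_ : ∀ u v → Dec (_≈_ M u v))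
  {w0 : Word n} (longest : Longest M w0) (c : Word n) (all : ∀ t → t ∈ c) where
  open Words M
  open Length M _≋?_
  open Positivity M cox _≋?_
  open Euler M cox _≋?_
  open AdaptedWords M cox _≋?_

  Position : Set
  Position = Pos M (length c)

  infix 4 _≺_
  _≺_ : Position → Position → Set
  _≺_ = _<P_ M

  word : List Position → Word n
  word = letters M c

  ≺-irrefl : ∀ {p} → ¬ (p ≺ p)
  ≺-irrefl (inj₁ lt)       = ℕₚ.<-irrefl refl lt
  ≺-irrefl (inj₂ (_ , lt)) = ℕₚ.<-irrefl refl lt

  ≺-asym : ∀ {p q} → p ≺ q → ¬ (q ≺ p)
  ≺-asym (inj₁ lt) (inj₁ lt′)             = ℕₚ.<-asym lt lt′
  ≺-asym (inj₁ lt) (inj₂ (refl , _))      = ℕₚ.<-irrefl refl lt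
  ≺-asym (inj₂ (refl , _)) (inj₁ lt)      = ℕₚ.<-irrefl refl lt
  ≺-asym (inj₂ (_ , lt)) (inj₂ (_ , lt′)) = ℕₚ.<-asym lt lt′

  lex-contradiction : ∀ as {p q bs es} → q ≺ p → ¬ LexLe M (as ++ p ∷ bs) (as ++ q ∷ es)
  lex-contradiction [] q≺p (lex< p≺q) = ≺-asym q≺p p≺q
  lex-contradiction [] q≺p (lex≡ _)   = ≺-irrefl q≺p
  lex-contradiction (a ∷ as) q≺p (lex< a≺a) = ≺-irrefl a≺a
  lex-contradiction (a ∷ as) q≺p (lex≡ l)   = lex-contradiction as q≺p l

  -- As long as some letter lengthens x, it can be taken from the next copy of c, which contains
  -- every letter. The fuel bounds the length still missing to that of w∘.
  extend : ∀ fuel x k → Reduced M x → length w0 ≤ len x ℕ.+ fuel → Σ (List Position) λ es →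
    (∀ q → proj₁ q ≤ k → Linked _≺_ (q ∷ es)) × Reduced M (x ++ word es) × (x ++ word es ≋ w0)
  extend fuel x k r le with Finₚ.any? (λ s → len (x ++ [ s ]) ℕ.≟ suc (len x))
  extend fuel x k r le | no ¬asc = [] , (λ q _ → [-]) , subst (Reduced M) (sym (++-identityʳ x)) r
    , ≈trans (≡⇒≋ (++-identityʳ x)) (all-descents⇒longest longest {x} (λ s → ¬ascent⇒descent {x} {s} (λ a → ¬asc (s , a))))
  extend zero x k r le | yes (s , a) = contradiction
    (ℕₚ.≤-trans (ℕₚ.≤-reflexive (sym a)) (ℕₚ.≤-trans (len≤longest longest (x ++ [ s ])) (ℕₚ.≤-trans le (ℕₚ.≤-reflexive (ℕₚ.+-identityʳ _))))) (ℕₚ.<-irrefl refl)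
  extend (suc fuel) x k r le | yes (s , a)
    with es , link , r′ , p ← extend fuel (x ++ [ s ]) (suc k) (ascent⇒reduced-snoc {x} {s} r a)
           (ℕₚ.≤-trans le (ℕₚ.≤-reflexive (trans (ℕₚ.+-suc (len x) fuel) (cong (ℕ._+ fuel) (sym a)))))
    = q ∷ es , (λ q′ q′≤k → inj₁ (s≤s q′≤k) ∷ link q ℕₚ.≤-refl) , subst (Reduced M) eq r′ , ≈trans (≡⇒≋ (sym eq)) p
    where
    q : Position
    q = suc k , index (all s)
    eq : (x ++ [ s ]) ++ word es ≡ x ++ word (q ∷ es)
    eq = trans (++-assoc x [ s ] (word es)) (cong (λ z → x ++ z ∷ word es) (lookup-index (all s)))

  From : ℕ → ℕ → Position → Set
  From k j (k′ , j′) = (k < k′) ⊎ (k ≡ k′ × j ≤ toℕ j′)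

  HeadFrom : ℕ → ℕ → List Position → Set
  HeadFrom k j []      = ⊤
  HeadFrom k j (p ∷ _) = From k j p

  index-after : ∀ (d pre : Word n) {t todo} → d ≡ pre ++ t ∷ todo → Σ (Fin (length d)) λ j → toℕ j ≡ length pre × lookup d j ≡ t
  index-after _ [] refl        = zero , refl , refl
  index-after _ (_ ∷ pre) refl with j , e , l ← index-after _ pre refl = suc j , cong suc e , l

  from-or-past : ∀ {k j} p → From k j p → (proj₁ p ≡ k × toℕ (proj₂ p) ≡ j) ⊎ From k (suc j) p
  from-or-past p (inj₁ lt) = inj₂ (inj₁ lt)
  from-or-past {k} {j} p (inj₂ (refl , le)) with ℕₚ.m≤n⇒m<n∨m≡n le
  ... | inj₁ lt = inj₂ (inj₂ (refl , lt))
  ... | inj₂ e  = inj₁ (refl , sym e)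

  bounded : ∀ (ws : List Position) → ∃ λ B → All (λ p → proj₁ p < B) ws
  bounded []             = 0 , []
  bounded ((k , _) ∷ ws) with B , bs ← bounded ws =
    suc k ℕ.⊔ B , ℕₚ.m≤m⊔n (suc k) B ∷ All.map (λ lt → ℕₚ.≤-trans lt (ℕₚ.m≤n⊔m (suc k) B)) bs

  module _ {ws : List Position} (lex : IsLexFirstWo M w0 c ws) where

    linked-ws : Linked _≺_ ws
    linked-ws = proj₁ (proj₁ lex)

    reduced-ws : Reduced M (word ws)
    reduced-ws = proj₁ (proj₂ (proj₁ lex))

    word-snoc : ∀ as p {t} → lookup c (proj₂ p) ≡ t → word (as ++ [ p ]) ≡ word as ++ [ t ]
    word-snoc as p refl = map-++ _ as [ p ]

    -- If the skipped letter lengthened the word taken so far, `extend` would complete the two to an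
    -- expression of w∘ that is lexicographically earlier than `ws`.
    skipped-descent : ∀ as {p bs} → ws ≡ as ++ p ∷ bs → ∀ q → q ≺ p → (∀ es → Linked _≺_ (q ∷ es) → Linked _≺_ (as ++ q ∷ es)) →
      ∀ {t} → lookup c (proj₂ q) ≡ t → Descent (word as) t
    skipped-descent as {p} {bs} eq q q≺p glue {t} l = ¬ascent⇒descent {word as} {t} λ a →
      let red-as = reduced-++ˡ (word as) (word (p ∷ bs)) (subst (Reduced M) (trans (cong word eq) (map-++ _ as (p ∷ bs))) reduced-ws)
          (es , link , r , w) = extend (length w0) (word as ++ [ t ]) (proj₁ q) (ascent⇒reduced-snoc {word as} {t} red-as a) (ℕₚ.m≤n+m (length w0) _)
          word≡ = trans (++-assoc (word as) [ t ] (word es)) (trans (cong (λ z → word as ++ z ∷ word es) (sym l)) (sym (map-++ _ as (q ∷ es))))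
      in lex-contradiction as q≺p (subst (λ z → LexLe M z (as ++ q ∷ es)) eq
           (proj₂ lex (as ++ q ∷ es) (glue es (link q ℕₚ.≤-refl) , subst (Reduced M) word≡ r , ≈trans (≡⇒≋ (sym word≡)) w)))

    walk : ∀ B k pre todo → c ≡ pre ++ todo → ∀ as bs → ws ≡ as ++ bs → Linked _≺_ bs → All (λ p → proj₁ p < k ℕ.+ B) bs →
      HeadFrom k (length pre) bs → (∀ q es → From k (length pre) q → Linked _≺_ (q ∷ es) → Linked _≺_ (as ++ q ∷ es)) →
      Run (word as) (todo ++ pre) (word bs)
    walk B k pre todo c≡ as [] ws≡ link bnd head glue = done
    walk zero k pre [] c≡ as (p ∷ bs) ws≡ link (lt ∷ _) head glue = contradiction (ℕₚ.≤-trans lt (ℕₚ.≤-reflexive (ℕₚ.+-identityʳ k))) (ℕₚ.≤⇒≯ (k≤ head))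
      where
      k≤ : From k (length pre) p → k ≤ proj₁ p
      k≤ (inj₁ lt)        = ℕₚ.<⇒≤ lt
      k≤ (inj₂ (refl , _)) = ℕₚ.≤-refl
    walk (suc B) k pre [] c≡ as (p ∷ bs) ws≡ link bnd head glue =
      subst (λ d → Run (word as) d (word (p ∷ bs))) (trans (++-identityʳ c) (trans c≡ (++-identityʳ pre)))
        (walk B (suc k) [] c refl as (p ∷ bs) ws≡ link (subst (λ b → All (λ p → proj₁ p < b) (p ∷ bs)) (ℕₚ.+-suc k B) bnd)
          (next head) (λ q es f → glue q es (prev f)))
      where
      next : From k (length pre) p → From (suc k) 0 p
      next (inj₁ lt) with ℕₚ.m≤n⇒m<n∨m≡n lt
      ... | inj₁ lt′ = inj₁ lt′
      ... | inj₂ e   = inj₂ (e , z≤n)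
      next (inj₂ (_ , le)) = contradiction (ℕₚ.≤-trans (Finₚ.toℕ<n (proj₂ p)) (ℕₚ.≤-trans (ℕₚ.≤-reflexive (cong length (trans c≡ (++-identityʳ pre)))) le)) (ℕₚ.<-irrefl refl)
      prev : ∀ {q} → From (suc k) 0 q → From k (length pre) q
      prev (inj₁ lt)         = inj₁ (ℕₚ.<-trans (ℕₚ.n<1+n k) lt)
      prev (inj₂ (refl , _)) = inj₁ (ℕₚ.n<1+n k)
    walk B k pre (t ∷ todo) c≡ as (p ∷ bs) ws≡ link bnd head glue with index-after c pre c≡
    ... | j , toℕj , l with from-or-past p head
    ...   | inj₁ (refl , toℕp) = subst (λ z → Run (word as) (t ∷ todo ++ pre) (z ∷ word bs)) (sym lp) (taken
            (subst₂ (λ x d → Run x d (word bs)) (word-snoc as p lp) (sym (++-assoc todo pre [ t ]))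
              (walk B k (pre ++ [ t ]) todo c≡′ (as ++ [ p ]) bs (trans ws≡ (sym (++-assoc as [ p ] bs))) (tail link) (All.tail bnd) (head′ bs link) glue′)))
      where
      lp : lookup c (proj₂ p) ≡ t
      lp = trans (cong (lookup c) (Finₚ.toℕ-injective (trans toℕp (sym toℕj)))) l
      c≡′ : c ≡ (pre ++ [ t ]) ++ todo
      c≡′ = trans c≡ (sym (++-assoc pre [ t ] todo))
      tail : ∀ {bs} → Linked _≺_ (p ∷ bs) → Linked _≺_ bs
      tail [-]      = []
      tail (_ ∷ ls) = ls
      past : ∀ {q} → p ≺ q → From k (length (pre ++ [ t ])) q
      past (inj₁ lt)       = inj₁ lt
      past (inj₂ (e , lt)) = inj₂ (e , ℕₚ.≤-trans (ℕₚ.≤-reflexive (trans (length-snoc pre t) (cong suc (sym toℕp)))) lt)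
      head′ : ∀ bs → Linked _≺_ (p ∷ bs) → HeadFrom k (length (pre ++ [ t ])) bs
      head′ [] _            = tt
      head′ (q ∷ _) (r ∷ _) = past r
      glue′ : ∀ q es → From k (length (pre ++ [ t ])) q → Linked _≺_ (q ∷ es) → Linked _≺_ ((as ++ [ p ]) ++ q ∷ es)
      glue′ q es f ls = subst (Linked _≺_) (sym (++-assoc as [ p ] (q ∷ es))) (glue p (q ∷ es) head (before f ∷ ls))
        where
        before : From k (length (pre ++ [ t ])) q → p ≺ q
        before (inj₁ lt)        = inj₁ lt
        before (inj₂ (e , le)) = inj₂ (e , ℕₚ.≤-trans (ℕₚ.≤-reflexive (trans (cong suc toℕp) (sym (length-snoc pre t)))) le)
    ...   | inj₂ f = skipped (skipped-descent as ws≡ (k , j) (before f) (λ es → glue (k , j) es (inj₂ (refl , ℕₚ.≤-reflexive (sym toℕj)))) l)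
            (subst (λ d → Run (word as) d (word (p ∷ bs))) (sym (++-assoc todo pre [ t ]))
              (walk B k (pre ++ [ t ]) todo (trans c≡ (sym (++-assoc pre [ t ] todo))) as (p ∷ bs) ws≡ link bnd
                (subst (λ m → From k m p) (sym (length-snoc pre t)) f) (λ q es f′ → glue q es (weaken (subst (λ m → From k m q) (length-snoc pre t) f′)))))
      where
      before : From k (suc (length pre)) p → (k , j) ≺ p
      before (inj₁ lt)        = inj₁ lt
      before (inj₂ (e , le)) = inj₂ (e , subst (λ m → suc m ≤ toℕ (proj₂ p)) (sym toℕj) le)
      weaken : ∀ {q m} → From k (suc m) q → From k m q
      weaken (inj₁ lt)       = inj₁ lt
      weaken (inj₂ (e , le)) = inj₂ (e , ℕₚ.<⇒≤ le)

    greedy-run : Run [] c (word ws)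
    greedy-run = subst (λ d → Run [] d (word ws)) (++-identityʳ c)
      (walk (proj₁ (bounded ws)) 0 [] c refl [] ws refl linked-ws (proj₂ (bounded ws)) (start ws) (λ q es _ ls → ls))
      where
      start : ∀ ws → HeadFrom 0 0 ws
      start []                = tt
      start ((zero , _) ∷ _)  = inj₂ (refl , z≤n)
      start ((suc _ , _) ∷ _) = inj₁ (s≤s z≤n)

    greedy-adapted : Unique c → Adapted (ori c) (word ws)
    greedy-adapted uniq = greedy⇒adapted uniq all reduced-ws greedy-run

-- Faces as subwords of labelled words, and their rotation

module Faces {n : ℕ} (M : Fin n → Fin n → ℕ) (cox : IsCoxeterMatrix M) (_≋?_ : ∀ u v → Dec (_≈_ M u v)) where
  open Words M
  open Length M _≋?_
  open Commutation M cox _≋?_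

  Label : Set
  Label = Fin n × Root M

  infix 4 _~ʳ_
  _~ʳ_ : Root M → Root M → Set
  _~ʳ_ = _~_ M

  ~ʳ-refl : ∀ {β} → β ~ʳ β
  ~ʳ-refl {neg t} = refl
  ~ʳ-refl {pos r} = ≈refl

  ~ʳ-sym : ∀ {β γ} → β ~ʳ γ → γ ~ʳ β
  ~ʳ-sym {neg _} {neg _} p = sym p
  ~ʳ-sym {pos _} {pos _} p = ≈sym p

  ~ʳ-trans : ∀ {β γ δ} → β ~ʳ γ → γ ~ʳ δ → β ~ʳ δ
  ~ʳ-trans {neg _} {neg _} {neg _} p q = trans p q
  ~ʳ-trans {pos _} {pos _} {pos _} p q = ≈trans p q

  Avoids : Root M → Root M → Root M → Set
  Avoids β₁ β₂ ρ = ¬ (ρ ~ʳ β₁) × ¬ (ρ ~ʳ β₂)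

  avoids-cong : ∀ {β₁ β₂ ρ ρ′} → ρ ~ʳ ρ′ → Avoids β₁ β₂ ρ → Avoids β₁ β₂ ρ′
  avoids-cong {β₁} {β₂} {ρ} {ρ′} p (a , b) = (λ q → a (~ʳ-trans {ρ} {ρ′} {β₁} p q)) , (λ q → b (~ʳ-trans {ρ} {ρ′} {β₂} p q))

  -- The complement of a face as a subword z of the labelled word Q whose letters all carry labels
  -- in P. Lists in place of subsets of `Fin` make commutations and rotation structural.
  data Pick (P : Root M → Set) : List Label → Word n → Set where
    nil  : Pick P [] []
    omit : ∀ {x Q z} → Pick P Q z → Pick P (x ∷ Q) z
    keep : ∀ {t ρ Q z} → P ρ → Pick P Q z → Pick P ((t , ρ) ∷ Q) (t ∷ z)

  snoc-omit : ∀ {P Q x z} → Pick P Q z → Pick P (Q ++ [ x ]) z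
  snoc-omit nil        = omit nil
  snoc-omit (omit p)   = omit (snoc-omit p)
  snoc-omit (keep a p) = keep a (snoc-omit p)

  snoc-keep : ∀ {P Q t ρ z} → P ρ → Pick P Q z → Pick P (Q ++ [ (t , ρ) ]) (z ++ [ t ])
  snoc-keep b nil        = keep b nil
  snoc-keep b (omit p)   = omit (snoc-keep b p)
  snoc-keep b (keep a p) = keep a (snoc-keep b p)

  pick-snoc : ∀ {P} Q {t ρ z} → Pick P (Q ++ [ (t , ρ) ]) z →
    Pick P Q z ⊎ (P ρ × Σ (Word n) λ z′ → z ≡ z′ ++ [ t ] × Pick P Q z′)
  pick-snoc [] (omit nil)   = inj₁ nil
  pick-snoc [] (keep b nil) = inj₂ (b , [] , refl , nil)
  pick-snoc (_ ∷ Q) (omit p) with pick-snoc Q p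
  ... | inj₁ q                  = inj₁ (omit q)
  ... | inj₂ (b , z′ , e , q)   = inj₂ (b , z′ , e , omit q)
  pick-snoc (_ ∷ Q) (keep a p) with pick-snoc Q p
  ... | inj₁ q                  = inj₁ (keep a q)
  ... | inj₂ (b , z′ , refl , q) = inj₂ (b , _ , refl , keep a q)

  subset⇒pick : ∀ {P m} (f : Fin m → Fin n) (g : Fin m → Root M) (X : Subset m) → (∀ i → i Sub.∈ X → P (g i)) →
    Pick P (tabulate (λ i → f i , g i)) (sub M f X)
  subset⇒pick {m = zero} f g [] p = nil
  subset⇒pick {m = suc m} f g (true ∷ X) p  = keep (p zero Vec.here) (subset⇒pick (f ∘ suc) (g ∘ suc) X (λ i i∈ → p (suc i) (Vec.there i∈)))
  subset⇒pick {m = suc m} f g (false ∷ X) p = omit (subset⇒pick (f ∘ suc) (g ∘ suc) X (λ i i∈ → p (suc i) (Vec.there i∈)))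

  pick⇒subset : ∀ {P m} (f : Fin m → Fin n) (g : Fin m → Root M) {z} → Pick P (tabulate (λ i → f i , g i)) z →
    Σ (Subset m) λ X → (∀ i → i Sub.∈ X → P (g i)) × sub M f X ≡ z
  pick⇒subset {m = zero} f g nil = [] , (λ ()) , refl
  pick⇒subset {m = suc m} f g (omit p) with X , q , e ← pick⇒subset (f ∘ suc) (g ∘ suc) p
    = false ∷ X , (λ { (suc i) (Vec.there i∈) → q i i∈ }) , e
  pick⇒subset {m = suc m} f g (keep a p) with X , q , e ← pick⇒subset (f ∘ suc) (g ∘ suc) p
    = true ∷ X , (λ { zero Vec.here → a ; (suc i) (Vec.there i∈) → q i i∈ }) , cong (f zero ∷_) e

  conj : Word n → Fin n → Word n
  conj x t = x ++ t ∷ reverse x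

  negs : Word n → List Label
  negs = map (λ t → t , neg t)

  inversions : Word n → Word n → List Label
  inversions pre []      = []
  inversions pre (t ∷ w) = (t , pos (conj pre t)) ∷ inversions (pre ++ [ t ]) w

  tabulate-inversions : ∀ pre w → tabulate (λ k → lookup w k , pos (conj (pre ++ take (toℕ k) w) (lookup w k))) ≡ inversions pre w
  tabulate-inversions pre []      = refl
  tabulate-inversions pre (t ∷ w) = cong₂ _∷_ (cong (λ x → t , pos (conj x t)) (++-identityʳ pre))
    (trans (tabulate-cong (λ k → cong (λ x → lookup w k , pos (conj x (lookup w k))) (sym (++-assoc pre [ t ] (take (toℕ k) w)))))
      (tabulate-inversions (pre ++ [ t ]) w))

  tabulate-Q : ∀ c w → tabulate (λ i → Qletter M c w i , Lr M c w i) ≡ negs c ++ inversions [] w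
  tabulate-Q [] w      = tabulate-inversions [] w
  tabulate-Q (t ∷ c) w = cong ((t , neg t) ∷_) (trans (tabulate-cong shift-index) (tabulate-Q c w))
    where
    shift-index : ∀ i → (Qletter M (t ∷ c) w (suc i) , Lr M (t ∷ c) w (suc i)) ≡ (Qletter M c w i , Lr M c w i)
    shift-index i with splitAt (length c) i
    ... | inj₁ _ = refl
    ... | inj₂ _ = refl

  FaceL : Word n → List Label → (Root M → Set) → Set
  FaceL w0 Q P = Σ (Word n) λ z → Pick P Q z × (z ≋ w0) × Reduced M z

  face⇒faceL : ∀ {w0 c w β₁ β₂} → Face M w0 c w β₁ β₂ → FaceL w0 (negs c ++ inversions [] w) (Avoids β₁ β₂)
  face⇒faceL {w0} {c} {w} {β₁} {β₂} (X , av , p , r) = _ , subst (λ Q → Pick (Avoids β₁ β₂) Q _) (tabulate-Q c w)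
    (subset⇒pick (Qletter M c w) (Lr M c w) X av) , p , r

  faceL⇒face : ∀ {w0 c w β₁ β₂} → FaceL w0 (negs c ++ inversions [] w) (Avoids β₁ β₂) → Face M w0 c w β₁ β₂
  faceL⇒face {w0} {c} {w} {β₁} {β₂} (z , pick , p , r)
    with X , av , refl ← pick⇒subset (Qletter M c w) (Lr M c w) (subst (λ Q → Pick (Avoids β₁ β₂) Q z) (sym (tabulate-Q c w)) pick)
    = X , av , p , r

  infix 4 _≈ᴸ_
  data _≈ᴸ_ : List Label → List Label → Set where
    ≈ᴸ-refl  : ∀ {Q} → Q ≈ᴸ Q
    ≈ᴸ-trans : ∀ {Q R S} → Q ≈ᴸ R → R ≈ᴸ S → Q ≈ᴸ S
    ≈ᴸ-∷     : ∀ {t ρ ρ′ Q R} → ρ ~ʳ ρ′ → Q ≈ᴸ R → (t , ρ) ∷ Q ≈ᴸ (t , ρ′) ∷ R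
    ≈ᴸ-swap  : ∀ {s t} → Commutes s t → ∀ {ρ ρ′ Q} → (s , ρ) ∷ (t , ρ′) ∷ Q ≈ᴸ (t , ρ′) ∷ (s , ρ) ∷ Q

  ≈ᴸ-sym : ∀ {Q R} → Q ≈ᴸ R → R ≈ᴸ Q
  ≈ᴸ-sym ≈ᴸ-refl                    = ≈ᴸ-refl
  ≈ᴸ-sym (≈ᴸ-trans p q)             = ≈ᴸ-trans (≈ᴸ-sym q) (≈ᴸ-sym p)
  ≈ᴸ-sym (≈ᴸ-∷ {ρ = ρ} {ρ′} p q)    = ≈ᴸ-∷ (~ʳ-sym {ρ} {ρ′} p) (≈ᴸ-sym q)
  ≈ᴸ-sym (≈ᴸ-swap c)                = ≈ᴸ-swap (Commutes-sym c)

  ≈ᴸ-++ : ∀ {Q Q′ R R′} → Q ≈ᴸ Q′ → R ≈ᴸ R′ → Q ++ R ≈ᴸ Q′ ++ R′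
  ≈ᴸ-++ {Q} {_} {R} {R′} ≈ᴸ-refl r = prefix Q
    where
    prefix : ∀ Q → Q ++ R ≈ᴸ Q ++ R′
    prefix []            = r
    prefix ((_ , ρ) ∷ Q) = ≈ᴸ-∷ (~ʳ-refl {ρ}) (prefix Q)
  ≈ᴸ-++ (≈ᴸ-trans p q) r = ≈ᴸ-trans (≈ᴸ-++ p r) (≈ᴸ-++ q ≈ᴸ-refl)
  ≈ᴸ-++ (≈ᴸ-∷ x p) r     = ≈ᴸ-∷ x (≈ᴸ-++ p r)
  ≈ᴸ-++ {R = R} {R′} (≈ᴸ-swap c {ρ} {ρ′} {Q}) r = ≈ᴸ-trans (≈ᴸ-swap c) (≈ᴸ-∷ (~ʳ-refl {ρ′}) (≈ᴸ-∷ (~ʳ-refl {ρ}) (≈ᴸ-++ (≈ᴸ-refl {Q}) r)))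

  pick-≈ᴸ : ∀ {P Q R z} → (∀ {ρ ρ′} → ρ ~ʳ ρ′ → P ρ → P ρ′) → Q ≈ᴸ R → Pick P Q z → Σ (Word n) λ z′ → Pick P R z′ × (z ~ᶜ z′)
  pick-≈ᴸ resp ≈ᴸ-refl p = _ , p , ~refl
  pick-≈ᴸ resp (≈ᴸ-trans a b) p with _ , p′ , e ← pick-≈ᴸ resp a p with _ , p″ , e′ ← pick-≈ᴸ resp b p′ = _ , p″ , ~trans e e′
  pick-≈ᴸ resp (≈ᴸ-∷ x a) (omit p) with _ , p′ , e ← pick-≈ᴸ resp a p = _ , omit p′ , e
  pick-≈ᴸ resp (≈ᴸ-∷ {t = t} {ρ} {ρ′} x a) (keep av p) with _ , p′ , e ← pick-≈ᴸ resp a p = _ , keep (resp {ρ} {ρ′} x av) p′ , ~∷ t e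
  pick-≈ᴸ resp (≈ᴸ-swap c) (omit (omit p))       = _ , omit (omit p) , ~refl
  pick-≈ᴸ resp (≈ᴸ-swap c) (omit (keep b p))     = _ , keep b (omit p) , ~refl
  pick-≈ᴸ resp (≈ᴸ-swap c) (keep a (omit p))     = _ , omit (keep a p) , ~refl
  pick-≈ᴸ resp (≈ᴸ-swap c) (keep a (keep b p))   = _ , keep b (keep a p) , ~swap c _

  faceL-≈ᴸ : ∀ {w0 Q R β₁ β₂} → Q ≈ᴸ R → FaceL w0 Q (Avoids β₁ β₂) → FaceL w0 R (Avoids β₁ β₂)
  faceL-≈ᴸ {β₁ = β₁} {β₂} e (z , p , q , r) with z′ , p′ , z~ ← pick-≈ᴸ (λ {ρ} {ρ′} → avoids-cong {β₁} {β₂} {ρ} {ρ′}) e p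
    = z′ , p′ , ≈trans (≈sym (~⇒≋ z~)) q , reduced-cong (~⇒≋ z~) (~⇒length z~) r

  negs-~ : ∀ {c c′} → c ~ᶜ c′ → negs c ≈ᴸ negs c′
  negs-~ ~refl        = ≈ᴸ-refl
  negs-~ (~trans p q) = ≈ᴸ-trans (negs-~ p) (negs-~ q)
  negs-~ (~∷ s p)     = ≈ᴸ-∷ refl (negs-~ p)
  negs-~ (~swap c u)  = ≈ᴸ-swap c

  conj-++ : ∀ x t → conj x t ++ x ≋ x ++ [ t ]
  conj-++ x t = begin
    (x ++ t ∷ reverse x) ++ x    ≡⟨ ++-assoc x (t ∷ reverse x) x ⟩
    x ++ t ∷ reverse x ++ x      ≈⟨ ++-congˡ x (∷-cong t (inverseˡ x)) ⟩
    x ++ [ t ] ∎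
    where open SetoidReasoning ≋-setoid

  -- Since x can be cancelled, the equation determines the reflection; comparing reflections thus
  -- needs no manipulation of reversed words.
  conj-unique : ∀ {x t r} → r ++ x ≋ x ++ [ t ] → r ≋ conj x t
  conj-unique {x} {t} p = cancelʳ x (≈trans p (≈sym (conj-++ x t)))

  conj-cong : ∀ {x y} → x ≋ y → ∀ t → conj x t ≋ conj y t
  conj-cong {x} {y} p t = conj-unique (≈trans (++-congˡ (conj x t) (≈sym p)) (≈trans (conj-++ x t) (++-congʳ [ t ] p)))

  -- The reflection s fixes α_t. This is why a commutation in w permutes the labels of the
  -- inversions together with the letters.
  conj-commute : ∀ {s t} → Commutes s t → ∀ x → conj (x ++ [ s ]) t ≋ conj x t
  conj-commute {s} {t} comm x = ≈sym (conj-unique (begin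
    conj x t ++ x ++ [ s ]      ≡⟨ ++-assoc (conj x t) x [ s ] ⟨
    (conj x t ++ x) ++ [ s ]    ≈⟨ ++-congʳ [ s ] (conj-++ x t) ⟩
    (x ++ [ t ]) ++ [ s ]       ≡⟨ ++-assoc x [ t ] [ s ] ⟩
    x ++ t ∷ s ∷ []             ≈⟨ ++-congˡ x (~⇒≋ (~swap (Commutes-sym comm) [])) ⟩
    x ++ s ∷ t ∷ []             ≡⟨ ++-assoc x [ s ] [ t ] ⟨
    (x ++ [ s ]) ++ [ t ] ∎))
    where open SetoidReasoning ≋-setoid

  inversions-cong : ∀ w {x y} → x ≋ y → inversions x w ≈ᴸ inversions y w
  inversions-cong [] p      = ≈ᴸ-refl
  inversions-cong (t ∷ w) p = ≈ᴸ-∷ (conj-cong p t) (inversions-cong w (++-congʳ [ t ] p))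

  inversions-~ : ∀ {w w′} → w ~ᶜ w′ → ∀ x → inversions x w ≈ᴸ inversions x w′
  inversions-~ ~refl x        = ≈ᴸ-refl
  inversions-~ (~trans p q) x = ≈ᴸ-trans (inversions-~ p x) (inversions-~ q x)
  inversions-~ (~∷ s p) x     = ≈ᴸ-∷ (≈refl {u = conj x s}) (inversions-~ p (x ++ [ s ]))
  inversions-~ (~swap {s} {t} c w) x = ≈ᴸ-trans (≈ᴸ-swap c)
    (≈ᴸ-∷ (conj-commute c x) (≈ᴸ-∷ (≈sym (conj-commute (Commutes-sym c) x)) (inversions-cong w swapped)))
    where
    swapped : (x ++ [ s ]) ++ [ t ] ≋ (x ++ [ t ]) ++ [ s ]
    swapped = ≈trans (≡⇒≋ (++-assoc x [ s ] [ t ])) (≈trans (++-congˡ x (~⇒≋ (~swap c []))) (≡⇒≋ (sym (++-assoc x [ t ] [ s ]))))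

  inversions-snoc : ∀ x w r → inversions x (w ++ [ r ]) ≡ inversions x w ++ [ (r , pos (conj (x ++ w) r)) ]
  inversions-snoc x [] r      = cong (λ y → [ (r , pos (conj y r)) ]) (sym (++-identityʳ x))
  inversions-snoc x (t ∷ w) r = cong ((t , pos (conj x t)) ∷_) (trans (inversions-snoc (x ++ [ t ]) w r)
    (cong (λ y → inversions (x ++ [ t ]) w ++ [ (r , pos (conj y r)) ]) (++-assoc x [ t ] w)))

  module Rotation (s : Fin n) where

    -- That ρ′ is the image of ρ under σ_s, expressed through the only tests a face makes:
    -- comparison with β on one side and with a σ_s-image γ on the other.
    Match : Root M → Root M → Set
    Match ρ ρ′ = ∀ {β γ} → Sigma M s β γ → (ρ ~ʳ β → ρ′ ~ʳ γ) × (ρ′ ~ʳ γ → ρ ~ʳ β)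

    conjugate-back : ∀ {u v} → u ≋ s ∷ v ++ [ s ] → s ∷ u ++ [ s ] ≋ v
    conjugate-back {u} {v} p = ≈trans (∷-cong s (++-congʳ [ s ] p)) (≈trans (∷-cancel s ((v ++ [ s ]) ++ [ s ])) (snoc-cancel v s))

    conjugate-forth : ∀ {u v} → s ∷ u ++ [ s ] ≋ v → u ≋ s ∷ v ++ [ s ]
    conjugate-forth {u} p = ≈sym (conjugate-back (≈sym p))

    sss : s ∷ [ s ] ++ [ s ] ≋ [ s ]
    sss = ∷-cancel s [ s ]

    match-neg : ∀ {t} → t ≢ s → Match (neg t) (neg t)
    match-neg t≢s (σ-neg≠ _) = (λ e → e) , (λ e → e)
    match-neg t≢s σ-negs     = (λ e → contradiction e t≢s) , (λ ())
    match-neg t≢s (σ-poss _) = (λ ()) , (λ e → contradiction e t≢s)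
    match-neg t≢s (σ-pos≠ _) = (λ ()) , (λ ())

    match-pos-s : Match (pos [ s ]) (neg s)
    match-pos-s (σ-neg≠ t≢s) = (λ ()) , (λ e → contradiction (sym e) t≢s)
    match-pos-s σ-negs       = (λ ()) , (λ ())
    match-pos-s (σ-poss p)   = (λ _ → refl) , (λ _ → ≈sym p)
    match-pos-s (σ-pos≠ ¬p)  = (λ p → contradiction (≈sym p) ¬p) , (λ ())

    match-neg-s : ∀ {r} → r ≋ [ s ] → Match (neg s) (pos r)
    match-neg-s r≋ (σ-neg≠ t≢s) = (λ e → contradiction (sym e) t≢s) , (λ ())
    match-neg-s r≋ σ-negs       = (λ _ → r≋) , (λ _ → refl)
    match-neg-s r≋ (σ-poss _)   = (λ ()) , (λ ())
    match-neg-s r≋ (σ-pos≠ ¬p)  = (λ ()) , (λ p → contradiction (≈trans (conjugate-forth (≈trans (≈sym p) r≋)) sss) ¬p)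

    match-pos : ∀ {r r′} → ¬ (r′ ≋ [ s ]) → r ≋ s ∷ r′ ++ [ s ] → Match (pos r) (pos r′)
    match-pos ¬s p (σ-neg≠ _) = (λ ()) , (λ ())
    match-pos ¬s p σ-negs     = (λ ()) , (λ q → contradiction q ¬s)
    match-pos ¬s p (σ-poss q) = (λ e → contradiction (≈trans (conjugate-forth (≈trans (≈sym p) (≈trans e q))) sss) ¬s) , (λ ())
    match-pos ¬s p (σ-pos≠ _) = (λ e → conjugate-forth (≈trans (≈sym p) e))
      , (λ e → ≈trans p (≈trans (∷-cong s (++-congʳ [ s ] e)) (conjugate-back ≈refl)))

    data Matched : List Label → List Label → Set where
      []  : Matched [] []
      _∷_ : ∀ {t ρ ρ′ Q R} → Match ρ ρ′ → Matched Q R → Matched ((t , ρ) ∷ Q) ((t , ρ′) ∷ R)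

    matched-++ : ∀ {Q Q′ R R′} → Matched Q Q′ → Matched R R′ → Matched (Q ++ R) (Q′ ++ R′)
    matched-++ [] r      = r
    matched-++ (m ∷ q) r = m ∷ matched-++ q r

    matched-negs : ∀ d → s ∉ d → Matched (negs d) (negs d)
    matched-negs [] _       = []
    matched-negs (t ∷ d) s∉ = match-neg (λ t≡s → s∉ (here (sym t≡s))) ∷ matched-negs d (s∉ ∘ there)

    matched-inversions : ∀ x w → Reduced M (s ∷ x ++ w) → Matched (inversions (s ∷ x) w) (inversions x w)
    matched-inversions x [] red      = []
    matched-inversions x (t ∷ w) red = match-pos not-s conj-s
      ∷ matched-inversions (x ++ [ t ]) w (subst (Reduced M) (cong (s ∷_) (sym (++-assoc x [ t ] w))) red)
      where
      conj-s : conj (s ∷ x) t ≋ s ∷ conj x t ++ [ s ]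
      conj-s = ≡⇒≋ (cong (s ∷_) (trans (cong (λ y → x ++ t ∷ y) (unfold-reverse s x)) (sym (++-assoc x (t ∷ reverse x) [ s ]))))
      not-s : ¬ (conj x t ≋ [ s ])
      -- Otherwise s x = x t in W, and then s x t w = x w would be a shorter expression of a reduced
      -- word.
      not-s p = ℕₚ.<-irrefl refl (begin-strict
        length (x ++ w)            <⟨ ℕₚ.n<1+n _ ⟩
        suc (length (x ++ w))      ≡⟨ cong suc (length-++ x) ⟩
        suc (length x ℕ.+ length w) ≡⟨ ℕₚ.+-suc (length x) (length w) ⟨
        length x ℕ.+ suc (length w) ≡⟨ length-++ x ⟨
        length (x ++ t ∷ w)        ≤⟨ ℕₚ.n≤1+n _ ⟩
        length (s ∷ x ++ t ∷ w)    ≤⟨ red (x ++ w) (≈sym shorter) ⟩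
        length (x ++ w) ∎)
        where
        open ℕₚ.≤-Reasoning
        shorter : s ∷ x ++ t ∷ w ≋ x ++ w
        shorter = ≈trans (++-congʳ (t ∷ w) (≈trans (++-congʳ x (≈sym p)) (conj-++ x t)))
          (≈trans (≡⇒≋ (++-assoc x [ t ] (t ∷ w))) (++-congˡ x (∷-cancel t w)))

    module _ {β₁ β₂ γ₁ γ₂ : Root M} (σ₁ : Sigma M s β₁ γ₁) (σ₂ : Sigma M s β₂ γ₂) where

      avoid⇒ : ∀ {ρ ρ′} → Match ρ ρ′ → Avoids β₁ β₂ ρ → Avoids γ₁ γ₂ ρ′
      avoid⇒ m (a , b) = a ∘ proj₂ (m σ₁) , b ∘ proj₂ (m σ₂)

      avoid⇐ : ∀ {ρ ρ′} → Match ρ ρ′ → Avoids γ₁ γ₂ ρ′ → Avoids β₁ β₂ ρ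
      avoid⇐ m (a , b) = a ∘ proj₁ (m σ₁) , b ∘ proj₁ (m σ₂)

      pick⇒ : ∀ {Q R z} → Matched Q R → Pick (Avoids β₁ β₂) Q z → Pick (Avoids γ₁ γ₂) R z
      pick⇒ [] nil              = nil
      pick⇒ (m ∷ ms) (omit p)   = omit (pick⇒ ms p)
      pick⇒ (m ∷ ms) (keep a p) = keep (avoid⇒ m a) (pick⇒ ms p)

      pick⇐ : ∀ {Q R z} → Matched Q R → Pick (Avoids γ₁ γ₂) R z → Pick (Avoids β₁ β₂) Q z
      pick⇐ [] nil              = nil
      pick⇐ (m ∷ ms) (omit p)   = omit (pick⇐ ms p)
      pick⇐ (m ∷ ms) (keep a p) = keep (avoid⇐ m a) (pick⇐ ms p)

      -- A subword keeping the first letter is s z with z = w in W, so z r is again w∘, of the same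
      -- length; the converse is symmetric. A subword omitting it omits the last letter on the other
      -- side.
      rotate : ∀ {w0 w r Q R} → s ∷ w ≋ w0 → w ++ [ r ] ≋ w0 → Matched Q R →
        FaceL w0 ((s , neg s) ∷ Q) (Avoids β₁ β₂) ⇔ FaceL w0 (R ++ [ (r , pos (conj w r)) ]) (Avoids γ₁ γ₂)
      rotate {w0} {w} {r} {Q} {R} sw wr ms = mk⇔ to from
        where
        -- From s w = w r in W, the label of the last letter is the reflection s, the image of -α_s
        -- under σ_s.
        m-last : Match (neg s) (pos (conj w r))
        m-last = match-neg-s (≈sym (conj-unique (≈trans sw (≈sym wr))))
        same-length : ∀ z → length (s ∷ z) ≡ length (z ++ [ r ])
        same-length z = sym (length-snoc z r)
        to : FaceL w0 ((s , neg s) ∷ Q) (Avoids β₁ β₂) → FaceL w0 (R ++ [ (r , pos (conj w r)) ]) (Avoids γ₁ γ₂)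
        to (z , omit p , e , red)     = z , snoc-omit (pick⇒ ms p) , e , red
        to (.s ∷ z , keep a p , e , red) = z ++ [ r ] , snoc-keep (avoid⇒ m-last a) (pick⇒ ms p) , zr
          , reduced-cong (≈trans e (≈sym zr)) (same-length z) red
          where
          zr : z ++ [ r ] ≋ w0
          zr = ≈trans (++-congʳ [ r ] (cancelˡ [ s ] (≈trans e (≈sym sw)))) wr
        from : FaceL w0 (R ++ [ (r , pos (conj w r)) ]) (Avoids γ₁ γ₂) → FaceL w0 ((s , neg s) ∷ Q) (Avoids β₁ β₂)
        from (z , p , e , red) with pick-snoc R p
        ... | inj₁ q = z , omit (pick⇐ ms q) , e , red
        ... | inj₂ (b , z′ , refl , q) = s ∷ z′ , keep (avoid⇐ m-last b) (pick⇐ ms q) , sz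
          , reduced-cong (≈trans e (≈sym sz)) (sym (same-length z′)) red
          where
          sz : s ∷ z′ ≋ w0
          sz = ≈trans (∷-cong s (cancelʳ [ r ] (≈trans e (≈sym wr)))) sw

-- Rotation of c w∘(c) into c′ w∘(c′)

module Rotate {n : ℕ} (M : Fin n → Fin n → ℕ) (cox : IsCoxeterMatrix M) (_≋?_ : ∀ u v → Dec (_≈_ M u v))
  {w0 : Word n} (longest : Longest M w0) where
  open Words M
  open Length M _≋?_
  open Positivity M cox _≋?_
  open Euler M cox _≋?_
  open Commutation M cox _≋?_
  open AdaptedWords M cox _≋?_
  open Faces M cox _≋?_

  len-w0 : len w0 ≡ length w0
  len-w0 = reduced⇒len (proj₁ longest)

  left-descent-w0 : ∀ s {u} → u ≋ w0 → len (s ∷ u) < len u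
  left-descent-w0 s {u} p = subst₂ _<_ (len-cong (∷-cong s (≈sym p))) (len-cong (≈sym p))
    (ℕₚ.≤-reflexive (trans (cong suc (sym (trans (len-cong (≡⇒≋ (sym (unfold-reverse s w0)))) (len-reverse (s ∷ w0)))))
      (trans (sym descent) (len-reverse w0))))
    where
    descent : Descent (reverse w0) s
    descent = ¬ascent⇒descent {reverse w0} {s} λ a → ℕₚ.<-irrefl refl
      (ℕₚ.≤-trans (ℕₚ.≤-reflexive (trans (cong suc (sym (trans (len-reverse w0) len-w0))) (sym a))) (len≤longest longest (reverse w0 ++ [ s ])))

  maximal⇒≋ : ∀ {x} → len x ≡ length w0 → x ≋ w0
  maximal⇒≋ {x} e = all-descents⇒longest longest {x} λ t → ¬ascent⇒descent {x} {t} λ a → ℕₚ.<-irrefl refl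
    (ℕₚ.≤-trans (ℕₚ.≤-reflexive (trans (cong suc (sym e)) (sym a))) (len≤longest longest (x ++ [ t ])))

  -- If no letter lengthened w, then w would be w∘ while being one letter too short. A lengthening
  -- letter reaches the maximal length, which only w∘ has.
  complete : ∀ {s w} → Reduced M (s ∷ w) → s ∷ w ≋ w0 → ∃ λ r → Reduced M (w ++ [ r ]) × w ++ [ r ] ≋ w0
  complete {s} {w} red p with Finₚ.any? (λ r → len (w ++ [ r ]) ℕ.≟ suc (len w))
  ... | yes (r , a) = r , ascent⇒reduced-snoc {w} {r} redw a , maximal⇒≋ (trans a (trans (cong suc (reduced⇒len redw)) (reduced-≋-length red (proj₁ longest) p)))
    where
    redw : Reduced M w
    redw = reduced-++ʳ [ s ] w red
  ... | no ¬a = contradiction (trans (sym (reduced⇒len red)) (trans (len-cong p) (trans (sym (len-cong w≋)) (reduced⇒len (reduced-++ʳ [ s ] w red))))) ℕₚ.1+n≢n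
    where
    w≋ : w ≋ w0
    w≋ = all-descents⇒longest longest {w} (λ t → ¬ascent⇒descent {w} {t} (λ a → ¬a (t , a)))

  module _ {c c′ : Word n} (permc : c ↭ allFin n) {s : Fin n} (init : len (s ∷ c) < len c)
    (c′≋ : c′ ≋ s ∷ c ++ [ s ]) (redc′ : Reduced M c′)
    {ws : List (Pos M (length c))} (lex : IsLexFirstWo M w0 c ws)
    {ws′ : List (Pos M (length c′))} (lex′ : IsLexFirstWo M w0 c′ ws′) where

    u u′ : Word n
    u  = letters M c ws
    u′ = letters M c′ ws′

    all-in : ∀ {d} → d ↭ allFin n → ∀ t → t ∈ d
    all-in p t = ∈-resp-↭ (↭-sym p) (∈-allFin t)

    unique-of : ∀ {d} → d ↭ allFin n → Unique d
    unique-of p = Unique-resp-↭ (↭-sym p) (allFin⁺ n)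

    record Rotated : Set where
      field
        d w   : Word n
        r     : Fin n
        s∉d   : s ∉ d
        c~    : c ~ᶜ s ∷ d
        u~    : u ~ᶜ s ∷ w
        c′~   : c′ ~ᶜ d ++ [ s ]
        u′~   : u′ ~ᶜ w ++ [ r ]
        sw    : s ∷ w ≋ w0
        wr    : w ++ [ r ] ≋ w0
        redsw : Reduced M (s ∷ w)

    u≋ : u ≋ w0
    u≋ = proj₂ (proj₂ (proj₁ lex))

    u′≋ : u′ ≋ w0
    u′≋ = proj₂ (proj₂ (proj₁ lex′))

    redu : Reduced M u
    redu = proj₁ (proj₂ (proj₁ lex))

    redu′ : Reduced M u′
    redu′ = proj₁ (proj₂ (proj₁ lex′))

    s∈u : s ∈ u
    s∈u with z , redz , u≋sz ← left-descent⇒∷ {s} {u} (left-descent-w0 s u≋) = letter-present {s} {u} (left-descent-nonpos redz u≋sz)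

    module _ {d : Word n} (c~ : c ~ᶜ s ∷ d) (uniqd : Unique (s ∷ d)) (c↭ : c ↭ s ∷ d) where

      alld : ∀ t → t ∈ s ∷ d
      alld t = ∈-resp-↭ c↭ (all-in permc t)

      permd : d ++ [ s ] ↭ allFin n
      permd = ↭-trans (++-comm d [ s ]) (↭-trans (↭-sym c↭) permc)

      c′≋ds : c′ ≋ d ++ [ s ]
      c′≋ds = ≈trans c′≋ (≈trans (∷-cong s (++-congʳ [ s ] (~⇒≋ c~))) (∷-cancel s (d ++ [ s ])))

      permc′ : c′ ↭ allFin n
      permc′ = coxeter⇒↭ permd (≈sym c′≋ds) redc′

      c′~ds : c′ ~ᶜ d ++ [ s ]
      c′~ds = unique≋⇒~ (d ++ [ s ]) c′ (unique-of permd) (unique-of permc′) c′≋ds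

      same-ori : flip s (ori (s ∷ d)) ≈ᵒ ori c′
      same-ori t r a = trans (sym (ori-rotate uniqd alld t r a)) (sym (ori-~ c′~ds t r a))

      rotated-by : Rotated
      rotated-by
        with w , u~ , adw ← pull-front u (ori-Antisym alld) (λ r _ → ori-first s d r) s∈u
               (adapted-cong u (ori-~ c~) (Greedy.greedy-adapted M cox _≋?_ longest c (all-in permc) lex (unique-of permc)))
        with redsw ← reduced-cong (~⇒≋ u~) (~⇒length u~) redu
        with sw ← ≈trans (≈sym (~⇒≋ u~)) u≋
        with r , redwr , wr ← complete {s} {w} redsw sw
        with r′ , u′~ ← adapted-unique w {r} {u′} (ori-Antisym (all-in permc′)) (adapted-cong w same-ori adw)
               (Greedy.greedy-adapted M cox _≋?_ longest c′ (all-in permc′) lex′ (unique-of permc′)) redwr redu′ (≈trans wr (≈sym u′≋))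
        -- The last letter recorded is the one occurring in w∘(c′) itself; that it completes `w` to
        -- w∘ follows from `u′~`.
        = record
          { d = d ; w = w ; r = r′ ; s∉d = Unique[x∷xs]⇒x∉xs uniqd ; c~ = c~ ; u~ = u~ ; c′~ = c′~ds ; u′~ = u′~
          ; sw = sw ; wr = ≈trans (≈sym (~⇒≋ u′~)) u′≋ ; redsw = redsw }

    rotated : Rotated
    rotated
      with z , redz , c≋sz ← left-descent⇒∷ {s} {c} init
      with d , c~ , uniqd , c↭ ← pull-letter {s} {c} (unique-of permc) (left-descent-nonpos redz c≋sz)
      = rotated-by c~ uniqd c↭

    face⇔ : ∀ {β₁ β₂ γ₁ γ₂} → Sigma M s β₁ γ₁ → Sigma M s β₂ γ₂ → Face M w0 c u β₁ β₂ ⇔ Face M w0 c′ u′ γ₁ γ₂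
    face⇔ {β₁} {β₂} {γ₁} {γ₂} σ₁ σ₂ = mk⇔
      (λ f → faceL⇒face (faceL-≈ᴸ (≈ᴸ-sym right) (to (faceL-≈ᴸ left (face⇒faceL f)))))
      (λ f → faceL⇒face (faceL-≈ᴸ (≈ᴸ-sym left) (from (faceL-≈ᴸ right (face⇒faceL f)))))
      where
      open Rotated rotated
      open Rotation s
      -- Both words without the rotating letter. The middle label α_s becomes -α_s, the negative
      -- roots of `d` stay, and the prefix s of the inversions disappears, as σ_s prescribes.
      Q R : List Label
      Q = negs d ++ (s , pos [ s ]) ∷ inversions [ s ] w
      R = negs d ++ (s , neg s) ∷ inversions [] w
      open Equivalence (rotate σ₁ σ₂ {Q = Q} {R} sw wr (matched-++ (matched-negs d s∉d) (match-pos-s ∷ matched-inversions [] w redsw)))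
      left : negs c ++ inversions [] u ≈ᴸ (s , neg s) ∷ Q
      left = ≈ᴸ-++ (negs-~ c~) (inversions-~ u~ [])
      regroup : negs (d ++ [ s ]) ++ inversions [] (w ++ [ r ]) ≡ R ++ [ (r , pos (conj w r)) ]
      regroup = begin
        negs (d ++ [ s ]) ++ inversions [] (w ++ [ r ])                             ≡⟨ cong₂ _++_ (map-++ _ d [ s ]) (inversions-snoc [] w r) ⟩
        (negs d ++ [ (s , neg s) ]) ++ inversions [] w ++ [ (r , pos (conj w r)) ]  ≡⟨ ++-assoc (negs d) [ (s , neg s) ] _ ⟩
        negs d ++ (s , neg s) ∷ inversions [] w ++ [ (r , pos (conj w r)) ]         ≡⟨ ++-assoc (negs d) ((s , neg s) ∷ inversions [] w) _ ⟨
        R ++ [ (r , pos (conj w r)) ] ∎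
        where open ≡-Reasoning
      right : negs c′ ++ inversions [] u′ ≈ᴸ R ++ [ (r , pos (conj w r)) ]
      right = subst (negs c′ ++ inversions [] u′ ≈ᴸ_) regroup (≈ᴸ-++ (negs-~ c′~) (inversions-~ u′~ []))

theorem5p7 : ∀ {n : ℕ} (M : Fin n → Fin n → ℕ) → IsCoxeterMatrix M → FiniteW M →
    (c : Word n) → IsCoxeterElement M c → Reduced M c →
    (s : Fin n) → Initial M s c →
    (c' : Word n) → _≈_ M c' (s ∷ c ++ [ s ]) → Reduced M c' →
    (w0 : Word n) → Longest M w0 →
    (ws : List (Pos M (length c))) → IsLexFirstWo M w0 c ws →
    (ws' : List (Pos M (length c'))) → IsLexFirstWo M w0 c' ws' →
    (β₁ β₂ γ₁ γ₂ : Root M) → InPhi M β₁ → InPhi M β₂ →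
    Sigma M s β₁ γ₁ → Sigma M s β₂ γ₂ →
    Face M w0 c (letters M c ws) β₁ β₂ ⇔ Face M w0 c' (letters M c' ws') γ₁ γ₂
theorem5p7 M cox fin c (p , perm , p≋c) redc s (q , q≋sc , q<) c' c'≋ redc' w0 longest ws lex ws' lex' β₁ β₂ γ₁ γ₂ _ _ σ₁ σ₂ =
  Rotate.face⇔ M cox dec longest (Commutation.coxeter⇒↭ M cox dec perm p≋c redc) init c'≋ redc' lex lex' σ₁ σ₂
  where
  dec = Words.≋-dec M fin
  open Length M dec
  init : len (s ∷ c) < len c
  init = ℕₚ.≤-trans (s≤s (len-min q≋sc)) (ℕₚ.≤-trans (q< c ≈refl) (ℕₚ.≤-reflexive (sym (reduced⇒len redc))))
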